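{- Let $p>5$ be a Mersenne prime (i.e. $p=2^n-1$ for some integer $n$) with $p\equiv \pm 2 \pmod 5$. Let $\mathbf{x}=(x_1,x_2,x_3)\in\mathbb{F}_p^3$ satisfy $x_1^2+x_2^2+x_3^2=3x_1x_2x_3$ in $\mathbb{F}_p$. Suppose that for some $i\in\{1,2,3\}$ the order of the matrix \[\begin{pmatrix} 0 & 1 \\ -1 & 3x_i \end{pmatrix}\] in $\mathrm{GL}_2(\mathbb{F}_p)$ is at least $p+1$. Then $\mathbf{x}$ has an integer lift, i.e. there exists $(a,b,c)\in\mathbb{Z}^3$ with $a^2+b^2+c^2=3abc$ and $(a,b,c)\equiv (x_1,x_2,x_3)\pmod p$. -}

module Defs where

open import Data.Nat as ℕ using (ℕ; zero; suc)
open import Data.Integer using (ℤ; +_; _+_; _-_; _*_; -_)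
open import Data.Integer.Divisibility using (_∣_)
open import Relation.Nullary using (¬_)
open import Data.Product using (_×_)

-- Congruence of integers modulo a natural number p.
-- Elements of 𝔽_p are represented by integer representatives;
-- equality in 𝔽_p is congruence mod p.
infix 4 _≡_[mod_] _≡ᴹ_[mod_]

_≡_[mod_] : ℤ → ℤ → ℕ → Set
a ≡ b [mod p ] = (+ p) ∣ (a - b)

-- 2×2 integer matrices (representatives of matrices over 𝔽_p)
record Mat2 : Set where
  constructor mat
  field
    m11 m12 m21 m22 : ℤ
open Mat2 public

_⊗_ : Mat2 → Mat2 → Mat2
A ⊗ B = mat (m11 A * m11 B + m12 A * m21 B) (m11 A * m12 B + m12 A * m22 B)
            (m21 A * m11 B + m22 A * m21 B) (m21 A * m12 B + m22 A * m22 B)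

I₂ : Mat2
I₂ = mat (+ 1) (+ 0) (+ 0) (+ 1)

_^ᴹ_ : Mat2 → ℕ → Mat2
A ^ᴹ zero = I₂
A ^ᴹ suc k = A ⊗ (A ^ᴹ k)

_≡ᴹ_[mod_] : Mat2 → Mat2 → ℕ → Set
A ≡ᴹ B [mod p ] = (m11 A ≡ m11 B [mod p ]) × (m12 A ≡ m12 B [mod p ])
                × (m21 A ≡ m21 B [mod p ]) × (m22 A ≡ m22 B [mod p ])

OrderAtLeast : ℕ → Mat2 → ℕ → Set
OrderAtLeast p A m = ∀ (k : ℕ) → 1 ℕ.≤ k → k ℕ.< m → ¬ ((A ^ᴹ k) ≡ᴹ I₂ [mod p ])

Mx : ℤ → Mat2
Mx x = mat (+ 0) (+ 1) (- (+ 1)) (+ 3 * x)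

markov : ℤ → ℤ → ℤ → ℤ
markov a b c = a * a + b * b + c * c - (+ 3) * a * b * c

{-# OPTIONS --safe #-}
module Submission where

-- Put X = 3x, so that the equation becomes X² + Y² + Z² = XYZ. For fixed X it describes a conic on which
-- ρ (y , z) = (z , Xz − y) acts; ρ is a Vieta involution followed by a swap, so it preserves solutions with
-- integer lifts. If ρ has order at least p + 1, the conic has at most p + 1 points and is a single orbit: as soon as
-- one of its points lifts, all do. The same holds, with the help of the swap, when X is "regular", that is when
-- X² − 4 is a nonsquare and ρ has order p + 1 or (p + 1)/2. As 5 is a nonsquare mod p, X = 3 is regular, and its
-- conic contains the solution (1 , 1 , 1).
--
-- Hence it suffices to join 3 to the given X by a chain of regular traces in which neighbours X, y lie on a common
-- solution, i.e. (X² − 4)(y² − 4) − 16 is a square. Because p + 1 is a power of 2, the nonregular elliptic traces lie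
-- low in the tree of t ↦ t² − 2, so they are few; a second moment bound for the sums Σ χ(w(w − 1)(w − l)) then gives
-- every regular trace at least (p + 1)/256 regular neighbours. The matrix χ(w − l) has nearly orthogonal rows,
-- so two sets of that size cannot be completely non-adjacent once p + 1 ≥ 2¹⁹: there is a chain 3 — y — y′ — X.
-- The only smaller primes satisfying the hypotheses are 7 and 127, where explicit Markov triples suffice.

open import Defs
open import Data.Nat as ℕ using (ℕ; zero; suc)
import Data.Nat.Properties as ℕ
import Data.Nat.Divisibility as ℕ
import Data.Nat.DivMod as ℕ
open import Data.Nat.Solver using () renaming (module +-*-Solver to ℕS)
open import Data.Nat.Primality using (Prime; prime⇒nonZero; prime⇒irreducible)
open import Data.Nat.Coprimality using (coprime-Bézout; prime⇒coprime)
open import Data.Nat.GCD using (module Bézout)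
open import Data.Integer as ℤ using (ℤ; +_; -[1+_])
import Data.Integer.Properties as ℤ
open import Data.Integer.DivMod using (_%ℕ_; _/ℕ_; n%ℕd<d; a≡a%ℕn+[a/ℕn]*n)
open import Data.Integer.Divisibility.Signed using (∣ᵤ⇒∣; ∣⇒∣ᵤ; divides)
open import Data.Integer.Solver using () renaming (module +-*-Solver to ℤS)
open import Data.Fin as Fin using (Fin; zero; suc; toℕ; fromℕ<)
import Data.Fin.Properties as Fin
open import Data.Fin.Permutation using (permutation)
open import Data.List using (List; []; _∷_; _++_; length; map)
open import Data.List.Relation.Unary.All as All using (All; []; _∷_)
open import Data.List.Relation.Unary.AllPairs using (AllPairs; []; _∷_)
open import Data.List.Relation.Unary.Any as Any using (Any)
open import Data.Maybe using (Maybe; just; nothing)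
open import Data.Sum using (_⊎_; inj₁; inj₂; [_,_]′)
open import Data.Product using (∃; _×_; _,_; proj₁; proj₂; uncurry)
open import Data.Product.Properties using (≡-dec)
open import Data.Empty using (⊥-elim)
open import Function using (_∘_)
open import Relation.Nullary using (¬_; Dec; yes; no; ¬?)
open import Relation.Nullary.Decidable using (_×-dec_; _⊎-dec_; map′; decidable-stable; from-yes)
open import Relation.Binary using (DecidableEquality; tri<; tri≈; tri>)
open import Relation.Binary.PropositionalEquality
open import Algebra using (CommutativeRing; IsCommutativeRing)
open import Algebra.Solver.Ring.AlmostCommutativeRing using (fromCommutativeRing; _-Raw-AlmostCommutative⟶_)
import Algebra.Solver.Ring
open import Algebra.Properties.Semiring.Sum ℤ.+-*-semiring using (sum; ∑-distrib-+; *-distribˡ-sum; sum-permute; sum-cong-≗; sum-replicate-zero)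

-- The field with p elements

-- With q = p + 1, the constants come from one tight balance. For elliptic X, four times the number
-- of elliptic neighbours is at least q + L, where L = Σ χ(w(w - 1)(w - l)) and l = X²/(X² - 4).
-- From this the nonregular traces must be subtracted. Were regularity to mean order q alone, the
-- bound for their number would be q/4 + 1, and four times that already consumes q; admitting order
-- q/2 lowers it to q/8 + 1, at the price of a conic that splits into two orbits, which the swap
-- exchanges. It remains to keep L above -q/2 by a fixed proportion. Instead of Hasse's theorem for
-- the curve s² = w(w - 1)(w - l), it suffices that L² summed over all l is at most p² and that the
-- anharmonic group supplies five parameters with the same L²: then |L| ≤ p/√5, where four
-- parameters would give p/2 and no margin. As 1/√5 < 15/32, a share of q/32 survives, whence the
-- q/256 neighbours.

record PrimeField (p : ℕ) : Set where
  infixl 6 _+_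
  infixl 7 _*_
  infix 8 -_
  field
    ⟦_⟧ : ℤ → Fin p
    _+_ _*_ : Fin p → Fin p → Fin p
    -_ inv : Fin p → Fin p
    isCommutativeRing : IsCommutativeRing _≡_ _+_ _*_ -_ ⟦ + 0 ⟧ ⟦ + 1 ⟧
    ⟦toℕ⟧ : ∀ x → ⟦ + toℕ x ⟧ ≡ x
    ⟦⟧-cong : ∀ a b → a ≡ b [mod p ] → ⟦ a ⟧ ≡ ⟦ b ⟧
    ⟦⟧-injective : ∀ a b → ⟦ a ⟧ ≡ ⟦ b ⟧ → a ≡ b [mod p ]
    +-homo : ∀ a b → ⟦ a ℤ.+ b ⟧ ≡ ⟦ a ⟧ + ⟦ b ⟧
    *-homo : ∀ a b → ⟦ a ℤ.* b ⟧ ≡ ⟦ a ⟧ * ⟦ b ⟧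
    -‿homo : ∀ a → ⟦ ℤ.- a ⟧ ≡ - ⟦ a ⟧
    *-inverseʳ : ∀ x → x ≢ ⟦ + 0 ⟧ → x * inv x ≡ ⟦ + 1 ⟧
    -- With this convention `inv` is an involution of the whole field, so `∑-reindex` applies to
    -- substitutions through 1/x with no exception at 0.
    inv-zero : inv ⟦ + 0 ⟧ ≡ ⟦ + 0 ⟧

module _ (p : ℕ) (pr : Prime p) where
  private
    instance
      p≢0 : ℕ.NonZero p
      p≢0 = prime⇒nonZero pr

    res : ℤ → Fin p
    res a = fromℕ< (n%ℕd<d a p)

    rep : Fin p → ℤ
    rep x = + toℕ x

    infix 4 _∼_
    record _∼_ (a b : ℤ) : Set where
      constructor congruent
      field
        quotient : ℤ
        difference : a ℤ.- b ≡ quotient ℤ.* + p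

    fromMod : ∀ {a b} → a ≡ b [mod p ] → a ∼ b
    fromMod h with ∣ᵤ⇒∣ h
    ... | divides k e = congruent k e

    toMod : ∀ {a b} → a ∼ b → a ≡ b [mod p ]
    toMod (congruent k e) = ∣⇒∣ᵤ (divides k e)

    -- Congruences are derived by exhibiting a difference as an explicit ℤ-combination of known
    -- differences, which leaves a polynomial identity for the ring solver.
    ∼-combine : ∀ {a b c d} u v → a ∼ b → c ∼ d → ∀ {x y} → x ℤ.- y ≡ u ℤ.* (a ℤ.- b) ℤ.+ v ℤ.* (c ℤ.- d) → x ∼ y
    ∼-combine u v (congruent k e) (congruent l f) h = congruent (u ℤ.* k ℤ.+ v ℤ.* l)
      (trans h (trans (cong₂ (λ s t → u ℤ.* s ℤ.+ v ℤ.* t) e f)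
        (solve 5 (λ u v k l p → u :* (k :* p) :+ v :* (l :* p) := (u :* k :+ v :* l) :* p) refl u v k l (+ p))))
      where open ℤS

    ∼-sym : ∀ {a b} → a ∼ b → b ∼ a
    ∼-sym {a} {b} h = ∼-combine (ℤ.- + 1) (+ 0) h h
      (solve 2 (λ a b → b :- a := con (ℤ.- + 1) :* (a :- b) :+ con (+ 0) :* (a :- b)) refl a b)
      where open ℤS

    ∼-trans : ∀ {a b c} → a ∼ b → b ∼ c → a ∼ c
    ∼-trans {a} {b} {c} h k = ∼-combine (+ 1) (+ 1) h k
      (solve 3 (λ a b c → a :- c := con (+ 1) :* (a :- b) :+ con (+ 1) :* (b :- c)) refl a b c)
      where open ℤS

    rep-res : ∀ a → rep (res a) ∼ a
    rep-res a = ∼-sym (congruent (a /ℕ p) (begin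
      a ℤ.- rep (res a)
        ≡⟨ cong₂ (λ u v → u ℤ.- + v) (a≡a%ℕn+[a/ℕn]*n a p) (Fin.toℕ-fromℕ< (n%ℕd<d a p)) ⟩
      (+ (a %ℕ p) ℤ.+ (a /ℕ p) ℤ.* + p) ℤ.- + (a %ℕ p)
        ≡⟨ solve 2 (λ u v → (u :+ v) :- u := v) refl (+ (a %ℕ p)) ((a /ℕ p) ℤ.* + p) ⟩
      (a /ℕ p) ℤ.* + p ∎))
      where open ≡-Reasoning
            open ℤS

    small : ∀ {i j} → i ℕ.< p → i ℕ.≤ j → (+ j) ≡ (+ i) [mod p ] → j ℕ.< p → i ≡ j
    small {i} {j} i<p i≤j h j<p with j ℕ.∸ i in eq
    ... | zero = ℕ.≤-antisym i≤j (ℕ.m∸n≡0⇒m≤n eq)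
    ... | suc k = ⊥-elim (ℕ.<⇒≱ (ℕ.≤-<-trans (subst (ℕ._≤ j) eq (ℕ.m∸n≤m j i)) j<p)
                    (ℕ.∣⇒≤ (subst (p ℕ.∣_) (trans (cong ℤ.∣_∣ (trans (ℤ.m-n≡m⊖n j i) (ℤ.⊖-≥ i≤j))) eq) h)))

    rep-injective : ∀ {x y} → rep x ∼ rep y → x ≡ y
    rep-injective {x} {y} h with ℕ.≤-total (toℕ x) (toℕ y)
    ... | inj₁ le = Fin.toℕ-injective (small (Fin.toℕ<n x) le (toMod {rep y} {rep x} (∼-sym h)) (Fin.toℕ<n y))
    ... | inj₂ ge = Fin.toℕ-injective (sym (small (Fin.toℕ<n y) ge (toMod {rep x} {rep y} h) (Fin.toℕ<n x)))

    res-cong : ∀ {a b} → a ∼ b → res a ≡ res b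
    res-cong {a} {b} h = rep-injective {res a} {res b} (∼-trans (rep-res a) (∼-trans h (∼-sym (rep-res b))))

    res-rep : ∀ x → res (rep x) ≡ x
    res-rep x = rep-injective {res (rep x)} {x} (rep-res (rep x))

    res-injective : ∀ {a b} → res a ≡ res b → a ∼ b
    res-injective {a} {b} e = ∼-trans (∼-sym (rep-res a)) (subst (λ r → rep r ∼ b) (sym e) (rep-res b))

    add mul : Fin p → Fin p → Fin p
    add x y = res (rep x ℤ.+ rep y)
    mul x y = res (rep x ℤ.* rep y)
    neg : Fin p → Fin p
    neg x = res (ℤ.- rep x)

    add-homo : ∀ a b → res (a ℤ.+ b) ≡ add (res a) (res b)
    add-homo a b = sym (res-cong {rep (res a) ℤ.+ rep (res b)} {a ℤ.+ b} (∼-combine (+ 1) (+ 1) (rep-res a) (rep-res b)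
      (solve 4 (λ a b c d → (a :+ b) :- (c :+ d) := con (+ 1) :* (a :- c) :+ con (+ 1) :* (b :- d))
        refl (rep (res a)) (rep (res b)) a b)))
      where open ℤS

    mul-homo : ∀ a b → res (a ℤ.* b) ≡ mul (res a) (res b)
    mul-homo a b = sym (res-cong {rep (res a) ℤ.* rep (res b)} {a ℤ.* b} (∼-combine (rep (res b)) a (rep-res a) (rep-res b)
      (solve 4 (λ a b c d → a :* b :- c :* d := b :* (a :- c) :+ c :* (b :- d))
        refl (rep (res a)) (rep (res b)) a b)))
      where open ℤS

    neg-homo : ∀ a → res (ℤ.- a) ≡ neg (res a)
    neg-homo a = sym (res-cong {ℤ.- rep (res a)} {ℤ.- a} (∼-combine (ℤ.- + 1) (+ 0) (rep-res a) (rep-res a)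
      (solve 2 (λ a c → (:- a) :- (:- c) := con (ℤ.- + 1) :* (a :- c) :+ con (+ 0) :* (a :- c)) refl (rep (res a)) a)))
      where open ℤS

    -- Each ring law of ℤ descends along the surjection res.
    isRing : IsCommutativeRing _≡_ add mul neg (res (+ 0)) (res (+ 1))
    isRing = record
      { isRing = record
        { +-isAbelianGroup = record
          { isGroup = record
            { isMonoid = record
              { isSemigroup = record
                { isMagma = record { isEquivalence = isEquivalence ; ∙-cong = cong₂ add }
                ; assoc = λ x y z → lift₃ x y z (λ a b c → trans (cong₂ add (sym (add-homo a b)) refl) (trans (sym (add-homo (a ℤ.+ b) c)) (trans (cong res (ℤ.+-assoc a b c)) (trans (add-homo a (b ℤ.+ c)) (cong (add (res a)) (add-homo b c))))))
                }
              ; identity = (λ x → lift₁ x λ a → trans (sym (add-homo (+ 0) a)) (cong res (ℤ.+-identityˡ a)))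
                         , (λ x → lift₁ x λ a → trans (sym (add-homo a (+ 0))) (cong res (ℤ.+-identityʳ a)))
              }
            ; inverse = (λ x → lift₁ x λ a → trans (cong₂ add (sym (neg-homo a)) refl) (trans (sym (add-homo (ℤ.- a) a)) (cong res (ℤ.+-inverseˡ a))))
                      , (λ x → lift₁ x λ a → trans (cong₂ add refl (sym (neg-homo a))) (trans (sym (add-homo a (ℤ.- a))) (cong res (ℤ.+-inverseʳ a))))
            ; ⁻¹-cong = cong neg
            }
          ; comm = λ x y → cong res (ℤ.+-comm (rep x) (rep y))
          }
        ; *-cong = cong₂ mul
        ; *-assoc = λ x y z → lift₃ x y z (λ a b c → trans (cong₂ mul (sym (mul-homo a b)) refl) (trans (sym (mul-homo (a ℤ.* b) c)) (trans (cong res (ℤ.*-assoc a b c)) (trans (mul-homo a (b ℤ.* c)) (cong (mul (res a)) (mul-homo b c))))))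
        ; *-identity = (λ x → lift₁ x λ a → trans (sym (mul-homo (+ 1) a)) (cong res (ℤ.*-identityˡ a)))
                     , (λ x → lift₁ x λ a → trans (sym (mul-homo a (+ 1))) (cong res (ℤ.*-identityʳ a)))
        ; distrib = (λ x y z → lift₃ x y z λ a b c → trans (cong (mul (res a)) (sym (add-homo b c))) (trans (sym (mul-homo a (b ℤ.+ c))) (trans (cong res (ℤ.*-distribˡ-+ a b c)) (trans (add-homo (a ℤ.* b) (a ℤ.* c)) (cong₂ add (mul-homo a b) (mul-homo a c))))))
                  , (λ x y z → lift₃ x y z λ a b c → trans (cong (λ t → mul t (res a)) (sym (add-homo b c))) (trans (sym (mul-homo (b ℤ.+ c) a)) (trans (cong res (ℤ.*-distribʳ-+ a b c)) (trans (add-homo (b ℤ.* a) (c ℤ.* a)) (cong₂ add (mul-homo b a) (mul-homo c a))))))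
        }
      ; *-comm = λ x y → cong res (ℤ.*-comm (rep x) (rep y))
      }
      where
      lift₁ : {P : Fin p → Set} → ∀ x → (∀ a → P (res a)) → P x
      lift₁ {P} x h = subst P (res-rep x) (h (rep x))
      lift₃ : {P : Fin p → Fin p → Fin p → Set} → ∀ x y z → (∀ a b c → P (res a) (res b) (res c)) → P x y z
      lift₃ {P} x y z h = lift₁ {λ x → P x y z} x λ a → lift₁ {λ y → P (res a) y z} y λ b → lift₁ {λ z → P (res a) (res b) z} z λ c → h a b c

    bezout : ∀ m → Bézout.Identity 1 p m → ∃ λ u → (+ m ℤ.* u) ∼ (+ 1)
    bezout m (Bézout.+- x y eq) = ℤ.- + y , congruent (ℤ.- + x) (begin
      (+ m ℤ.* ℤ.- + y) ℤ.- + 1 ≡⟨ solve 2 (λ m y → m :* (:- y) :- con (+ 1) := :- (con (+ 1) :+ y :* m)) refl (+ m) (+ y) ⟩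
      ℤ.- (+ 1 ℤ.+ + y ℤ.* + m) ≡⟨ cong (λ t → ℤ.- (+ 1 ℤ.+ t)) (sym (ℤ.pos-* y m)) ⟩
      ℤ.- (+ (1 ℕ.+ y ℕ.* m)) ≡⟨ cong (λ t → ℤ.- (+ t)) eq ⟩
      ℤ.- (+ (x ℕ.* p)) ≡⟨ cong ℤ.-_ (ℤ.pos-* x p) ⟩
      ℤ.- (+ x ℤ.* + p) ≡⟨ ℤ.neg-distribˡ-* (+ x) (+ p) ⟩
      ℤ.- + x ℤ.* + p ∎)
      where open ≡-Reasoning
            open ℤS
    bezout m (Bézout.-+ x y eq) = + y , congruent (+ x) (begin
      (+ m ℤ.* + y) ℤ.- + 1 ≡⟨ cong (ℤ._- + 1) (trans (sym (ℤ.pos-* m y)) (cong +_ (trans (ℕ.*-comm m y) (sym eq)))) ⟩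
      (+ (1 ℕ.+ x ℕ.* p)) ℤ.- + 1 ≡⟨ solve 1 (λ m → (con (+ 1) :+ m) :- con (+ 1) := m) refl (+ (x ℕ.* p)) ⟩
      + (x ℕ.* p) ≡⟨ ℤ.pos-* x p ⟩
      + x ℤ.* + p ∎)
      where open ≡-Reasoning
            open ℤS

    inverse : ∀ x → x ≢ res (+ 0) → ∃ λ u → mul x u ≡ res (+ 1)
    inverse x x≢0 = res (proj₁ bz) , trans (cong₂ mul (sym (res-rep x)) refl) (trans (sym (mul-homo (rep x) (proj₁ bz))) (res-cong {rep x ℤ.* proj₁ bz} {+ 1} (proj₂ bz)))
      where
      nz : ℕ.NonZero (toℕ x)
      nz = ℕ.≢-nonZero (λ e → x≢0 (trans (sym (res-rep x)) (cong (λ k → res (+ k)) e)))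
      bz = bezout (toℕ x) (coprime-Bézout (prime⇒coprime pr {{nz}} (Fin.toℕ<n x)))

    inverse₀ : Fin p → Fin p
    inverse₀ x with x Fin.≟ res (+ 0)
    ... | yes _ = res (+ 0)
    ... | no x≢0 = proj₁ (inverse x x≢0)

    inverse₀-inverse : ∀ x → x ≢ res (+ 0) → mul x (inverse₀ x) ≡ res (+ 1)
    inverse₀-inverse x x≢0 with x Fin.≟ res (+ 0)
    ... | yes e = ⊥-elim (x≢0 e)
    ... | no x≢0 = proj₂ (inverse x x≢0)

    inverse₀-zero : inverse₀ (res (+ 0)) ≡ res (+ 0)
    inverse₀-zero with res (+ 0) Fin.≟ res (+ 0)
    ... | yes e = refl
    ... | no n = ⊥-elim (n refl)

  primeField : PrimeField p
  primeField = record
    { ⟦_⟧ = res ; _+_ = add ; _*_ = mul ; -_ = neg ; inv = inverse₀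
    ; isCommutativeRing = isRing ; ⟦toℕ⟧ = res-rep
    ; ⟦⟧-cong = λ a b h → res-cong (fromMod {a} {b} h) ; ⟦⟧-injective = λ a b e → toMod (res-injective {a} {b} e)
    ; +-homo = add-homo ; *-homo = mul-homo ; -‿homo = neg-homo
    ; *-inverseʳ = inverse₀-inverse ; inv-zero = inverse₀-zero }

module FieldTheory {p : ℕ} (K : PrimeField p) where
  open PrimeField K public
  open IsCommutativeRing isCommutativeRing public
    using (*-assoc; *-comm; +-identityˡ; *-identityˡ; *-identityʳ; zeroˡ; zeroʳ; -‿inverseʳ)

  F : Set
  F = Fin p

  0F 1F : F
  0F = ⟦ + 0 ⟧
  1F = ⟦ + 1 ⟧

  infixl 6 _-_
  _-_ : F → F → F
  x - y = x + - y

  ring : CommutativeRing _ _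
  ring = record { isCommutativeRing = isCommutativeRing }

  private
    homomorphism : CommutativeRing.rawRing ℤ.+-*-commutativeRing -Raw-AlmostCommutative⟶ fromCommutativeRing ring
    homomorphism = record
      { ⟦_⟧ = ⟦_⟧ ; +-homo = +-homo ; *-homo = *-homo ; -‿homo = -‿homo
      ; 0-homo = refl ; 1-homo = refl }

    coeff≟ : ∀ a b → Maybe (⟦ a ⟧ ≡ ⟦ b ⟧)
    coeff≟ a b with a ℤ.≟ b
    ... | yes e = just (cong ⟦_⟧ e)
    ... | no _ = nothing

  -- Coefficients are integers embedded by `⟦_⟧`, so the solver also computes with numerals such as
  -- `2F` and `4F`.
  module Ring = Algebra.Solver.Ring (CommutativeRing.rawRing ℤ.+-*-commutativeRing) (fromCommutativeRing ring) homomorphism coeff≟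

  x-x≡0 : ∀ {x y} → x ≡ y → x - y ≡ 0F
  x-x≡0 {x} refl = -‿inverseʳ x

  x-y≡0⇒x≡y : ∀ {x y} → x - y ≡ 0F → x ≡ y
  x-y≡0⇒x≡y {x} {y} h = begin
    x ≡⟨ solve 2 (λ x y → x := (x :- y) :+ y) refl x y ⟩
    (x - y) + y ≡⟨ cong (_+ y) h ⟩
    0F + y ≡⟨ +-identityˡ y ⟩
    y ∎
    where open ≡-Reasoning
          open Ring

  -- The pattern of most algebra below: a - b is displayed as a multiple of the known l - r. Finding
  -- the multiplier `c` is the work; the solver checks the identity.
  linear : ∀ {l r} → l ≡ r → ∀ c {a b} → a - b ≡ c * (l - r) → a ≡ b
  linear {l} {r} h c e = x-y≡0⇒x≡y (trans e (trans (cong (c *_) (x-x≡0 h)) (zeroʳ c)))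

  linear₂ : ∀ {l r l′ r′} → l ≡ r → l′ ≡ r′ → ∀ c d {a b} → a - b ≡ c * (l - r) + d * (l′ - r′) → a ≡ b
  linear₂ h h′ c d e = x-y≡0⇒x≡y (trans e (trans (cong₂ _+_ (trans (cong (c *_) (x-x≡0 h)) (zeroʳ c)) (trans (cong (d *_) (x-x≡0 h′)) (zeroʳ d))) (+-identityˡ _)))

  *-cancelˡ : ∀ {c} → c ≢ 0F → ∀ {x y} → c * x ≡ c * y → x ≡ y
  *-cancelˡ {c} c≢0 {x} {y} h = linear₂ h (*-inverseʳ c c≢0) (inv c) (y - x)
    (solve 4 (λ c i x y → x :- y := i :* (c :* x :- c :* y) :+ (y :- x) :* (c :* i :- con (+ 1))) refl c (inv c) x y)
    where open Ring

  x*y≡0 : ∀ {x y} → x ≢ 0F → x * y ≡ 0F → y ≡ 0F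
  x*y≡0 {x} x≢0 h = *-cancelˡ x≢0 (trans h (sym (zeroʳ x)))

  *-nonzero : ∀ {x y} → x ≢ 0F → y ≢ 0F → x * y ≢ 0F
  *-nonzero x≢0 y≢0 h = y≢0 (x*y≡0 x≢0 h)

  ⟦⟧-nonzero : ∀ k {{_ : ℕ.NonZero k}} → k ℕ.< p → ⟦ + k ⟧ ≢ 0F
  ⟦⟧-nonzero k k<p h = ℕ.<⇒≱ k<p (ℕ.∣⇒≤ (subst (p ℕ.∣_) (cong ℤ.∣_∣ (ℤ.+-identityʳ (+ k))) (⟦⟧-injective (+ k) (+ 0) h)))

-- Finite sums and free orbits

≤-from : ∀ {a b c d} → c ℤ.≤ d → b ℤ.- a ≡ d ℤ.- c → a ℤ.≤ b
≤-from h e = ℤ.0≤i-j⇒j≤i (subst (+ 0 ℤ.≤_) (sym e) (ℤ.i≤j⇒0≤j-i h))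

≤-from₂ : ∀ {a b c d c′ d′} → c ℤ.≤ d → c′ ℤ.≤ d′ → b ℤ.- a ≡ (d ℤ.- c) ℤ.+ (d′ ℤ.- c′) → a ℤ.≤ b
≤-from₂ h h′ e = ℤ.0≤i-j⇒j≤i (subst (+ 0 ℤ.≤_) (sym e) (ℤ.+-mono-≤ (ℤ.i≤j⇒0≤j-i h) (ℤ.i≤j⇒0≤j-i h′)))

≡-from : ∀ {a b c d} → c ≡ d → a ℤ.- b ≡ c ℤ.- d → a ≡ b
≡-from {a} {b} {c} refl e = ℤ.i-j≡0⇒i≡j a b (trans e (ℤ.i≡j⇒i-j≡0 {c} refl))

indicator : {A : Set} → Dec A → ℤ
indicator (yes _) = + 1
indicator (no _) = + 0

indicator-yes : {A : Set} (d : Dec A) → A → indicator d ≡ + 1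
indicator-yes (yes _) _ = refl
indicator-yes (no n) a = ⊥-elim (n a)

indicator-no : {A : Set} (d : Dec A) → ¬ A → indicator d ≡ + 0
indicator-no (yes a) n = ⊥-elim (n a)
indicator-no (no _) _ = refl

indicator-cong : {A B : Set} (d : Dec A) (e : Dec B) → (A → B) → (B → A) → indicator d ≡ indicator e
indicator-cong (yes a) e f g = sym (indicator-yes e (f a))
indicator-cong (no n) e f g = sym (indicator-no e (n ∘ g))

indicator-× : {A B C : Set} (c : Dec C) (d : Dec A) (e : Dec B) → (C → A × B) → (A × B → C) →
  indicator c ≡ indicator d ℤ.* indicator e
indicator-× c (yes a) (yes b) f g = indicator-yes c (g (a , b))
indicator-× c (yes a) (no ¬b) f g = indicator-no c (¬b ∘ proj₂ ∘ f)
indicator-× c (no ¬a) (yes b) f g = indicator-no c (¬a ∘ proj₁ ∘ f)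
indicator-× c (no ¬a) (no ¬b) f g = indicator-no c (¬a ∘ proj₁ ∘ f)

indicator-nonneg : {A : Set} (d : Dec A) → + 0 ℤ.≤ indicator d
indicator-nonneg (yes _) = ℤ.+≤+ ℕ.z≤n
indicator-nonneg (no _) = ℤ.≤-refl

indicator-mono : {A B : Set} (d : Dec A) (e : Dec B) → (A → B) → indicator d ℤ.≤ indicator e
indicator-mono (yes a) e f = ℤ.≤-reflexive (sym (indicator-yes e (f a)))
indicator-mono (no _) e f = indicator-nonneg e

-- A finite type seen through its sum. `∑-δ` says that each point is counted exactly once; with
-- linearity and monotonicity this supports the counting arguments for the field and the plane
-- alike. Counts are integers so that they can be subtracted.
record Summation (V : Set) : Set₁ where
  infix 4 _≟_
  field
    _≟_ : DecidableEquality V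
    search : {P : V → Set} → (∀ v → Dec (P v)) → Dec (∃ P)
    ∑ : (V → ℤ) → ℤ
    ∑-mono : ∀ {f g} → (∀ v → f v ℤ.≤ g v) → ∑ f ℤ.≤ ∑ g
    ∑-+ : ∀ f g → ∑ (λ v → f v ℤ.+ g v) ≡ ∑ f ℤ.+ ∑ g
    ∑-* : ∀ c f → ∑ (λ v → c ℤ.* f v) ≡ c ℤ.* ∑ f
    ∑-δ : ∀ u → ∑ (λ v → indicator (u ≟ v)) ≡ + 1

  ∑-cong : ∀ {f g : V → ℤ} → (∀ v → f v ≡ g v) → ∑ f ≡ ∑ g
  ∑-cong h = ℤ.≤-antisym (∑-mono (ℤ.≤-reflexive ∘ h)) (∑-mono (ℤ.≤-reflexive ∘ sym ∘ h))

  ∑-zero : ∀ {f : V → ℤ} → (∀ v → f v ≡ + 0) → ∑ f ≡ + 0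
  ∑-zero {f} h = trans (∑-cong {g = λ v → + 0 ℤ.* f v} h) (∑-* (+ 0) f)

  ∑-nonneg : ∀ {f : V → ℤ} → (∀ v → + 0 ℤ.≤ f v) → + 0 ℤ.≤ ∑ f
  ∑-nonneg {f} h = subst (ℤ._≤ ∑ f) (∑-zero {λ _ → + 0} (λ _ → refl)) (∑-mono h)

  ∑-*ʳ : ∀ c (f : V → ℤ) → ∑ (λ v → f v ℤ.* c) ≡ ∑ f ℤ.* c
  ∑-*ʳ c f = trans (∑-cong (λ v → ℤ.*-comm (f v) c)) (trans (∑-* c f) (ℤ.*-comm c (∑ f)))

  ∑-neg : ∀ (f : V → ℤ) → ∑ (λ v → ℤ.- f v) ≡ ℤ.- ∑ f
  ∑-neg f = trans (∑-cong (λ v → sym (ℤ.-1*i≡-i (f v)))) (trans (∑-* (ℤ.- + 1) f) (ℤ.-1*i≡-i (∑ f)))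

  ∑-minus : ∀ (f g : V → ℤ) → ∑ (λ v → f v ℤ.- g v) ≡ ∑ f ℤ.- ∑ g
  ∑-minus f g = trans (∑-+ f (λ v → ℤ.- g v)) (cong (ℤ._+_ (∑ f)) (∑-neg g))

  ∑-pick : ∀ u (f : V → ℤ) → ∑ (λ v → indicator (u ≟ v) ℤ.* f v) ≡ f u
  ∑-pick u f = begin
    ∑ (λ v → indicator (u ≟ v) ℤ.* f v) ≡⟨ ∑-cong pointwise ⟩
    ∑ (λ v → f u ℤ.* indicator (u ≟ v)) ≡⟨ ∑-* (f u) (λ v → indicator (u ≟ v)) ⟩
    f u ℤ.* ∑ (λ v → indicator (u ≟ v)) ≡⟨ cong (f u ℤ.*_) (∑-δ u) ⟩
    f u ℤ.* + 1                         ≡⟨ ℤ.*-identityʳ (f u) ⟩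
    f u ∎
    where
    open ≡-Reasoning
    pointwise : ∀ v → indicator (u ≟ v) ℤ.* f v ≡ f u ℤ.* indicator (u ≟ v)
    pointwise v with u ≟ v
    ... | yes refl = ℤ.*-comm (+ 1) (f u)
    ... | no _ = sym (ℤ.*-zeroʳ (f u))

  count : {P : V → Set} → (∀ v → Dec (P v)) → ℤ
  count P? = ∑ (indicator ∘ P?)

finite : ∀ n → Summation (Fin n)
finite n = record
  { _≟_ = Fin._≟_ ; search = Fin.any? ; ∑ = sum ; ∑-mono = mono
  ; ∑-+ = ∑-distrib-+ ; ∑-* = λ c f → sym (*-distribˡ-sum c f) ; ∑-δ = delta }
  where
  mono : ∀ {n} {f g : Fin n → ℤ} → (∀ i → f i ℤ.≤ g i) → sum f ℤ.≤ sum g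
  mono {zero} h = ℤ.≤-refl
  mono {suc n} h = ℤ.+-mono-≤ (h Fin.zero) (mono (h ∘ Fin.suc))
  delta : ∀ {n} (i : Fin n) → sum (λ j → indicator (i Fin.≟ j)) ≡ + 1
  delta {suc n} Fin.zero = cong (ℤ._+_ (+ 1)) (sum-replicate-zero n)
  delta {suc n} (Fin.suc i) = trans (ℤ.+-identityˡ _)
    (trans (sum-cong-≗ (λ j → indicator-cong (Fin.suc i Fin.≟ Fin.suc j) (i Fin.≟ j) Fin.suc-injective (cong Fin.suc))) (delta i))

_×-summation_ : ∀ {V W} → Summation V → Summation W → Summation (V × W)
_×-summation_ {V} {W} A B = record
  { _≟_ = ≡-dec A._≟_ B._≟_
  ; search = λ P? → map′ (λ (v , w , h) → (v , w) , h) (λ ((v , w) , h) → v , w , h) (A.search (λ v → B.search (λ w → P? (v , w))))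
  ; ∑ = λ f → A.∑ (λ v → B.∑ (λ w → f (v , w)))
  ; ∑-mono = λ h → A.∑-mono (λ v → B.∑-mono (λ w → h (v , w)))
  ; ∑-+ = λ f g → trans (A.∑-cong (λ v → B.∑-+ _ _)) (A.∑-+ _ _)
  ; ∑-* = λ c f → trans (A.∑-cong (λ v → B.∑-* c _)) (A.∑-* c _)
  ; ∑-δ = λ (a , b) → trans (A.∑-cong (λ v → trans (B.∑-cong (split a b v)) (trans (B.∑-* (indicator (a A.≟ v)) (λ w → indicator (b B.≟ w))) (trans (cong (indicator (a A.≟ v) ℤ.*_) (B.∑-δ b)) (ℤ.*-identityʳ (indicator (a A.≟ v))))))) (A.∑-δ a) }
  where
  module A = Summation A
  module B = Summation B
  split : ∀ a b v w → indicator (≡-dec A._≟_ B._≟_ (a , b) (v , w)) ≡ indicator (a A.≟ v) ℤ.* indicator (b B.≟ w)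
  split a b v w = indicator-× _ (a A.≟ v) (b B.≟ w) (λ { refl → refl , refl }) (λ { (refl , refl) → refl })

sum-const : ∀ n c → sum {n} (λ _ → c) ≡ + n ℤ.* c
sum-const zero c = sym (ℤ.*-zeroˡ c)
sum-const (suc n) c = trans (cong (ℤ._+_ c) (sum-const n c)) (sym (ℤ.suc-* (+ n) c))

module _ {V : Set} (S : Summation V) where
  open Summation S

  ∑-swap : ∀ {n} (f : V → Fin n → ℤ) → ∑ (λ v → sum (f v)) ≡ sum (λ i → ∑ (λ v → f v i))
  ∑-swap {zero} f = ∑-zero (λ _ → refl)
  ∑-swap {suc n} f = trans (∑-+ _ _) (cong (ℤ._+_ (∑ (λ v → f v Fin.zero))) (∑-swap (λ v i → f v (Fin.suc i))))

  hits : ∀ {n} (g : Fin n → V) → (∀ {i j} → g i ≡ g j → i ≡ j) → ∀ u →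
    sum (λ i → indicator (g i ≟ u)) ≡ indicator (Fin.any? (λ i → g i ≟ u))
  hits {n} g inj u with Fin.any? (λ i → g i ≟ u)
  ... | yes (i , refl) = trans (∑′.∑-cong (λ j → indicator-cong (g j ≟ g i) (i Fin.≟ j) (sym ∘ inj) (cong g ∘ sym))) (∑′.∑-δ i)
    where module ∑′ = Summation (finite n)
  ... | no h = ∑′.∑-zero (λ j → indicator-no (g j ≟ u) (λ e → h (j , e)))
    where module ∑′ = Summation (finite n)

  count-image : ∀ {n} (g : Fin n → V) → (∀ {i j} → g i ≡ g j → i ≡ j) →
    count (λ u → Fin.any? (λ i → g i ≟ u)) ≡ + n
  count-image {n} g inj = begin
    ∑ (λ u → indicator (Fin.any? (λ i → g i ≟ u))) ≡⟨ ∑-cong (sym ∘ hits g inj) ⟩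
    ∑ (λ u → sum (λ i → indicator (g i ≟ u)))      ≡⟨ ∑-swap (λ u i → indicator (g i ≟ u)) ⟩
    sum (λ i → ∑ (λ u → indicator (g i ≟ u)))      ≡⟨ sum-cong-≗ (λ i → ∑-δ (g i)) ⟩
    sum {n} (λ _ → + 1)                            ≡⟨ sum-const n (+ 1) ⟩
    + n ℤ.* + 1                                    ≡⟨ ℤ.*-identityʳ (+ n) ⟩
    + n ∎
    where open ≡-Reasoning

  -- Pigeonhole: a point missed by `g` would, together with the image, make n + 1 points where at
  -- most n fit.
  covers : ∀ {C : V → Set} (C? : ∀ v → Dec (C v)) {n} (g : Fin n → V) → (∀ {i j} → g i ≡ g j → i ≡ j) →
    (∀ i → C (g i)) → count C? ℤ.≤ + n → ∀ {w} → C w → ∃ λ i → g i ≡ w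
  covers C? {n} g inj Cg small {w} Cw with Fin.any? (λ i → g i ≟ w)
  ... | yes h = h
  ... | no h = ⊥-elim (ℤ.<⇒≱ (ℤ.suc[i]≤j⇒i<j (ℤ.≤-refl {ℤ.suc (+ n)})) (ℤ.≤-trans (ℤ.≤-trans (ℤ.≤-reflexive total) (∑-mono pointwise)) small))
    where
    total : ℤ.suc (+ n) ≡ ∑ (λ u → indicator (w ≟ u) ℤ.+ indicator (Fin.any? (λ i → g i ≟ u)))
    total = sym (trans (∑-+ _ _) (cong₂ ℤ._+_ (∑-δ w) (count-image g inj)))
    pointwise : ∀ u → indicator (w ≟ u) ℤ.+ indicator (Fin.any? (λ i → g i ≟ u)) ℤ.≤ indicator (C? u)
    pointwise u with w ≟ u | Fin.any? (λ i → g i ≟ u)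
    ... | yes refl | yes (i , e) = ⊥-elim (h (i , e))
    ... | yes refl | no _ = ℤ.≤-reflexive (sym (indicator-yes (C? w) Cw))
    ... | no _ | yes (i , refl) = ℤ.≤-reflexive (sym (indicator-yes (C? (g i)) (Cg i)))
    ... | no _ | no _ = indicator-nonneg (C? u)

iterate : {V : Set} → (V → V) → ℕ → V → V
iterate f zero v = v
iterate f (suc k) v = f (iterate f k v)

iterate-+ : ∀ {V : Set} (f : V → V) j k v → iterate f (j ℕ.+ k) v ≡ iterate f j (iterate f k v)
iterate-+ f zero k v = refl
iterate-+ f (suc j) k v = cong f (iterate-+ f j k v)

iterate-suc : ∀ {V : Set} (f : V → V) k v → iterate f (suc k) v ≡ iterate f k (f v)
iterate-suc f zero v = refl
iterate-suc f (suc k) v = cong f (iterate-suc f k v)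

iterate-* : ∀ {V : Set} (f : V → V) j k v → iterate f (j ℕ.* k) v ≡ iterate (iterate f k) j v
iterate-* f zero k v = refl
iterate-* f (suc j) k v = trans (iterate-+ f k (j ℕ.* k) v) (cong (iterate f k) (iterate-* f j k v))

iterate-preserves : ∀ {V : Set} (P : V → Set) {f} → (∀ {v} → P v → P (f v)) → ∀ k {v} → P v → P (iterate f k v)
iterate-preserves P h zero Pv = Pv
iterate-preserves P h (suc k) Pv = h (iterate-preserves P h k Pv)

module Orbits {V : Set} (S : Summation V) (f : V → V) (injective : ∀ {v w} → f v ≡ f w → v ≡ w) where
  open Summation S

  iterate-injective : ∀ k {v w} → iterate f k v ≡ iterate f k w → v ≡ w
  iterate-injective zero h = h
  iterate-injective (suc k) h = iterate-injective k (injective h)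

  return : ∀ {v i j} → i ℕ.< j → iterate f i v ≡ iterate f j v → iterate f (j ℕ.∸ i) v ≡ v
  return {v} {i} {j} i<j h = sym (iterate-injective i
    (trans h (trans (cong (λ k → iterate f k v) (sym (ℕ.m+[n∸m]≡n (ℕ.<⇒≤ i<j)))) (iterate-+ f i (j ℕ.∸ i) v))))

  FreeBelow : ℕ → V → Set
  FreeBelow d v = ∀ k → 0 ℕ.< k → k ℕ.< d → iterate f k v ≢ v

  orbit-injective : ∀ {d v} → FreeBelow d v → ∀ {i j : Fin d} → iterate f (toℕ i) v ≡ iterate f (toℕ j) v → i ≡ j
  orbit-injective {d} {v} free {i} {j} h with ℕ.<-cmp (toℕ i) (toℕ j)
  ... | tri< lt _ _ = ⊥-elim (free (toℕ j ℕ.∸ toℕ i) (ℕ.m<n⇒0<n∸m lt) (ℕ.≤-<-trans (ℕ.m∸n≤m (toℕ j) (toℕ i)) (Fin.toℕ<n j)) (return lt h))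
  ... | tri≈ _ e _ = Fin.toℕ-injective e
  ... | tri> _ _ gt = ⊥-elim (free (toℕ i ℕ.∸ toℕ j) (ℕ.m<n⇒0<n∸m gt) (ℕ.≤-<-trans (ℕ.m∸n≤m (toℕ i) (toℕ j)) (Fin.toℕ<n i)) (return gt (sym h)))

  record FreeOn (C : V → Set) (e : ℕ) : Set where
    field
      closed : ∀ {v} → C v → C (f v)
      periodic : ∀ {v} → C v → iterate f (suc e) v ≡ v
      free : ∀ {v} → C v → FreeBelow (suc e) v

  private
    -- Recursion on `N`, a bound for the number of points that are left; each round removes the
    -- orbit of some point of `C`.
    remove-orbits : ∀ e N {C : V → Set} (C? : ∀ v → Dec (C v)) → FreeOn C e → count C? ℤ.≤ + N → ∃ λ m → count C? ≡ + m ℤ.* + suc e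
    remove-orbits e N {C} C? fr bound with search C?
    ... | no none = 0 , ∑-zero (λ v → indicator-no (C? v) (λ Cv → none (v , Cv)))
    ... | yes (v , Cv) = conclude N bound
      where
      open FreeOn fr
      d = suc e
      Orbit : V → Set
      Orbit w = ∃ λ (i : Fin d) → iterate f (toℕ i) v ≡ w
      Orbit? : ∀ w → Dec (Orbit w)
      Orbit? w = Fin.any? (λ i → iterate f (toℕ i) v ≟ w)
      C′ : V → Set
      C′ w = C w × ¬ Orbit w
      C′? : ∀ w → Dec (C′ w)
      C′? w = C? w ×-dec ¬? (Orbit? w)
      -- A preimage of an orbit point lies in the orbit: for `v` itself it is the last point f^e v,
      -- by periodicity and injectivity.
      back : ∀ {w} → C w → Orbit (f w) → Orbit w
      back Cw (Fin.zero , h) = Fin.fromℕ e , injective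
        (trans (cong (λ k → iterate f (suc k) v) (Fin.toℕ-fromℕ e)) (trans (periodic Cv) h))
      back Cw (Fin.suc i , h) = Fin.inject₁ i , injective
        (trans (cong (λ k → iterate f (suc k) v) (Fin.toℕ-inject₁ i)) h)
      fr′ : FreeOn C′ e
      fr′ = record
        { closed = λ (Cw , ¬o) → closed Cw , λ o → ¬o (back Cw o)
        ; periodic = periodic ∘ proj₁ ; free = free ∘ proj₁ }
      split : ∀ w → indicator (C? w) ≡ indicator (C′? w) ℤ.+ indicator (Orbit? w)
      split w with Orbit? w | C? w
      ... | yes _ | yes _ = refl
      ... | yes (i , refl) | no n = ⊥-elim (n (iterate-preserves C closed (toℕ i) Cv))
      ... | no _ | yes _ = refl
      ... | no _ | no _ = refl
      total : count C? ≡ count C′? ℤ.+ + d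
      total = trans (∑-cong split) (trans (∑-+ _ _) (cong (ℤ._+_ (count C′?)) (count-image S _ (orbit-injective (free Cv)))))
      0≤count : + 0 ℤ.≤ count C′?
      0≤count = ∑-nonneg (λ w → indicator-nonneg (C′? w))
      open ℤS
      conclude : ∀ N → count C? ℤ.≤ + N → ∃ λ m → count C? ≡ + m ℤ.* + d
      conclude zero b = ⊥-elim (ℤ.<⇒≱ (ℤ.+<+ (ℕ.s≤s ℕ.z≤n)) (ℤ.≤-trans (ℤ.+-mono-≤ 0≤count (ℤ.≤-refl {+ d})) (subst (ℤ._≤ + 0) total b)))
      conclude (suc N) b with remove-orbits e N C′? fr′ (≤-from₂ (subst (ℤ._≤ + suc N) total b) (ℤ.+≤+ (ℕ.z≤n {e}))
        (solve 3 (λ c n e → n :- c := (con (+ 1) :+ n :- (c :+ (con (+ 1) :+ e))) :+ (e :- con (+ 0))) refl (count C′?) (+ N) (+ e)))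
      ... | m , h = suc m , trans total (trans (cong (ℤ._+ + d) h) (trans (ℤ.+-comm (+ m ℤ.* + d) (+ d)) (sym (ℤ.suc-* (+ m) (+ d)))))

  orbit-size-divides : ∀ {e} {C : V → Set} (C? : ∀ v → Dec (C v)) → FreeOn C e → ∃ λ m → count C? ≡ + m ℤ.* + suc e
  orbit-size-divides {e} C? fr = remove-orbits e ℤ.∣ count C? ∣ C? fr (ℤ.≤-reflexive (sym (ℤ.0≤i⇒+∣i∣≡i (∑-nonneg (λ w → indicator-nonneg (C? w))))))

-- The quadratic character

module Character {p : ℕ} (K : PrimeField p) (m : ℕ) (p+1 : suc p ≡ 2 ℕ.^ (3 ℕ.+ m)) where
  open FieldTheory K public
  open Summation (finite p) public

  2F 3F 4F 5F : F
  2F = ⟦ + 2 ⟧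
  3F = ⟦ + 3 ⟧
  4F = ⟦ + 4 ⟧
  5F = ⟦ + 5 ⟧

  7≤p : 7 ℕ.≤ p
  7≤p = ℕ.s≤s⁻¹ (subst (8 ℕ.≤_) (sym p+1) (ℕ.^-monoʳ-≤ 2 (ℕ.m≤m+n 3 m)))

  small-nonzero : ∀ k {{_ : ℕ.NonZero k}} → k ℕ.≤ 6 → ⟦ + k ⟧ ≢ 0F
  small-nonzero k k≤6 = ⟦⟧-nonzero k (ℕ.≤-<-trans k≤6 7≤p)

  1≢0 : 1F ≢ 0F
  1≢0 = small-nonzero 1 (ℕ.m≤m+n 1 5)

  2≢0 : 2F ≢ 0F
  2≢0 = small-nonzero 2 (ℕ.m≤m+n 2 4)

  4≢0 : 4F ≢ 0F
  4≢0 = small-nonzero 4 (ℕ.m≤m+n 4 2)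

  open Ring using (solve; _:=_; _:+_; _:*_; _:-_; :-_; con)

  -x≡0⇒x≡0 : ∀ {x} → - x ≡ 0F → x ≡ 0F
  -x≡0⇒x≡0 {x} h = linear h (- 1F) (solve 1 (λ x → x :- con (+ 0) := (:- con (+ 1)) :* (:- x :- con (+ 0))) refl x)

  x≡-x⇒x≡0 : ∀ {x} → x ≡ - x → x ≡ 0F
  x≡-x⇒x≡0 {x} h = x*y≡0 2≢0 (linear h 1F (solve 1 (λ x → con (+ 2) :* x :- con (+ 0) := con (+ 1) :* (x :- :- x)) refl x))

  x²≡y² : ∀ {x y} → x * x ≡ y * y → x ≡ y ⊎ x ≡ - y
  x²≡y² {x} {y} h with x - y ≟ 0F
  ... | yes e = inj₁ (x-y≡0⇒x≡y e)
  ... | no n = inj₂ (linear (x*y≡0 {y = x + y} n (linear h 1F (solve 2 (λ x y → (x :- y) :* (x :+ y) :- con (+ 0) := con (+ 1) :* (x :* x :- y :* y)) refl x y))) 1F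
                      (solve 2 (λ x y → x :- (:- y) := con (+ 1) :* (x :+ y :- con (+ 0))) refl x y))

  inv-nonzero : ∀ {x} → x ≢ 0F → inv x ≢ 0F
  inv-nonzero {x} x≢0 h = 1≢0 (trans (sym (*-inverseʳ x x≢0)) (trans (cong (x *_) h) (zeroʳ x)))

  inv-involutive : ∀ x → inv (inv x) ≡ x
  inv-involutive x with x ≟ 0F
  ... | yes refl = trans (cong inv inv-zero) inv-zero
  ... | no x≢0 = *-cancelˡ (inv-nonzero x≢0) (trans (*-inverseʳ (inv x) (inv-nonzero x≢0)) (trans (sym (*-inverseʳ x x≢0)) (*-comm x (inv x))))

  x²≡0 : ∀ {x} → x * x ≡ 0F → x ≡ 0F
  x²≡0 {x} h with x ≟ 0F
  ... | yes e = e
  ... | no n = x*y≡0 n h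

  ∑-const : ∀ c → ∑ (λ _ → c) ≡ + p ℤ.* c
  ∑-const = sum-const p

  ∑-reindex : ∀ (f : F → ℤ) (σ τ : F → F) → (∀ x → σ (τ x) ≡ x) → (∀ x → τ (σ x) ≡ x) → ∑ (λ x → f (σ x)) ≡ ∑ f
  ∑-reindex f σ τ στ τσ = sym (sum-permute f (permutation σ τ στ τσ))

  -- A square root of −1 would make F∖{0} a union of orbits of size 4, but p − 1 ≡ 2 (mod 4).
  -1-nonsquare : ∀ i → i * i ≢ - 1F
  -1-nonsquare i h = absurd (Orbits.orbit-size-divides (finite p) (i *_) (*-cancelˡ i≢0) nonzero? freeOrbits)
    where
    nonzero? : ∀ (v : F) → Dec (v ≢ 0F)
    nonzero? v = ¬? (v ≟ 0F)
    i≢0 : i ≢ 0F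
    i≢0 refl = 1≢0 (linear h 1F (solve 0 (con (+ 1) :- con (+ 0) := con (+ 1) :* (con (+ 0) :* con (+ 0) :- :- con (+ 1))) refl))
    open Orbits (finite p) (i *_) (*-cancelˡ i≢0)
    no-fixed : ∀ k → 0 ℕ.< k → k ℕ.< 4 → ∀ {v} → v ≢ 0F → iterate (i *_) k v ≢ v
    twice : ∀ v → i * (i * v) ≡ - v
    twice v = linear h v (solve 2 (λ i v → i :* (i :* v) :- :- v := v :* (i :* i :- :- con (+ 1))) refl i v)
    no-fixed 2 _ _ {v} v≢0 e = v≢0 (x≡-x⇒x≡0 (trans (sym e) (twice v)))
    no-fixed 1 a b {v} v≢0 e = no-fixed 2 (ℕ.s≤s ℕ.z≤n) (ℕ.s≤s (ℕ.s≤s (ℕ.s≤s ℕ.z≤n))) v≢0 (trans (cong (i *_) e) e)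
    no-fixed 3 a b {v} v≢0 e = no-fixed 1 (ℕ.s≤s ℕ.z≤n) (ℕ.s≤s (ℕ.s≤s ℕ.z≤n)) (*-nonzero i≢0 v≢0)
      (trans (twice v) (linear (trans (sym (twice (i * v))) e) 1F
        (solve 2 (λ i v → :- v :- i :* v := con (+ 1) :* (:- (i :* v) :- v)) refl i v)))
    no-fixed (suc (suc (suc (suc k)))) _ (ℕ.s≤s (ℕ.s≤s (ℕ.s≤s (ℕ.s≤s ()))))
    freeOrbits : FreeOn (λ v → v ≢ 0F) 3
    freeOrbits = record
      { closed = *-nonzero i≢0
      ; periodic = λ {v} _ → trans (twice (i * (i * v))) (trans (cong -_ (twice v)) (solve 1 (λ v → :- :- v := v) refl v))
      ; free = λ v≢0 k a b → no-fixed k a b v≢0 }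
    count-nonzero : count nonzero? ℤ.+ + 1 ≡ + p
    count-nonzero = begin
      count nonzero? ℤ.+ + 1 ≡⟨ cong (ℤ._+_ (count nonzero?)) (sym (∑-δ 0F)) ⟩
      count nonzero? ℤ.+ ∑ (λ v → indicator (0F ≟ v)) ≡⟨ sym (∑-+ _ _) ⟩
      ∑ (λ v → indicator (nonzero? v) ℤ.+ indicator (0F ≟ v)) ≡⟨ ∑-cong pointwise ⟩
      ∑ (λ _ → + 1) ≡⟨ ∑-const (+ 1) ⟩
      + p ℤ.* + 1 ≡⟨ ℤ.*-identityʳ (+ p) ⟩
      + p ∎
      where
      open ≡-Reasoning
      pointwise : ∀ v → indicator (nonzero? v) ℤ.+ indicator (0F ≟ v) ≡ + 1
      pointwise v with 0F ≟ v
      ... | yes refl = cong (ℤ._+ + 1) (indicator-no (nonzero? 0F) (λ n → n refl))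
      ... | no n = cong (ℤ._+ + 0) (indicator-yes (nonzero? v) (n ∘ sym))
    absurd : ¬ (∃ λ k → count nonzero? ≡ + k ℤ.* + 4)
    -- From p - 1 = 4k follows p + 1 = 2 + 4k, whereas 4 divides p + 1.
    absurd (k , e) = contra (trans (sym (ℕ.[m+kn]%n≡m%n 2 k 4)) (trans (cong (ℕ._% 4) sizes) (trans (cong (ℕ._% 4) (sym (ℕ.*-assoc 2 2 (2 ℕ.* 2 ℕ.^ m)))) (trans (cong (ℕ._% 4) (ℕ.*-comm 4 (2 ℕ.* 2 ℕ.^ m))) (ℕ.m*n%n≡0 (2 ℕ.* 2 ℕ.^ m) 4)))))
      where
      contra : 2 ≢ 0
      contra ()
      sizes : 2 ℕ.+ k ℕ.* 4 ≡ 2 ℕ.* (2 ℕ.* (2 ℕ.* 2 ℕ.^ m))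
      sizes = trans (cong suc (ℤ.+-injective (trans (trans (cong (ℤ._+_ (+ 1)) (ℤ.pos-* k 4)) (trans (cong (ℤ._+_ (+ 1)) (sym e)) (ℤ.+-comm (+ 1) (count nonzero?)))) count-nonzero))) p+1

  IsSquare : F → Set
  IsSquare c = ∃ λ x → x * x ≡ c

  isSquare? : ∀ c → Dec (IsSquare c)
  isSquare? c = search (λ x → x * x ≟ c)

  abstract
    χ : F → ℤ
    χ c with c ≟ 0F | isSquare? c
    ... | yes _ | _ = + 0
    ... | no _ | yes _ = + 1
    ... | no _ | no _ = -[1+ 0 ]

    χ-zero : χ 0F ≡ + 0
    χ-zero with 0F ≟ 0F | isSquare? 0F
    ... | yes _ | _ = refl
    ... | no n | _ = ⊥-elim (n refl)

    χ-square : ∀ {s c} → s ≢ 0F → s * s ≡ c → χ c ≡ + 1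
    χ-square {s} {c} s≢0 e with c ≟ 0F | isSquare? c
    ... | yes refl | _ = ⊥-elim (s≢0 (x²≡0 e))
    ... | no _ | yes _ = refl
    ... | no _ | no n = ⊥-elim (n (s , e))

    χ-nonsquare : ∀ {c} → ¬ IsSquare c → χ c ≡ -[1+ 0 ]
    χ-nonsquare {c} n with c ≟ 0F | isSquare? c
    ... | yes refl | _ = ⊥-elim (n (0F , zeroˡ 0F))
    ... | no _ | yes y = ⊥-elim (n y)
    ... | no _ | no _ = refl

    roots : ∀ c → ∑ (λ x → indicator (x * x ≟ c)) ≡ + 1 ℤ.+ χ c
    roots c with c ≟ 0F | isSquare? c
    ... | yes refl | _ = trans (∑-cong (λ x → indicator-cong (x * x ≟ 0F) (0F ≟ x) (sym ∘ x²≡0) (λ { refl → zeroˡ 0F }))) (∑-δ 0F)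
    ... | no c≢0 | yes (s , refl) = trans (∑-cong pointwise) (trans (∑-+ _ _) (cong₂ ℤ._+_ (∑-δ s) (∑-δ (- s))))
      where
      neg² : - s * - s ≡ s * s
      neg² = solve 1 (λ s → :- s :* :- s := s :* s) refl s
      pointwise : ∀ x → indicator (x * x ≟ s * s) ≡ indicator (s ≟ x) ℤ.+ indicator (- s ≟ x)
      pointwise x with s ≟ x | - s ≟ x
      ... | yes refl | yes e = ⊥-elim (c≢0 (trans (cong (s *_) (x≡-x⇒x≡0 (sym e))) (zeroʳ s)))
      ... | yes refl | no _ = indicator-yes (s * s ≟ s * s) refl
      ... | no _ | yes refl = indicator-yes (- s * - s ≟ s * s) neg²
      ... | no n | no n′ = indicator-no (x * x ≟ s * s) contra
        where
        contra : x * x ≢ s * s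
        contra e with x²≡y² e
        ... | inj₁ h = n (sym h)
        ... | inj₂ h = n′ (sym h)
    ... | no _ | no n = ∑-zero (λ x → indicator-no (x * x ≟ c) (λ e → n (x , e)))

    -- The y are grouped by v = y², each v having 1 + χ(v) roots. This reduces the sums over conics
    -- and over the tree of t ↦ t² - 2.
    ∑-of-squares : ∀ (g : F → ℤ) → ∑ (λ y → g (y * y)) ≡ ∑ (λ v → (+ 1 ℤ.+ χ v) ℤ.* g v)
    ∑-of-squares g = begin
      ∑ (λ y → g (y * y)) ≡⟨ ∑-cong (λ y → sym (∑-pick (y * y) g)) ⟩
      ∑ (λ y → ∑ (λ v → indicator (y * y ≟ v) ℤ.* g v)) ≡⟨ ∑-swap (finite p) (λ y v → indicator (y * y ≟ v) ℤ.* g v) ⟩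
      ∑ (λ v → ∑ (λ y → indicator (y * y ≟ v) ℤ.* g v)) ≡⟨ ∑-cong (λ v → trans (∑-*ʳ (g v) (λ y → indicator (y * y ≟ v))) (cong (ℤ._* g v) (roots v))) ⟩
      ∑ (λ v → (+ 1 ℤ.+ χ v) ℤ.* g v) ∎
      where open ≡-Reasoning

    -- The constant function 1 in `∑-of-squares` gives p = p + ∑ χ.
    ∑χ≡0 : ∑ χ ≡ + 0
    ∑χ≡0 = ≡-from (sym (begin
      ∑ (λ _ → + 1) ℤ.+ + 0 ≡⟨ ℤ.+-identityʳ (∑ (λ _ → + 1)) ⟩
      ∑ (λ _ → + 1) ≡⟨ ∑-of-squares (λ _ → + 1) ⟩
      ∑ (λ v → (+ 1 ℤ.+ χ v) ℤ.* + 1) ≡⟨ ∑-cong (λ v → ℤ.*-identityʳ (+ 1 ℤ.+ χ v)) ⟩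
      ∑ (λ v → + 1 ℤ.+ χ v) ≡⟨ ∑-+ (λ _ → + 1) χ ⟩
      ∑ (λ _ → + 1) ℤ.+ ∑ χ ∎)) (ℤS.solve 2 (λ a b → b ℤS.:- ℤS.con (+ 0) ℤS.:= (a ℤS.:+ b) ℤS.:- (a ℤS.:+ ℤS.con (+ 0))) refl (∑ (λ _ → + 1)) (∑ χ))
      where open ≡-Reasoning

    χ≤1 : ∀ c → χ c ℤ.≤ + 1
    χ≤1 c with c ≟ 0F | isSquare? c
    ... | yes _ | _ = ℤ.+≤+ ℕ.z≤n
    ... | no _ | yes _ = ℤ.≤-refl
    ... | no _ | no _ = ℤ.-≤+

    -1≤χ : ∀ c → -[1+ 0 ] ℤ.≤ χ c
    -1≤χ c with c ≟ 0F | isSquare? c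
    ... | yes _ | _ = ℤ.-≤+
    ... | no _ | yes _ = ℤ.-≤+
    ... | no _ | no _ = ℤ.≤-refl

    -- Squares cannot come in pairs {c , −c}, and since χ sums to zero they come one in each pair.
    χ-neg : ∀ c → χ c ℤ.+ χ (- c) ≡ + 0
    χ-neg c = ℤ.≤-antisym (nonpos c) (subst₂ ℤ._≤_ total (∑-pick c f) (∑-mono below))
      where
      f : F → ℤ
      f v = χ v ℤ.+ χ (- v)
      nonpos : ∀ v → f v ℤ.≤ + 0
      nonpos v with v ≟ 0F | isSquare? v
      ... | yes refl | _ = ℤ.≤-reflexive (trans (ℤ.+-identityˡ (χ (- 0F))) (trans (cong χ (solve 0 (:- con (+ 0) := con (+ 0)) refl)) χ-zero))
      ... | no v≢0 | yes (s , e) = ℤ.≤-reflexive (cong (ℤ._+_ (+ 1)) (χ-nonsquare λ (t , h) → -1-nonsquare (t * inv s)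
              (linear₂ (trans h (cong -_ (sym e))) (*-inverseʳ s (λ { refl → v≢0 (trans (sym e) (zeroˡ 0F)) })) (inv s * inv s) (- (1F + s * inv s))
                (solve 3 (λ t s i → (t :* i) :* (t :* i) :- (:- con (+ 1)) := (i :* i) :* (t :* t :- (:- (s :* s))) :+ (:- (con (+ 1) :+ s :* i)) :* (s :* i :- con (+ 1))) refl t s (inv s)))))
      ... | no _ | no _ = ℤ.+-monoʳ-≤ -[1+ 0 ] (χ≤1 (- v))
      below : ∀ v → f v ℤ.≤ indicator (c ≟ v) ℤ.* f v
      below v with c ≟ v
      ... | yes refl = ℤ.≤-reflexive (sym (ℤ.*-identityˡ (f c)))
      ... | no _ = nonpos v
      neg-neg : ∀ x → - - x ≡ x
      neg-neg = solve 1 (λ x → :- :- x := x) refl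
      total : ∑ f ≡ + 0
      total = trans (∑-+ χ (χ ∘ -_)) (cong₂ ℤ._+_ ∑χ≡0 (trans (∑-reindex χ -_ -_ neg-neg neg-neg) ∑χ≡0))

-- Sums of the quadratic character

square-nonneg : ∀ i → + 0 ℤ.≤ i ℤ.* i
square-nonneg (+ n) = subst (+ 0 ℤ.≤_) (ℤ.pos-* n n) (ℤ.+≤+ ℕ.z≤n)
square-nonneg -[1+ n ] = ℤ.+≤+ ℕ.z≤n

module CharacterSums {p : ℕ} (K : PrimeField p) (m : ℕ) (p+1 : suc p ≡ 2 ℕ.^ (3 ℕ.+ m)) where
  open Character K m p+1 public
  open Ring using (solve; _:=_; _:+_; _:*_; _:-_; :-_; con)

  χ-neg′ : ∀ c → χ (- c) ≡ ℤ.- χ c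
  χ-neg′ c = ≡-from (χ-neg c) (ℤS.solve 2 (λ a b → b ℤS.:- (ℤS.:- a) ℤS.:= (a ℤS.:+ b) ℤS.:- ℤS.con (+ 0)) refl (χ c) (χ (- c)))

  -- As -1 is a nonsquare, the nonsquares are the elements -(s * s), and multiplicativity of `χ`
  -- becomes a check on explicit roots.
  data Trichotomy (c : F) : Set where
    is-zero : c ≡ 0F → Trichotomy c
    is-square : ∀ {s} → s ≢ 0F → c ≡ s * s → Trichotomy c
    is-negsquare : ∀ {s} → s ≢ 0F → c ≡ - (s * s) → Trichotomy c

  trichotomy : ∀ c → Trichotomy c
  trichotomy c with c ≟ 0F | isSquare? c | isSquare? (- c)
  ... | yes e | _ | _ = is-zero e
  ... | no c≢0 | yes (s , e) | _ = is-square (λ { refl → c≢0 (trans (sym e) (zeroˡ 0F)) }) (sym e)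
  ... | no c≢0 | no _ | yes (s , e) = is-negsquare {s = s} (λ { refl → c≢0 (-x≡0⇒x≡0 (trans (sym e) (zeroˡ 0F))) })
        (linear e 1F (solve 2 (λ c s → c :- :- (s :* s) := con (+ 1) :* (s :* s :- :- c)) refl c s))
  -- If c and -c were both nonsquares, χ c + χ(-c) would be -2 instead of 0.
  ... | no _ | no n | no n′ with trans (sym (cong₂ ℤ._+_ (χ-nonsquare n) (χ-nonsquare n′))) (χ-neg c)
  ...   | ()

  χ-negsquare : ∀ {s c} → s ≢ 0F → c ≡ - (s * s) → χ c ≡ -[1+ 0 ]
  χ-negsquare {s} s≢0 refl = trans (χ-neg′ (s * s)) (cong ℤ.-_ (χ-square s≢0 refl))

  χ-* : ∀ a b → χ (a * b) ≡ χ a ℤ.* χ b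
  χ-* a b with trichotomy a | trichotomy b
  ... | is-zero refl | _ = trans (cong χ (zeroˡ b)) (trans χ-zero (sym (trans (cong (ℤ._* χ b) χ-zero) (ℤ.*-zeroˡ (χ b)))))
  ... | is-square _ _ | is-zero refl = trans (cong χ (zeroʳ a)) (trans χ-zero (sym (trans (cong (χ a ℤ.*_) χ-zero) (ℤ.*-zeroʳ (χ a)))))
  ... | is-negsquare _ _ | is-zero refl = trans (cong χ (zeroʳ a)) (trans χ-zero (sym (trans (cong (χ a ℤ.*_) χ-zero) (ℤ.*-zeroʳ (χ a)))))
  ... | is-square {s} s≢0 refl | is-square {t} t≢0 refl = trans (χ-square (*-nonzero s≢0 t≢0) (solve 2 (λ s t → (s :* t) :* (s :* t) := s :* s :* (t :* t)) refl s t)) (sym (cong₂ ℤ._*_ (χ-square s≢0 refl) (χ-square t≢0 refl)))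
  ... | is-square {s} s≢0 refl | is-negsquare {t} t≢0 refl = trans (χ-negsquare (*-nonzero s≢0 t≢0) (solve 2 (λ s t → s :* s :* (:- (t :* t)) := :- ((s :* t) :* (s :* t))) refl s t)) (sym (cong₂ ℤ._*_ (χ-square s≢0 refl) (χ-negsquare t≢0 refl)))
  ... | is-negsquare {s} s≢0 refl | is-square {t} t≢0 refl = trans (χ-negsquare (*-nonzero s≢0 t≢0) (solve 2 (λ s t → (:- (s :* s)) :* (t :* t) := :- ((s :* t) :* (s :* t))) refl s t)) (sym (cong₂ ℤ._*_ (χ-negsquare s≢0 refl) (χ-square t≢0 refl)))
  ... | is-negsquare {s} s≢0 refl | is-negsquare {t} t≢0 refl = trans (χ-square (*-nonzero s≢0 t≢0) (solve 2 (λ s t → (s :* t) :* (s :* t) := (:- (s :* s)) :* (:- (t :* t))) refl s t)) (sym (cong₂ ℤ._*_ (χ-negsquare s≢0 refl) (χ-negsquare t≢0 refl)))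

  χ² : ∀ {c} → c ≢ 0F → χ c ℤ.* χ c ≡ + 1
  χ² {c} c≢0 = trans (sym (χ-* c c)) (χ-square c≢0 refl)

  χ-*-square : ∀ {s} c → s ≢ 0F → χ (s * s * c) ≡ χ c
  χ-*-square {s} c s≢0 = trans (χ-* (s * s) c) (trans (cong (ℤ._* χ c) (χ-square s≢0 refl)) (ℤ.*-identityˡ (χ c)))

  χ-inv : ∀ c → χ (inv c) ≡ χ c
  χ-inv c with c ≟ 0F
  ... | yes refl = cong χ inv-zero
  ... | no c≢0 = trans (sym (χ-*-square (inv c) c≢0)) (cong χ (linear (*-inverseʳ c c≢0) c
                   (solve 2 (λ c i → c :* c :* i :- c := c :* (c :* i :- con (+ 1))) refl c (inv c))))

  ∑-shift : ∀ (g : F → ℤ) b → ∑ (λ x → g (x - b)) ≡ ∑ g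
  ∑-shift g b = ∑-reindex g (_- b) (_+ b)
    (λ x → solve 2 (λ x b → x :+ b :- b := x) refl x b) (λ x → solve 2 (λ x b → x :- b :+ b := x) refl x b)

  ∑-scale : ∀ (g : F → ℤ) {α} → α ≢ 0F → ∑ (λ x → g (α * x)) ≡ ∑ g
  ∑-scale g {α} α≢0 = ∑-reindex g (α *_) (inv α *_)
    (λ x → linear (*-inverseʳ α α≢0) x (solve 3 (λ a i x → a :* (i :* x) :- x := x :* (a :* i :- con (+ 1))) refl α (inv α) x))
    (λ x → linear (*-inverseʳ α α≢0) x (solve 3 (λ a i x → i :* (a :* x) :- x := x :* (a :* i :- con (+ 1))) refl α (inv α) x))

  -- For x ≠ 0, x(x+e) differs from 1 + e/x by a square factor.
  ∑χ[x*[x+e]] : ∀ {e} → e ≢ 0F → ∑ (λ x → χ (x * (x + e))) ≡ -[1+ 0 ]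
  ∑χ[x*[x+e]] {e} e≢0 = begin
    ∑ (λ x → χ (x * (x + e))) ≡⟨ ∑-cong pointwise ⟩
    ∑ (λ x → χ (1F + e * inv x) ℤ.- indicator (0F ≟ x)) ≡⟨ ∑-minus (λ x → χ (1F + e * inv x)) (λ x → indicator (0F ≟ x)) ⟩
    ∑ (λ x → χ (1F + e * inv x)) ℤ.- ∑ (λ x → indicator (0F ≟ x)) ≡⟨ cong₂ ℤ._-_ affine (∑-δ 0F) ⟩
    -[1+ 0 ] ∎
    where
    open ≡-Reasoning
    pointwise : ∀ x → χ (x * (x + e)) ≡ χ (1F + e * inv x) ℤ.- indicator (0F ≟ x)
    pointwise x with 0F ≟ x
    ... | yes refl = trans (trans (cong χ (zeroˡ (0F + e))) χ-zero) (sym (cong (ℤ._- + 1) (χ-square {1F} 1≢0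
                       (trans (solve 1 (λ e → con (+ 1) :* con (+ 1) := con (+ 1) :+ e :* con (+ 0)) refl e) (cong (λ i → 1F + e * i) (sym inv-zero))))))
    ... | no n = trans (trans (cong χ (linear (*-inverseʳ x (n ∘ sym)) (- (e * x))
                    (solve 3 (λ x e i → x :* (x :+ e) :- x :* x :* (con (+ 1) :+ e :* i) := (:- (e :* x)) :* (x :* i :- con (+ 1))) refl x e (inv x))))
                    (χ-*-square (1F + e * inv x) (n ∘ sym))) (sym (ℤ.+-identityʳ (χ (1F + e * inv x))))
    affine : ∑ (λ x → χ (1F + e * inv x)) ≡ + 0
    affine = trans (∑-reindex χ (λ x → 1F + e * inv x) (λ y → inv (inv e * (y - 1F)))
      (λ y → trans (cong (λ t → 1F + e * t) (inv-involutive (inv e * (y - 1F)))) (linear (*-inverseʳ e e≢0) (y - 1F)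
               (solve 3 (λ e i y → con (+ 1) :+ e :* (i :* (y :- con (+ 1))) :- y := (y :- con (+ 1)) :* (e :* i :- con (+ 1))) refl e (inv e) y)))
      (λ x → trans (cong inv (linear (*-inverseʳ e e≢0) (inv x)
               (solve 3 (λ e i x → i :* (con (+ 1) :+ e :* x :- con (+ 1)) :- x := x :* (e :* i :- con (+ 1))) refl e (inv e) (inv x)))) (inv-involutive x)))
      ∑χ≡0

  -- The cases b = c and b ≠ c share one formula, so that it can be expanded under a double sum in
  -- `bessel`.
  ∑χ-quadratic : ∀ b c → ∑ (λ x → χ ((x - b) * (x - c))) ≡ + p ℤ.* indicator (b ≟ c) ℤ.- + 1
  ∑χ-quadratic b c with b ≟ c
  ... | no b≢c = trans (trans (∑-cong (λ x → cong χ (solve 3 (λ x b c → (x :- b) :* (x :- c) := (x :- b) :* (x :- b :+ (b :- c))) refl x b c)))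
                   (trans (∑-shift (λ x → χ (x * (x + (b - c)))) b) (∑χ[x*[x+e]] (λ h → b≢c (x-y≡0⇒x≡y h)))))
                   (cong (ℤ._- + 1) (sym (ℤ.*-zeroʳ (+ p))))
  ... | yes refl = trans (∑-cong pointwise) (trans (∑-minus (λ _ → + 1) (λ x → indicator (b ≟ x))) (cong₂ ℤ._-_ (∑-const (+ 1)) (∑-δ b)))
    where
    pointwise : ∀ x → χ ((x - b) * (x - b)) ≡ + 1 ℤ.- indicator (b ≟ x)
    pointwise x with b ≟ x
    ... | yes refl = trans (cong χ (solve 1 (λ b → (b :- b) :* (b :- b) := con (+ 0)) refl b)) χ-zero
    ... | no n = χ-square (λ h → n (sym (x-y≡0⇒x≡y h))) refl

  ∑χ-affine : ∀ {α} → α ≢ 0F → ∀ β → ∑ (λ x → χ (α * x - β)) ≡ + 0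
  ∑χ-affine {α} α≢0 β = trans (∑-scale (λ x → χ (x - β)) α≢0) (trans (∑-shift χ β) ∑χ≡0)

  -- Grouping by v = y² leaves a linear sum, which vanishes, and χ(α) times the quadratic sum of
  -- χ(v(v - β/α)), which is -1.
  ∑χ[αy²-β] : ∀ {α β} → α ≢ 0F → β ≢ 0F → ∑ (λ y → χ (α * (y * y) - β)) ≡ ℤ.- χ α
  ∑χ[αy²-β] {α} {β} α≢0 β≢0 = begin
    ∑ (λ y → χ (α * (y * y) - β)) ≡⟨ ∑-of-squares (λ v → χ (α * v - β)) ⟩
    ∑ (λ v → (+ 1 ℤ.+ χ v) ℤ.* χ (α * v - β)) ≡⟨ ∑-cong pointwise ⟩
    ∑ (λ v → χ (α * v - β) ℤ.+ χ α ℤ.* χ ((v - 0F) * (v - γ))) ≡⟨ ∑-+ (λ v → χ (α * v - β)) (λ v → χ α ℤ.* χ ((v - 0F) * (v - γ))) ⟩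
    ∑ (λ v → χ (α * v - β)) ℤ.+ ∑ (λ v → χ α ℤ.* χ ((v - 0F) * (v - γ))) ≡⟨ cong₂ ℤ._+_ (∑χ-affine α≢0 β) (∑-* (χ α) (λ v → χ ((v - 0F) * (v - γ)))) ⟩
    + 0 ℤ.+ χ α ℤ.* ∑ (λ v → χ ((v - 0F) * (v - γ))) ≡⟨ cong (λ t → + 0 ℤ.+ χ α ℤ.* t) (trans (∑χ-quadratic 0F γ) (cong (λ t → + p ℤ.* t ℤ.- + 1) (indicator-no (0F ≟ γ) (γ≢0 ∘ sym)))) ⟩
    + 0 ℤ.+ χ α ℤ.* (+ p ℤ.* + 0 ℤ.- + 1) ≡⟨ ℤS.solve 2 (λ a p → ℤS.con (+ 0) ℤS.:+ a ℤS.:* (p ℤS.:* ℤS.con (+ 0) ℤS.:- ℤS.con (+ 1)) ℤS.:= ℤS.:- a) refl (χ α) (+ p) ⟩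
    ℤ.- χ α ∎
    where
    open ≡-Reasoning
    γ = β * inv α
    γ≢0 : γ ≢ 0F
    γ≢0 = *-nonzero β≢0 (inv-nonzero α≢0)
    pointwise : ∀ v → (+ 1 ℤ.+ χ v) ℤ.* χ (α * v - β) ≡ χ (α * v - β) ℤ.+ χ α ℤ.* χ ((v - 0F) * (v - γ))
    pointwise v = trans (ℤS.solve 2 (λ c d → (ℤS.con (+ 1) ℤS.:+ c) ℤS.:* d ℤS.:= d ℤS.:+ c ℤS.:* d) refl (χ v) (χ (α * v - β)))
      (cong (ℤ._+_ (χ (α * v - β))) (trans (sym (χ-* v (α * v - β))) (trans (cong χ (linear (*-inverseʳ α α≢0) (v * β)
        (solve 4 (λ v a b i → v :* (a :* v :- b) :- a :* ((v :- con (+ 0)) :* (v :- b :* i)) := (v :* b) :* (a :* i :- con (+ 1))) refl v α β (inv α)))) (χ-* α ((v - 0F) * (v - γ))))))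

  -- The vectors λ ↦ χ(w − λ) are orthogonal up to an error of −1 in each inner product.
  bessel : ∀ (h : F → ℤ) → ∑ (λ l → ∑ (λ w → h w ℤ.* χ (w - l)) ℤ.* ∑ (λ w → h w ℤ.* χ (w - l))) ℤ.≤ + p ℤ.* ∑ (λ w → h w ℤ.* h w)
  bessel h = ≤-from (square-nonneg (∑ h)) (trans (cong (ℤ._-_ (+ p ℤ.* ∑ (λ w → h w ℤ.* h w))) total)
      (ℤS.solve 2 (λ a b → a ℤS.:- (a ℤS.:- b ℤS.:* b) ℤS.:= b ℤS.:* b ℤS.:- ℤS.con (+ 0)) refl (+ p ℤ.* ∑ (λ w → h w ℤ.* h w)) (∑ h)))
    where
    open ≡-Reasoning
    term : F → F → ℤ
    term w l = h w ℤ.* χ (w - l)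
    swap-product : ∀ w l → term w l ℤ.* ∑ (λ v → term v l) ≡ ∑ (λ v → (h w ℤ.* h v) ℤ.* χ ((l - w) * (l - v)))
    swap-product w l = trans (sym (∑-* (term w l) (λ v → term v l))) (∑-cong λ v → begin
      (h w ℤ.* χ (w - l)) ℤ.* (h v ℤ.* χ (v - l)) ≡⟨ ℤS.solve 4 (λ a b c d → (a ℤS.:* b) ℤS.:* (c ℤS.:* d) ℤS.:= (a ℤS.:* c) ℤS.:* (b ℤS.:* d)) refl (h w) (χ (w - l)) (h v) (χ (v - l)) ⟩
      (h w ℤ.* h v) ℤ.* (χ (w - l) ℤ.* χ (v - l)) ≡⟨ cong (ℤ._*_ (h w ℤ.* h v)) (trans (sym (χ-* (w - l) (v - l))) (cong χ (solve 3 (λ w v l → (w :- l) :* (v :- l) := (l :- w) :* (l :- v)) refl w v l))) ⟩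
      (h w ℤ.* h v) ℤ.* χ ((l - w) * (l - v)) ∎)
    inner : ∀ w → ∑ (λ v → (h w ℤ.* h v) ℤ.* (+ p ℤ.* indicator (w ≟ v) ℤ.- + 1)) ≡ + p ℤ.* (h w ℤ.* h w) ℤ.- h w ℤ.* ∑ h
    inner w = begin
      ∑ (λ v → (h w ℤ.* h v) ℤ.* (+ p ℤ.* indicator (w ≟ v) ℤ.- + 1))
        ≡⟨ ∑-cong (λ v → ℤS.solve 4 (λ a b p i → (a ℤS.:* b) ℤS.:* (p ℤS.:* i ℤS.:- ℤS.con (+ 1)) ℤS.:= (p ℤS.:* a) ℤS.:* (i ℤS.:* b) ℤS.:- a ℤS.:* b) refl (h w) (h v) (+ p) (indicator (w ≟ v))) ⟩
      ∑ (λ v → (+ p ℤ.* h w) ℤ.* (indicator (w ≟ v) ℤ.* h v) ℤ.- h w ℤ.* h v)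
        ≡⟨ ∑-minus (λ v → (+ p ℤ.* h w) ℤ.* (indicator (w ≟ v) ℤ.* h v)) (λ v → h w ℤ.* h v) ⟩
      ∑ (λ v → (+ p ℤ.* h w) ℤ.* (indicator (w ≟ v) ℤ.* h v)) ℤ.- ∑ (λ v → h w ℤ.* h v)
        ≡⟨ cong₂ ℤ._-_ (trans (∑-* (+ p ℤ.* h w) (λ v → indicator (w ≟ v) ℤ.* h v)) (trans (cong (ℤ._*_ (+ p ℤ.* h w)) (∑-pick w h)) (ℤ.*-assoc (+ p) (h w) (h w)))) (∑-* (h w) h) ⟩
      + p ℤ.* (h w ℤ.* h w) ℤ.- h w ℤ.* ∑ h ∎
    total : ∑ (λ l → ∑ (λ w → term w l) ℤ.* ∑ (λ w → term w l)) ≡ + p ℤ.* ∑ (λ w → h w ℤ.* h w) ℤ.- ∑ h ℤ.* ∑ h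
    total = begin
      ∑ (λ l → ∑ (λ w → term w l) ℤ.* ∑ (λ w → term w l))
        ≡⟨ ∑-cong (λ l → trans (sym (∑-*ʳ (∑ (λ w → term w l)) (λ w → term w l))) (∑-cong (λ w → swap-product w l))) ⟩
      ∑ (λ l → ∑ (λ w → ∑ (λ v → (h w ℤ.* h v) ℤ.* χ ((l - w) * (l - v)))))
        ≡⟨ ∑-swap (finite p) (λ l w → ∑ (λ v → (h w ℤ.* h v) ℤ.* χ ((l - w) * (l - v)))) ⟩
      ∑ (λ w → ∑ (λ l → ∑ (λ v → (h w ℤ.* h v) ℤ.* χ ((l - w) * (l - v)))))
        ≡⟨ ∑-cong (λ w → trans (∑-swap (finite p) (λ l v → (h w ℤ.* h v) ℤ.* χ ((l - w) * (l - v))))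
             (∑-cong (λ v → trans (∑-* (h w ℤ.* h v) (λ l → χ ((l - w) * (l - v)))) (cong (ℤ._*_ (h w ℤ.* h v)) (∑χ-quadratic w v))))) ⟩
      ∑ (λ w → ∑ (λ v → (h w ℤ.* h v) ℤ.* (+ p ℤ.* indicator (w ≟ v) ℤ.- + 1)))
        ≡⟨ ∑-cong inner ⟩
      ∑ (λ w → + p ℤ.* (h w ℤ.* h w) ℤ.- h w ℤ.* ∑ h)
        ≡⟨ ∑-minus (λ w → + p ℤ.* (h w ℤ.* h w)) (λ w → h w ℤ.* ∑ h) ⟩
      ∑ (λ w → + p ℤ.* (h w ℤ.* h w)) ℤ.- ∑ (λ w → h w ℤ.* ∑ h)
        ≡⟨ cong₂ ℤ._-_ (∑-* (+ p) (λ w → h w ℤ.* h w)) (∑-*ʳ (∑ h) h) ⟩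
      + p ℤ.* ∑ (λ w → h w ℤ.* h w) ℤ.- ∑ h ℤ.* ∑ h ∎

-- Rotations of the conics

module Rotation {p : ℕ} (K : PrimeField p) (m : ℕ) (p+1 : suc p ≡ 2 ℕ.^ (3 ℕ.+ m)) where
  open CharacterSums K m p+1 public
  open Ring using (solve; _:=_; _:+_; _:*_; _:-_; :-_; con)
  open ≡-Reasoning

  plane : Summation (F × F)
  plane = finite p ×-summation finite p

  module Plane = Summation plane

  ρ : F → F × F → F × F
  ρ X (y , z) = z , X * z - y

  -- The quadratic form invariant under `ρ X`; the conic is its level set at -X².
  form : F → F × F → F
  form X (y , z) = y * y + z * z - X * y * z

  OnConic : F → F × F → Set
  OnConic X (y , z) = X * X + y * y + z * z ≡ X * y * z

  onConic? : ∀ X v → Dec (OnConic X v)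
  onConic? X (y , z) = X * X + y * y + z * z ≟ X * y * z

  infixl 6 _⊕_
  _⊕_ : F × F → F × F → F × F
  (y , z) ⊕ (y′ , z′) = y + y′ , z + z′

  infixl 7 _⊙_
  _⊙_ : F → F × F → F × F
  α ⊙ (y , z) = α * y , α * z

  origin : F × F
  origin = 0F , 0F

  ρ-linear : ∀ X α v β w → ρ X (α ⊙ v ⊕ β ⊙ w) ≡ α ⊙ ρ X v ⊕ β ⊙ ρ X w
  ρ-linear X α (y , z) β (y′ , z′) = cong₂ _,_ refl
    (trans (cong₂ (λ s t → s - t) (solve 5 (λ X a z b z′ → X :* (a :* z :+ b :* z′) := a :* (X :* z) :+ b :* (X :* z′)) refl X α z β z′) refl)
      (solve 6 (λ a s y b t y′ → a :* s :+ b :* t :- (a :* y :+ b :* y′) := a :* (s :- y) :+ b :* (t :- y′)) refl α (X * z) y β (X * z′) y′))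

  iterate-linear : ∀ X k α v β w → iterate (ρ X) k (α ⊙ v ⊕ β ⊙ w) ≡ α ⊙ iterate (ρ X) k v ⊕ β ⊙ iterate (ρ X) k w
  iterate-linear X zero α v β w = refl
  iterate-linear X (suc k) α v β w = trans (cong (ρ X) (iterate-linear X k α v β w)) (ρ-linear X α (iterate (ρ X) k v) β (iterate (ρ X) k w))

  ρ-injective : ∀ X {v w} → ρ X v ≡ ρ X w → v ≡ w
  ρ-injective X {y , z} {y′ , z′} h with cong proj₁ h | cong proj₂ h
  ... | refl | e = cong₂ _,_ (linear e (- 1F) (solve 4 (λ X y z y′ → y :- y′ := (:- con (+ 1)) :* (X :* z :- y :- (X :* z :- y′))) refl X y z y′)) refl

  ρ-conic : ∀ X {v} → OnConic X v → OnConic X (ρ X v)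
  ρ-conic X {y , z} h = linear h 1F (solve 3 (λ X y z →
    X :* X :+ z :* z :+ (X :* z :- y) :* (X :* z :- y) :- X :* z :* (X :* z :- y) := con (+ 1) :* (X :* X :+ y :* y :+ z :* z :- X :* y :* z)) refl X y z)

  swap : F × F → F × F
  swap (y , z) = z , y

  swap-conic : ∀ X {v} → OnConic X v → OnConic X (swap v)
  swap-conic X {y , z} h = linear h 1F (solve 3 (λ X y z → X :* X :+ z :* z :+ y :* y :- X :* z :* y := con (+ 1) :* (X :* X :+ y :* y :+ z :* z :- X :* y :* z)) refl X y z)

  conic-form : ∀ {X v} → X ≢ 0F → OnConic X v → form X v ≢ 0F
  conic-form {X} {y , z} X≢0 h e = X≢0 (x²≡0 (linear₂ h e 1F (- 1F)
    (solve 3 (λ X y z → X :* X :- con (+ 0) := con (+ 1) :* (X :* X :+ y :* y :+ z :* z :- X :* y :* z) :+ (:- con (+ 1)) :* (y :* y :+ z :* z :- X :* y :* z :- con (+ 0))) refl X y z)))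

  -- The determinant of (v, ρ v) is −form X v, so Cramer's rule expresses w through v and ρ v.
  span : ∀ X v → form X v ≢ 0F → ∀ w → ∃ λ α → ∃ λ β → w ≡ α ⊙ v ⊕ β ⊙ ρ X v
  span X (y , z) q≢0 (y′ , z′) = i * (z * z′ - y′ * r) , i * (z * y′ - y * z′) , cong₂ _,_
    (divide y′ (solve 5 (λ y z r y′ z′ → (z :* z′ :- y′ :* r) :* y :+ (z :* y′ :- y :* z′) :* z := y′ :* (z :* z :- y :* r)) refl y z r y′ z′))
    (divide z′ (solve 5 (λ y z r y′ z′ → (z :* z′ :- y′ :* r) :* z :+ (z :* y′ :- y :* z′) :* r := z′ :* (z :* z :- y :* r)) refl y z r y′ z′))
    where
    r i : F
    r = X * z - y
    i = inv (form X (y , z))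
    divide : ∀ c {a b s t} → a * s + b * t ≡ c * (z * z - y * r) → c ≡ i * a * s + i * b * t
    divide c {a} {b} {s} {t} h = begin
      c ≡⟨ sym (*-identityʳ c) ⟩
      c * 1F ≡⟨ cong (c *_) (sym (*-inverseʳ (form X (y , z)) q≢0)) ⟩
      c * (form X (y , z) * i) ≡⟨ cong (λ q → c * (q * i)) (solve 3 (λ X y z → y :* y :+ z :* z :- X :* y :* z := z :* z :- y :* (X :* z :- y)) refl X y z) ⟩
      c * ((z * z - y * r) * i) ≡⟨ sym (*-assoc c (z * z - y * r) i) ⟩
      c * (z * z - y * r) * i ≡⟨ cong (_* i) (sym h) ⟩
      (a * s + b * t) * i ≡⟨ solve 5 (λ a b s t i → (a :* s :+ b :* t) :* i := i :* a :* s :+ i :* b :* t) refl a b s t i ⟩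
      i * a * s + i * b * t ∎

  -- A power of ρ that fixes v also fixes ρ v, and these two vectors span the plane. Hence all
  -- points of the conic have the same period.
  fixes-one⇒fixes-all : ∀ X k {v} → form X v ≢ 0F → iterate (ρ X) k v ≡ v → ∀ w → iterate (ρ X) k w ≡ w
  fixes-one⇒fixes-all X k {v} q≢0 h w =
    let α , β , e = span X v q≢0 w in begin
    iterate (ρ X) k w ≡⟨ cong (iterate (ρ X) k) e ⟩
    iterate (ρ X) k (α ⊙ v ⊕ β ⊙ ρ X v) ≡⟨ iterate-linear X k α v β (ρ X v) ⟩
    α ⊙ iterate (ρ X) k v ⊕ β ⊙ iterate (ρ X) k (ρ X v) ≡⟨ cong₂ (λ s t → α ⊙ s ⊕ β ⊙ t) h (trans (sym (iterate-suc (ρ X) k v)) (cong (ρ X) h)) ⟩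
    α ⊙ v ⊕ β ⊙ ρ X v ≡⟨ sym e ⟩
    w ∎

  module Orb X = Orbits plane (ρ X) (ρ-injective X)
  open Orb using (FreeBelow; FreeOn)

  first-return : ∀ X v N → FreeBelow X (suc N) v ⊎ ∃ λ e → iterate (ρ X) (suc e) v ≡ v × FreeBelow X (suc e) v
  first-return X v zero = inj₁ λ { (suc k) _ (ℕ.s≤s ()) }
  first-return X v (suc N) with first-return X v N
  ... | inj₂ found = inj₂ found
  ... | inj₁ free with iterate (ρ X) (suc N) v Plane.≟ v
  ...   | yes e = inj₂ (N , e , free)
  ...   | no n = inj₁ λ k 0<k k<N+2 → [ free k 0<k , (λ { refl → n }) ]′ (ℕ.m≤n⇒m<n∨m≡n (ℕ.s≤s⁻¹ k<N+2))
    where open Data.Sum using ([_,_]′)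

  conic-freeOn : ∀ X {e v} → X ≢ 0F → OnConic X v → iterate (ρ X) (suc e) v ≡ v → FreeBelow X (suc e) v → FreeOn X (OnConic X) e
  conic-freeOn X {e} {v} X≢0 Cv period free = record
    { closed = λ {w} → ρ-conic X {w}
    ; periodic = λ {w} _ → fixes-one⇒fixes-all X (suc e) (conic-form {X} {v} X≢0 Cv) period w
    ; free = λ {w} Cw k 0<k k<d h → free k 0<k k<d (fixes-one⇒fixes-all X k (conic-form {X} {w} X≢0 Cw) h v) }

  -- Lagrange's theorem for the group generated by ρ, acting freely on the conic.
  period-count : ∀ X {N v} → X ≢ 0F → OnConic X v → Plane.count (onConic? X) ≡ + N → ∀ w → iterate (ρ X) N w ≡ w
  period-count X {N} {v} X≢0 Cv size w with first-return X v N
  -- N + 1 distinct points of one orbit do not fit on a conic of N points.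
  ... | inj₁ free = ⊥-elim (ℕ.<⇒≱ (ℕ.n<1+n N) (ℤ.drop‿+≤+ (subst₂ ℤ._≤_ (count-image plane (λ i → iterate (ρ X) (toℕ i) v) (Orb.orbit-injective X free)) size (Plane.∑-mono below))))
    where
    below : ∀ u → indicator (Fin.any? (λ i → iterate (ρ X) (toℕ i) v Plane.≟ u)) ℤ.≤ indicator (onConic? X u)
    below u = indicator-mono (Fin.any? (λ i → iterate (ρ X) (toℕ i) v Plane.≟ u)) (onConic? X u)
      (λ (i , h) → subst (OnConic X) h (iterate-preserves (OnConic X) (λ {w} → ρ-conic X {w}) (toℕ i) {v} Cv))
  ... | inj₂ (e , period , free) with Orb.orbit-size-divides X (onConic? X) (conic-freeOn X X≢0 Cv period free)
  ...   | k , h = begin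
    iterate (ρ X) N w ≡⟨ cong (λ j → iterate (ρ X) j w) (ℤ.+-injective (trans (sym size) (trans h (sym (ℤ.pos-* k (suc e)))))) ⟩
    iterate (ρ X) (k ℕ.* suc e) w ≡⟨ iterate-* (ρ X) k (suc e) w ⟩
    iterate (iterate (ρ X) (suc e)) k w ≡⟨ iterate-preserves (_≡ w) (λ { refl → fixes-one⇒fixes-all X (suc e) (conic-form {X} {v} X≢0 Cv) period w }) k refl ⟩
    w ∎

  discriminant : F → F
  discriminant X = X * X - 4F

  -- For fixed y, completing the square turns the equation into (2z - Xy)² = (X² - 4)y² - 4X², so
  -- the number of z is 1 + χ of the right-hand side.
  conic-size : ∀ X → X ≢ 0F → discriminant X ≢ 0F → Plane.count (onConic? X) ≡ + p ℤ.- χ (discriminant X)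
  conic-size X X≢0 a≢0 = begin
    ∑ (λ y → ∑ (λ z → indicator (onConic? X (y , z)))) ≡⟨ ∑-cong fibre ⟩
    ∑ (λ y → + 1 ℤ.+ χ (discriminant X * (y * y) - 4F * (X * X))) ≡⟨ ∑-+ (λ _ → + 1) (λ y → χ (discriminant X * (y * y) - 4F * (X * X))) ⟩
    ∑ (λ _ → + 1) ℤ.+ ∑ (λ y → χ (discriminant X * (y * y) - 4F * (X * X))) ≡⟨ cong₂ ℤ._+_ (trans (∑-const (+ 1)) (ℤ.*-identityʳ (+ p))) (∑χ[αy²-β] a≢0 (*-nonzero 4≢0 (*-nonzero X≢0 X≢0))) ⟩
    + p ℤ.- χ (discriminant X) ∎
    where
    fibre : ∀ y → ∑ (λ z → indicator (onConic? X (y , z))) ≡ + 1 ℤ.+ χ (discriminant X * (y * y) - 4F * (X * X))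
    fibre y = trans (trans (∑-cong (λ z → indicator-cong (onConic? X (y , z)) (σ z * σ z ≟ D) (to z) (from z)))
        (∑-reindex (λ u → indicator (u * u ≟ D)) σ τ στ τσ)) (roots D)
      where
      D = discriminant X * (y * y) - 4F * (X * X)
      σ τ : F → F
      σ z = 2F * z - X * y
      τ u = inv 2F * (u + X * y)
      στ : ∀ u → σ (τ u) ≡ u
      στ u = linear (*-inverseʳ 2F 2≢0) (u + X * y) (solve 4 (λ i u X y → con (+ 2) :* (i :* (u :+ X :* y)) :- X :* y :- u := (u :+ X :* y) :* (con (+ 2) :* i :- con (+ 1))) refl (inv 2F) u X y)
      τσ : ∀ z → τ (σ z) ≡ z
      τσ z = linear (*-inverseʳ 2F 2≢0) z (solve 4 (λ i z X y → i :* (con (+ 2) :* z :- X :* y :+ X :* y) :- z := z :* (con (+ 2) :* i :- con (+ 1))) refl (inv 2F) z X y)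
      to : ∀ z → OnConic X (y , z) → σ z * σ z ≡ D
      to z h = linear h 4F (solve 3 (λ X y z → (con (+ 2) :* z :- X :* y) :* (con (+ 2) :* z :- X :* y) :- ((X :* X :- con (+ 4)) :* (y :* y) :- con (+ 4) :* (X :* X)) := con (+ 4) :* (X :* X :+ y :* y :+ z :* z :- X :* y :* z)) refl X y z)
      from : ∀ z → σ z * σ z ≡ D → OnConic X (y , z)
      from z h = *-cancelˡ 4≢0 (linear h 1F (solve 3 (λ X y z → con (+ 4) :* (X :* X :+ y :* y :+ z :* z) :- con (+ 4) :* (X :* y :* z) := con (+ 1) :* ((con (+ 2) :* z :- X :* y) :* (con (+ 2) :* z :- X :* y) :- ((X :* X :- con (+ 4)) :* (y :* y) :- con (+ 4) :* (X :* X)))) refl X y z))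

  -- When X² = 4 the equation becomes (2z - Xy)² = -(2X)², which would make -1 a square.
  parabolic-empty : ∀ X {v} → X ≢ 0F → discriminant X ≡ 0F → ¬ OnConic X v
  parabolic-empty X {y , z} X≢0 a≡0 h = -1-nonsquare ((2F * z - X * y) * inv (2F * X)) (begin
    (2F * z - X * y) * inv (2F * X) * ((2F * z - X * y) * inv (2F * X))
      ≡⟨ solve 2 (λ s i → s :* i :* (s :* i) := (s :* s) :* (i :* i)) refl (2F * z - X * y) (inv (2F * X)) ⟩
    (2F * z - X * y) * (2F * z - X * y) * (inv (2F * X) * inv (2F * X))
      ≡⟨ cong (_* (inv (2F * X) * inv (2F * X))) (linear₂ h a≡0 4F (y * y) (solve 3 (λ X y z → (con (+ 2) :* z :- X :* y) :* (con (+ 2) :* z :- X :* y) :- (:- ((con (+ 2) :* X) :* (con (+ 2) :* X))) := con (+ 4) :* (X :* X :+ y :* y :+ z :* z :- X :* y :* z) :+ (y :* y) :* (X :* X :- con (+ 4) :- con (+ 0))) refl X y z)) ⟩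
    - ((2F * X) * (2F * X)) * (inv (2F * X) * inv (2F * X))
      ≡⟨ solve 2 (λ s i → (:- (s :* s)) :* (i :* i) := :- ((s :* i) :* (s :* i))) refl (2F * X) (inv (2F * X)) ⟩
    - ((2F * X) * inv (2F * X) * ((2F * X) * inv (2F * X)))
      ≡⟨ cong (λ t → - (t * t)) (*-inverseʳ (2F * X) (*-nonzero 2≢0 X≢0)) ⟩
    - (1F * 1F) ≡⟨ cong -_ (*-identityˡ 1F) ⟩
    - 1F ∎)

  -- X² - 4 is the discriminant of t² - Xt + 1, the characteristic polynomial of `ρ X`; an elliptic
  -- rotation has no eigenvalue in the field.
  Elliptic : F → Set
  Elliptic X = χ (discriminant X) ≡ -[1+ 0 ]

  elliptic? : ∀ X → Dec (Elliptic X)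
  elliptic? X = χ (discriminant X) ℤ.≟ -[1+ 0 ]

  -1⇒nonsquare : ∀ {c} → χ c ≡ -[1+ 0 ] → ¬ IsSquare c
  -1⇒nonsquare h (s , refl) with s ≟ 0F
  ... | yes refl = contra (trans (sym h) (trans (cong χ (zeroˡ 0F)) χ-zero))
    where
    contra : -[1+ 0 ] ≢ + 0
    contra ()
  ... | no s≢0 = contra (trans (sym h) (χ-square s≢0 refl))
    where
    contra : -[1+ 0 ] ≢ + 1
    contra ()

  elliptic⇒discriminant≢0 : ∀ {X} → Elliptic X → discriminant X ≢ 0F
  elliptic⇒discriminant≢0 h e = -1⇒nonsquare h (0F , trans (zeroˡ 0F) (sym e))

  -- A zero (y , z) of the form with z ≠ 0 would make (2y - Xz)/z a square root of X² - 4.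
  elliptic-anisotropic : ∀ {X v} → Elliptic X → v ≢ origin → form X v ≢ 0F
  elliptic-anisotropic {X} {y , z} E v≢0 q with z ≟ 0F
  ... | yes refl = v≢0 (cong₂ _,_ (x²≡0 (linear q 1F (solve 2 (λ X y → y :* y :- con (+ 0) := con (+ 1) :* (y :* y :+ con (+ 0) :* con (+ 0) :- X :* y :* con (+ 0) :- con (+ 0))) refl X y))) refl)
  ... | no z≢0 = -1⇒nonsquare E ((2F * y - X * z) * inv z , linear₂ q (*-inverseʳ z z≢0) (4F * (inv z * inv z)) ((X * X - 4F) * (z * inv z + 1F))
      (solve 4 (λ X y z i → ((con (+ 2) :* y :- X :* z) :* i) :* ((con (+ 2) :* y :- X :* z) :* i) :- (X :* X :- con (+ 4))
        := (con (+ 4) :* (i :* i)) :* (y :* y :+ z :* z :- X :* y :* z :- con (+ 0)) :+ ((X :* X :- con (+ 4)) :* (z :* i :+ con (+ 1))) :* (z :* i :- con (+ 1))) refl X y z (inv z)))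

  -- If t = u + 1/u is the trace of a matrix of determinant 1, then t² - 2 = u² + 1/u² is the trace
  -- of its square.
  trace : F → F
  trace t = t * t - 2F

  -- Cayley–Hamilton for the 2ʲ-th power of ρ X, whose trace is obtained by iterating t ↦ t² − 2.
  doubling : ∀ X j w → iterate (ρ X) (2 ℕ.^ j) (iterate (ρ X) (2 ℕ.^ j) w) ≡ iterate trace j X ⊙ iterate (ρ X) (2 ℕ.^ j) w ⊕ (- 1F) ⊙ w
  doubling X zero (y , z) = cong₂ _,_
    (solve 3 (λ X y z → X :* z :- y := X :* z :+ (:- con (+ 1)) :* y) refl X y z)
    (solve 3 (λ X y z → X :* (X :* z :- y) :- z := X :* (X :* z :- y) :+ (:- con (+ 1)) :* z) refl X y z)
  doubling X (suc j) w = begin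
    B (B w) ≡⟨ trans (cong B (B≡AA w)) (B≡AA (A (A w))) ⟩
    A (A (A (A w))) ≡⟨ doubling X j (A (A w)) ⟩
    τ ⊙ A (A (A w)) ⊕ (- 1F) ⊙ A (A w) ≡⟨ cong₂ (λ s t → τ ⊙ s ⊕ (- 1F) ⊙ t) (doubling X j (A w)) refl ⟩
    τ ⊙ (τ ⊙ A (A w) ⊕ (- 1F) ⊙ A w) ⊕ (- 1F) ⊙ A (A w) ≡⟨ collect τ (A (A w)) (A w) w (doubling X j w) ⟩
    (τ * τ - 2F) ⊙ A (A w) ⊕ (- 1F) ⊙ w ≡⟨ cong (λ t → (τ * τ - 2F) ⊙ t ⊕ (- 1F) ⊙ w) (sym (B≡AA w)) ⟩
    (τ * τ - 2F) ⊙ B w ⊕ (- 1F) ⊙ w ∎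
    where
    A B : F × F → F × F
    A = iterate (ρ X) (2 ℕ.^ j)
    B = iterate (ρ X) (2 ℕ.^ suc j)
    τ = iterate trace j X
    B≡AA : ∀ u → B u ≡ A (A u)
    B≡AA u = trans (iterate-+ (ρ X) (2 ℕ.^ j) (2 ℕ.^ j ℕ.+ 0) u) (cong (λ k → A (iterate (ρ X) k u)) (ℕ.+-identityʳ (2 ℕ.^ j)))
    collect : ∀ τ s t u → s ≡ τ ⊙ t ⊕ (- 1F) ⊙ u → τ ⊙ (τ ⊙ s ⊕ (- 1F) ⊙ t) ⊕ (- 1F) ⊙ s ≡ (τ * τ - 2F) ⊙ s ⊕ (- 1F) ⊙ u
    collect τ (s , s′) (t , t′) (u , u′) h = cong₂ _,_ (coordinate (cong proj₁ h)) (coordinate (cong proj₂ h))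
      where
      coordinate : ∀ {s t u} → s ≡ τ * t + (- 1F) * u → τ * (τ * s + (- 1F) * t) + (- 1F) * s ≡ (τ * τ - 2F) * s + (- 1F) * u
      coordinate {s} {t} {u} h = linear h 1F (solve 4 (λ T s t u → T :* (T :* s :+ (:- con (+ 1)) :* t) :+ (:- con (+ 1)) :* s :- ((T :* T :- con (+ 2)) :* s :+ (:- con (+ 1)) :* u) := con (+ 1) :* (s :- (T :* t :+ (:- con (+ 1)) :* u))) refl τ s t u)

  fixed-doubling : ∀ X j {v} → iterate (ρ X) (2 ℕ.^ j) v ≡ v → v ≡ iterate trace j X ⊙ v ⊕ (- 1F) ⊙ v
  fixed-doubling X j {v} h = trans (trans (sym h) (cong (iterate (ρ X) (2 ℕ.^ j)) (sym h))) (trans (doubling X j v) (cong (λ t → iterate trace j X ⊙ t ⊕ (- 1F) ⊙ v) h))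

  -- On a fixed vector Cayley-Hamilton reads v = τv - v, and v has a nonzero coordinate by which to
  -- divide.
  period⇒trace : ∀ X j {v} → v ≢ origin → iterate (ρ X) (2 ℕ.^ j) v ≡ v → iterate trace j X ≡ 2F
  period⇒trace X j {y , z} v≢0 h with y ≟ 0F | z ≟ 0F
  ... | yes refl | yes refl = ⊥-elim (v≢0 refl)
  ... | no y≢0 | _ = *-cancelˡ y≢0 (linear (cong proj₁ (fixed-doubling X j h)) (- 1F) (solve 2 (λ y t → y :* t :- y :* con (+ 2) := (:- con (+ 1)) :* (y :- (t :* y :+ (:- con (+ 1)) :* y))) refl y (iterate trace j X)))
  ... | yes _ | no z≢0 = *-cancelˡ z≢0 (linear (cong proj₂ (fixed-doubling X j h)) (- 1F) (solve 2 (λ y t → y :* t :- y :* con (+ 2) := (:- con (+ 1)) :* (y :- (t :* y :+ (:- con (+ 1)) :* y))) refl z (iterate trace j X)))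

  -- With trace 2, A − 1 is nilpotent, so A fixes A w − w; an anisotropic form leaves no room for that unless A = 1.
  trace⇒period : ∀ X j → Elliptic X → iterate trace j X ≡ 2F → ∀ w → iterate (ρ X) (2 ℕ.^ j) w ≡ w
  trace⇒period X j E t≡2 w with 1F ⊙ A w ⊕ (- 1F) ⊙ w Plane.≟ origin
    where A = iterate (ρ X) (2 ℕ.^ j)
  ... | yes e = cong₂ _,_ (difference (cong proj₁ e)) (difference (cong proj₂ e))
    where
    difference : ∀ {s t} → 1F * s + (- 1F) * t ≡ 0F → s ≡ t
    difference {s} {t} h = linear h 1F (solve 2 (λ s t → s :- t := con (+ 1) :* (con (+ 1) :* s :+ (:- con (+ 1)) :* t :- con (+ 0))) refl s t)
  ... | no u≢0 = fixes-one⇒fixes-all X (2 ℕ.^ j) (elliptic-anisotropic {X} E u≢0) fixed w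
    where
    A : F × F → F × F
    A = iterate (ρ X) (2 ℕ.^ j)
    coordinate : ∀ s t → 1F * (2F * s + (- 1F) * t) + (- 1F) * s ≡ 1F * s + (- 1F) * t
    coordinate = solve 2 (λ s t → con (+ 1) :* (con (+ 2) :* s :+ (:- con (+ 1)) :* t) :+ (:- con (+ 1)) :* s := con (+ 1) :* s :+ (:- con (+ 1)) :* t) refl
    fixed : A (1F ⊙ A w ⊕ (- 1F) ⊙ w) ≡ 1F ⊙ A w ⊕ (- 1F) ⊙ w
    fixed = begin
      A (1F ⊙ A w ⊕ (- 1F) ⊙ w) ≡⟨ iterate-linear X (2 ℕ.^ j) 1F (A w) (- 1F) w ⟩
      1F ⊙ A (A w) ⊕ (- 1F) ⊙ A w ≡⟨ cong (λ t → 1F ⊙ t ⊕ (- 1F) ⊙ A w) (trans (doubling X j w) (cong (λ t → t ⊙ A w ⊕ (- 1F) ⊙ w) t≡2)) ⟩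
      1F ⊙ (2F ⊙ A w ⊕ (- 1F) ⊙ w) ⊕ (- 1F) ⊙ A w ≡⟨ cong₂ _,_ (coordinate _ _) (coordinate _ _) ⟩
      1F ⊙ A w ⊕ (- 1F) ⊙ w ∎

-- Traces and orders

half : ∀ k → ∃ λ h → (k ≡ h ℕ.* 2) ⊎ (k ≡ suc (h ℕ.* 2))
half zero = 0 , inj₁ refl
half (suc k) with half k
... | h , inj₁ e = h , inj₂ (cong suc e)
... | h , inj₂ e = suc h , inj₁ (cong suc e)

-- For odd k, 2^j · k exceeds 2^j by a multiple of 2^(j+1), so f^(2^j) acts on v as a power of f^k;
-- an even k is halved by passing from f to its second iterate.
two-power-period : ∀ {V : Set} (f : V → V) j {v} → (∀ w → iterate f (2 ℕ.^ suc j) w ≡ w) →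
  ∀ k → 0 ℕ.< k → k ℕ.< 2 ℕ.^ suc j → iterate f k v ≡ v → iterate f (2 ℕ.^ j) v ≡ v
two-power-period f j {v} id k 0<k k<2^ fixed with half k
... | h , inj₂ refl = begin
  iterate f (2 ℕ.^ j) v ≡⟨ cong (iterate f (2 ℕ.^ j)) (sym (trans (iterate-* f h (2 ℕ.^ suc j) v) (iterate-preserves (_≡ v) (λ { refl → id v }) h refl))) ⟩
  iterate f (2 ℕ.^ j) (iterate f (h ℕ.* 2 ℕ.^ suc j) v) ≡⟨ sym (iterate-+ f (2 ℕ.^ j) (h ℕ.* 2 ℕ.^ suc j) v) ⟩
  iterate f (2 ℕ.^ j ℕ.+ h ℕ.* 2 ℕ.^ suc j) v ≡⟨ cong (λ i → iterate f i v) (trans (cong (2 ℕ.^ j ℕ.+_) (sym (ℕ.*-assoc h 2 (2 ℕ.^ j)))) (ℕ.*-comm (suc (h ℕ.* 2)) (2 ℕ.^ j))) ⟩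
  iterate f (2 ℕ.^ j ℕ.* suc (h ℕ.* 2)) v ≡⟨ iterate-* f (2 ℕ.^ j) (suc (h ℕ.* 2)) v ⟩
  iterate (iterate f (suc (h ℕ.* 2))) (2 ℕ.^ j) v ≡⟨ iterate-preserves (_≡ v) (λ { refl → fixed }) (2 ℕ.^ j) refl ⟩
  v ∎
  where open ≡-Reasoning
... | zero , inj₁ refl = ⊥-elim (ℕ.<-irrefl refl 0<k)
two-power-period f zero id k 0<k k<2 fixed | suc h , inj₁ refl = ⊥-elim (ℕ.<⇒≱ k<2 (ℕ.s≤s (ℕ.s≤s ℕ.z≤n)))
two-power-period f (suc j) {v} id k 0<k k<2^ fixed | suc h , inj₁ refl =
  trans (cong (λ i → iterate f i v) (ℕ.*-comm 2 (2 ℕ.^ j))) (trans (iterate-* f (2 ℕ.^ j) 2 v)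
    (two-power-period (iterate f 2) j
      (λ w → trans (sym (iterate-* f (2 ℕ.^ suc j) 2 w)) (trans (cong (λ i → iterate f i w) (ℕ.*-comm (2 ℕ.^ suc j) 2)) (id w)))
      (suc h) (ℕ.s≤s ℕ.z≤n) (ℕ.*-cancelʳ-< 2 (suc h) (2 ℕ.^ suc j) (subst (suc h ℕ.* 2 ℕ.<_) (ℕ.*-comm 2 (2 ℕ.^ suc j)) k<2^))
      (trans (sym (iterate-* f (suc h) 2 v)) fixed)))

module TraceTree {p : ℕ} (K : PrimeField p) (k : ℕ) (p+1 : suc p ≡ 2 ℕ.^ (4 ℕ.+ k)) where
  open Rotation K (suc k) p+1 public
  open Ring using (solve; _:=_; _:+_; _:*_; _:-_; :-_; con)
  open ≡-Reasoning
  open Orb using (FreeBelow)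

  trace-2 : ∀ j → iterate trace j 2F ≡ 2F
  trace-2 j = iterate-preserves (_≡ 2F) (λ { refl → solve 0 (con (+ 2) :* con (+ 2) :- con (+ 2) := con (+ 2)) refl }) j refl

  trace-stable : ∀ i j {X} → iterate trace j X ≡ 2F → iterate trace (i ℕ.+ j) X ≡ 2F
  trace-stable i j {X} h = trans (iterate-+ trace i j X) (trans (cong (iterate trace i) h) (trace-2 i))

  trace-0 : ∀ j → iterate trace (2 ℕ.+ j) 0F ≡ 2F
  trace-0 j = trans (cong (λ i → iterate trace i 0F) (ℕ.+-comm 2 j)) (trace-stable j 2
    (solve 0 ((con (+ 0) :* con (+ 0) :- con (+ 2)) :* (con (+ 0) :* con (+ 0) :- con (+ 2)) :- con (+ 2) := con (+ 2)) refl))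

  elliptic-conic-size : ∀ {X} → X ≢ 0F → Elliptic X → Plane.count (onConic? X) ≡ + (2 ℕ.^ (4 ℕ.+ k))
  elliptic-conic-size {X} X≢0 E = trans (conic-size X X≢0 (elliptic⇒discriminant≢0 E))
    (trans (cong (ℤ._-_ (+ p)) E) (cong +_ (trans (ℕ.+-comm p 1) p+1)))

  elliptic-period : ∀ {X} → X ≢ 0F → Elliptic X → ∀ w → iterate (ρ X) (2 ℕ.^ (4 ℕ.+ k)) w ≡ w
  elliptic-period {X} X≢0 E with Plane.search (onConic? X)
  ... | yes (v , Cv) = period-count X X≢0 Cv (elliptic-conic-size X≢0 E)
  ... | no none = ⊥-elim (ℕ.<⇒≢ (ℕ.m^n>0 2 (4 ℕ.+ k)) (sym (ℤ.+-injective (trans (sym (elliptic-conic-size X≢0 E)) (Plane.∑-zero (λ v → indicator-no (onConic? X v) (λ Cv → none (v , Cv))))))))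

  elliptic-trace : ∀ {X} → Elliptic X → iterate trace (4 ℕ.+ k) X ≡ 2F
  elliptic-trace {X} E with X ≟ 0F
  ... | yes refl = trace-0 (2 ℕ.+ k)
  ... | no X≢0 = period⇒trace X (4 ℕ.+ k) {1F , 0F} (λ e → 1≢0 (cong proj₁ e)) (elliptic-period X≢0 E (1F , 0F))

  fibre-2 fibre--2 : ℕ → ℤ
  fibre-2 j = ∑ (λ y → indicator (iterate trace j y ≟ 2F))
  fibre--2 j = ∑ (λ y → indicator (iterate trace j y ≟ - 2F))

  ∑-trace : ∀ (g : F → ℤ) → ∑ (λ y → g (trace y)) ≡ ∑ (λ v → (+ 1 ℤ.+ χ v) ℤ.* g (v - 2F))
  ∑-trace g = ∑-of-squares (λ v → g (v - 2F))

  fibre-trace : ∀ j c → ∑ (λ y → indicator (iterate trace (suc j) y ≟ c)) ≡ ∑ (λ v → (+ 1 ℤ.+ χ v) ℤ.* indicator (iterate trace j (v - 2F) ≟ c))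
  fibre-trace j c = trans (∑-cong (λ y → cong (λ t → indicator (t ≟ c)) (iterate-suc trace j y))) (∑-trace (λ v → indicator (iterate trace j v ≟ c)))

  -- The only preimage of -2 under t ↦ t² - 2 is 0, and from there each level at most doubles
  -- because 1 + χ(v) ≤ 2.
  fibre--2-bound : ∀ j → fibre--2 (suc j) ℤ.≤ + (2 ℕ.^ j)
  fibre--2-bound zero = ℤ.≤-reflexive (trans (∑-cong (λ y → indicator-cong (trace y ≟ - 2F) (0F ≟ y)
      (λ e → sym (x²≡0 (linear e 1F (solve 1 (λ y → y :* y :- con (+ 0) := con (+ 1) :* (y :* y :- con (+ 2) :- (:- con (+ 2)))) refl y))))
      (λ { refl → solve 0 (con (+ 0) :* con (+ 0) :- con (+ 2) := :- con (+ 2)) refl }))) (∑-δ 0F))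
  fibre--2-bound (suc j) = ℤ.≤-trans (ℤ.≤-reflexive (fibre-trace (suc j) (- 2F))) (ℤ.≤-trans (∑-mono pointwise)
      (ℤ.≤-trans (ℤ.≤-reflexive (trans (∑-* (+ 2) (λ v → g (v - 2F))) (cong (ℤ._*_ (+ 2)) (∑-shift g 2F))))
        (ℤ.≤-trans (ℤ.*-monoˡ-≤-nonNeg (+ 2) (fibre--2-bound j)) (ℤ.≤-reflexive (sym (ℤ.pos-* 2 (2 ℕ.^ j)))))))
    where
    g : F → ℤ
    g v = indicator (iterate trace (suc j) v ≟ - 2F)
    pointwise : ∀ v → (+ 1 ℤ.+ χ v) ℤ.* g (v - 2F) ℤ.≤ + 2 ℤ.* g (v - 2F)
    pointwise v with iterate trace (suc j) (v - 2F) ≟ - 2F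
    ... | yes _ = subst (ℤ._≤ + 2) (sym (ℤ.*-identityʳ (+ 1 ℤ.+ χ v))) (ℤ.+-monoʳ-≤ (+ 1) (χ≤1 v))
    ... | no _ = ℤ.≤-reflexive (ℤ.*-zeroʳ (+ 1 ℤ.+ χ v))

  2≢-2 : 2F ≢ - 2F
  2≢-2 e = 2≢0 (x≡-x⇒x≡0 e)

  fibre-2-suc : ∀ j → fibre-2 (suc j) ≡ fibre-2 j ℤ.+ fibre--2 j
  fibre-2-suc j = trans (∑-cong pointwise) (∑-+ _ _)
    where
    pointwise : ∀ y → indicator (trace (iterate trace j y) ≟ 2F) ≡ indicator (iterate trace j y ≟ 2F) ℤ.+ indicator (iterate trace j y ≟ - 2F)
    pointwise y with iterate trace j y ≟ 2F | iterate trace j y ≟ - 2F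
    ... | yes e | yes e′ = ⊥-elim (2≢-2 (trans (sym e) e′))
    ... | yes e | no _ = indicator-yes (trace (iterate trace j y) ≟ 2F) (trans (cong trace e) (trace-2 1))
    ... | no _ | yes e = indicator-yes (trace (iterate trace j y) ≟ 2F) (trans (cong trace e) (solve 0 ((:- con (+ 2)) :* (:- con (+ 2)) :- con (+ 2) := con (+ 2)) refl))
    ... | no n | no n′ = indicator-no (trace (iterate trace j y) ≟ 2F) λ e →
          [ n , n′ ]′ (x²≡y² (linear e 1F (solve 1 (λ t → t :* t :- con (+ 2) :* con (+ 2) := con (+ 1) :* (t :* t :- con (+ 2) :- con (+ 2))) refl (iterate trace j y))))

  -- A preimage of 2 is 2 or -2, so the levels over -2 add up: at most 2 + (1 + 2 + 4 + ... +
  -- 2^(j-1)).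
  fibre-2-bound : ∀ j → fibre-2 (suc j) ℤ.≤ + (2 ℕ.^ j ℕ.+ 1)
  fibre-2-bound zero = ℤ.≤-reflexive (trans (fibre-2-suc 0) (cong₂ ℤ._+_ (at-zero 2F) (at-zero (- 2F))))
    where
    at-zero : ∀ c → ∑ (λ y → indicator (y ≟ c)) ≡ + 1
    at-zero c = trans (∑-cong (λ y → indicator-cong (y ≟ c) (c ≟ y) sym sym)) (∑-δ c)
  fibre-2-bound (suc j) = ℤ.≤-trans (ℤ.≤-reflexive (fibre-2-suc (suc j))) (ℤ.≤-trans (ℤ.+-mono-≤ (fibre-2-bound j) (fibre--2-bound j))
    (ℤ.+≤+ (ℕ.≤-reflexive (trans (ℕ.+-assoc (2 ℕ.^ j) 1 (2 ℕ.^ j)) (trans (cong (2 ℕ.^ j ℕ.+_) (ℕ.+-comm 1 (2 ℕ.^ j)))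
      (trans (sym (ℕ.+-assoc (2 ℕ.^ j) (2 ℕ.^ j) 1)) (cong (λ t → 2 ℕ.^ j ℕ.+ t ℕ.+ 1) (sym (ℕ.+-identityʳ (2 ℕ.^ j))))))))))

  discriminant≡0 : ∀ {y} → discriminant y ≡ 0F → y ≡ 2F ⊎ y ≡ - 2F
  discriminant≡0 {y} h = x²≡y² (linear h 1F (solve 1 (λ y → y :* y :- con (+ 2) :* con (+ 2) := con (+ 1) :* (y :* y :- con (+ 4) :- con (+ 0))) refl y))

  -- The sum of 1 - χ(y² - 4) over all y is p + 1; each elliptic y contributes 2 to it, and y = 2
  -- and y = -2 contribute 1 each.
  elliptic-count : + (2 ℕ.^ (4 ℕ.+ k)) ℤ.≤ + 2 ℤ.* count elliptic? ℤ.+ + 2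
  elliptic-count = subst₂ ℤ._≤_ left right (∑-mono pointwise)
    where
    rhs : F → ℤ
    rhs y = + 2 ℤ.* indicator (elliptic? y) ℤ.+ (indicator (2F ≟ y) ℤ.+ indicator (- 2F ≟ y))
    left : ∑ (λ y → + 1 ℤ.- χ (1F * (y * y) - 4F)) ≡ + (2 ℕ.^ (4 ℕ.+ k))
    left = trans (∑-minus (λ _ → + 1) (λ y → χ (1F * (y * y) - 4F))) (trans (cong₂ ℤ._-_ (trans (∑-const (+ 1)) (ℤ.*-identityʳ (+ p)))
      (trans (∑χ[αy²-β] 1≢0 4≢0) (cong ℤ.-_ (χ-square {1F} 1≢0 (*-identityˡ 1F))))) (cong +_ (trans (ℕ.+-comm p 1) p+1)))
    right : ∑ rhs ≡ + 2 ℤ.* count elliptic? ℤ.+ + 2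
    right = trans (∑-+ (λ y → + 2 ℤ.* indicator (elliptic? y)) (λ y → indicator (2F ≟ y) ℤ.+ indicator (- 2F ≟ y)))
      (cong₂ ℤ._+_ (∑-* (+ 2) (λ y → indicator (elliptic? y))) (trans (∑-+ (λ y → indicator (2F ≟ y)) (λ y → indicator (- 2F ≟ y))) (cong₂ ℤ._+_ (∑-δ 2F) (∑-δ (- 2F)))))
    0≤ : ∀ y → + 0 ℤ.≤ indicator (2F ≟ y) ℤ.+ indicator (- 2F ≟ y)
    0≤ y = ℤ.+-mono-≤ (indicator-nonneg (2F ≟ y)) (indicator-nonneg (- 2F ≟ y))
    pointwise : ∀ y → + 1 ℤ.- χ (1F * (y * y) - 4F) ℤ.≤ rhs y
    pointwise y = subst (λ t → + 1 ℤ.- χ (t - 4F) ℤ.≤ rhs y) (sym (*-identityˡ (y * y))) (by-cases (trichotomy (discriminant y)))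
      where
      by-cases : Trichotomy (discriminant y) → + 1 ℤ.- χ (discriminant y) ℤ.≤ rhs y
      by-cases (is-square s≢0 e) = ℤ.≤-trans (ℤ.≤-reflexive (cong (ℤ._-_ (+ 1)) (χ-square s≢0 (sym e))))
        (ℤ.+-mono-≤ (ℤ.*-monoˡ-≤-nonNeg (+ 2) (indicator-nonneg (elliptic? y))) (0≤ y))
      by-cases (is-negsquare s≢0 e) = ℤ.≤-trans (ℤ.≤-reflexive (trans (cong (ℤ._-_ (+ 1)) E) (cong (ℤ._*_ (+ 2)) (sym (indicator-yes (elliptic? y) E)))))
        (subst (ℤ._≤ rhs y) (ℤ.+-identityʳ (+ 2 ℤ.* indicator (elliptic? y))) (ℤ.+-monoʳ-≤ (+ 2 ℤ.* indicator (elliptic? y)) (0≤ y)))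
        where E = χ-negsquare s≢0 e
      by-cases (is-zero e) = ℤ.≤-trans (ℤ.≤-reflexive (trans (cong (ℤ._-_ (+ 1)) (trans (cong χ e) χ-zero)) (one (discriminant≡0 e))))
        (ℤ.+-mono-≤ (ℤ.*-monoˡ-≤-nonNeg (+ 2) (indicator-nonneg (elliptic? y))) (ℤ.≤-refl {indicator (2F ≟ y) ℤ.+ indicator (- 2F ≟ y)}))
        where
        one : y ≡ 2F ⊎ y ≡ - 2F → + 1 ≡ + 0 ℤ.+ (indicator (2F ≟ y) ℤ.+ indicator (- 2F ≟ y))
        one (inj₁ refl) = sym (trans (ℤ.+-identityˡ _) (cong₂ ℤ._+_ (indicator-yes (2F ≟ 2F) refl) (indicator-no (- 2F ≟ 2F) (2≢-2 ∘ sym))))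
        one (inj₂ refl) = sym (trans (ℤ.+-identityˡ _) (cong₂ ℤ._+_ (indicator-no (2F ≟ - 2F) 2≢-2) (indicator-yes (- 2F ≟ - 2F) refl)))

  -- All elliptic y lie over 2 in the tree of t ↦ t² − 2. A node X with X + 2 nonsquare at height 3 + k
  -- would have no preimages, and then the tree is too small to hold them.
  leaf-height : ∀ {X} → ¬ IsSquare (X + 2F) → iterate trace (3 ℕ.+ k) X ≢ 2F
  leaf-height {X} leaf h = ℤ.<⇒≱ (ℤ.suc[i]≤j⇒i<j (ℤ.≤-refl {ℤ.suc (+ 2 ℤ.* fibre-2 (4 ℕ.+ k))})) contradictory
    where
    g : F → ℤ
    g v = indicator (iterate trace (3 ℕ.+ k) v ≟ 2F)
    -- An element v - 2 of the lower fibre has 1 + χ(v) preimages, generically bounded by 2. This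
    -- drops by 1 at v = 0 and by 2 at the leaf v = X + 2, which makes the 3 in `upper`.
    bound : F → ℤ
    bound v = + 2 ℤ.* g (v - 2F) ℤ.- (indicator (0F ≟ v) ℤ.+ + 2 ℤ.* indicator (X + 2F ≟ v))
    g0 : g (0F - 2F) ≡ + 1
    g0 = indicator-yes (iterate trace (3 ℕ.+ k) (0F - 2F) ≟ 2F) (trans (cong (λ t → iterate trace (3 ℕ.+ k) t) (solve 0 (con (+ 0) :- con (+ 2) := con (+ 0) :* con (+ 0) :- con (+ 2)) refl)) (trans (sym (iterate-suc trace (3 ℕ.+ k) 0F)) (trace-0 (2 ℕ.+ k))))
    gX : g (X + 2F - 2F) ≡ + 1
    gX = indicator-yes (iterate trace (3 ℕ.+ k) (X + 2F - 2F) ≟ 2F) (trans (cong (λ t → iterate trace (3 ℕ.+ k) t) (solve 1 (λ X → X :+ con (+ 2) :- con (+ 2) := X) refl X)) h)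
    upper : fibre-2 (4 ℕ.+ k) ℤ.≤ + 2 ℤ.* fibre-2 (3 ℕ.+ k) ℤ.- + 3
    upper = ℤ.≤-trans (ℤ.≤-reflexive (fibre-trace (3 ℕ.+ k) 2F)) (ℤ.≤-trans (∑-mono pointwise) (ℤ.≤-reflexive sum-bound))
      where
      pointwise : ∀ v → (+ 1 ℤ.+ χ v) ℤ.* g (v - 2F) ℤ.≤ bound v
      pointwise v with 0F ≟ v | X + 2F ≟ v
      ... | yes refl | yes e = ⊥-elim (leaf (0F , trans (zeroˡ 0F) (sym e)))
      ... | yes refl | no _ = ℤ.≤-reflexive (trans (cong₂ (λ s t → (+ 1 ℤ.+ s) ℤ.* t) χ-zero g0) (cong (λ t → + 2 ℤ.* t ℤ.- + 1) (sym g0)))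
      ... | no _ | yes refl = ℤ.≤-reflexive (trans (cong₂ (λ s t → (+ 1 ℤ.+ s) ℤ.* t) (χ-nonsquare leaf) gX) (cong (λ t → + 2 ℤ.* t ℤ.- + 2) (sym gX)))
      ... | no _ | no _ with iterate trace (3 ℕ.+ k) (v - 2F) ≟ 2F
      ...   | yes _ = subst (ℤ._≤ + 2) (sym (ℤ.*-identityʳ (+ 1 ℤ.+ χ v))) (ℤ.+-monoʳ-≤ (+ 1) (χ≤1 v))
      ...   | no _ = ℤ.≤-reflexive (ℤ.*-zeroʳ (+ 1 ℤ.+ χ v))
      sum-bound : ∑ bound ≡ + 2 ℤ.* fibre-2 (3 ℕ.+ k) ℤ.- + 3
      sum-bound = trans (∑-minus (λ v → + 2 ℤ.* g (v - 2F)) (λ v → indicator (0F ≟ v) ℤ.+ + 2 ℤ.* indicator (X + 2F ≟ v)))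
        (cong₂ ℤ._-_ (trans (∑-* (+ 2) (λ v → g (v - 2F))) (cong (ℤ._*_ (+ 2)) (∑-shift g 2F)))
          (trans (∑-+ (λ v → indicator (0F ≟ v)) (λ v → + 2 ℤ.* indicator (X + 2F ≟ v)))
            (cong₂ ℤ._+_ (∑-δ 0F) (trans (∑-* (+ 2) (λ v → indicator (X + 2F ≟ v))) (cong (ℤ._*_ (+ 2)) (∑-δ (X + 2F)))))))
    lower : count elliptic? ℤ.+ + 2 ℤ.≤ fibre-2 (4 ℕ.+ k)
    lower = ℤ.≤-trans (ℤ.≤-reflexive (sym sum-lower)) (∑-mono pointwise)
      where
      sum-lower : ∑ (λ y → indicator (elliptic? y) ℤ.+ (indicator (2F ≟ y) ℤ.+ indicator (- 2F ≟ y))) ≡ count elliptic? ℤ.+ + 2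
      sum-lower = trans (∑-+ (λ y → indicator (elliptic? y)) (λ y → indicator (2F ≟ y) ℤ.+ indicator (- 2F ≟ y)))
        (cong (ℤ._+_ (count elliptic?)) (trans (∑-+ (λ y → indicator (2F ≟ y)) (λ y → indicator (- 2F ≟ y))) (cong₂ ℤ._+_ (∑-δ 2F) (∑-δ (- 2F)))))
      above : ∀ y → iterate trace (4 ℕ.+ k) y ≡ 2F → + 1 ℤ.≤ indicator (iterate trace (4 ℕ.+ k) y ≟ 2F)
      above y e = ℤ.≤-reflexive (sym (indicator-yes (iterate trace (4 ℕ.+ k) y ≟ 2F) e))
      pointwise : ∀ y → indicator (elliptic? y) ℤ.+ (indicator (2F ≟ y) ℤ.+ indicator (- 2F ≟ y)) ℤ.≤ indicator (iterate trace (4 ℕ.+ k) y ≟ 2F)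
      pointwise y with elliptic? y | 2F ≟ y | - 2F ≟ y
      ... | yes E | yes refl | _ = ⊥-elim (elliptic⇒discriminant≢0 E (solve 0 (con (+ 2) :* con (+ 2) :- con (+ 4) := con (+ 0)) refl))
      ... | yes E | no _ | yes refl = ⊥-elim (elliptic⇒discriminant≢0 E (solve 0 ((:- con (+ 2)) :* (:- con (+ 2)) :- con (+ 4) := con (+ 0)) refl))
      ... | yes E | no _ | no _ = above y (elliptic-trace E)
      ... | no _ | yes refl | yes e = ⊥-elim (2≢-2 (sym e))
      ... | no _ | yes refl | no _ = above 2F (trace-2 (4 ℕ.+ k))
      ... | no _ | no _ | yes refl = above (- 2F) (trans (iterate-suc trace (3 ℕ.+ k) (- 2F)) (trans (cong (iterate trace (3 ℕ.+ k)) (solve 0 ((:- con (+ 2)) :* (:- con (+ 2)) :- con (+ 2) := con (+ 2)) refl)) (trace-2 (3 ℕ.+ k))))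
      ... | no _ | no _ | no _ = indicator-nonneg (iterate trace (4 ℕ.+ k) y ≟ 2F)
    -- With q = p + 1, `lower` and `elliptic-count` put at least q/2 + 1 elements over 2, while
    -- `upper` and `fibre-2-bound` allow at most q/2 - 1. Everything is doubled to avoid halves.
    contradictory : ℤ.suc (+ 2 ℤ.* fibre-2 (4 ℕ.+ k)) ℤ.≤ + 2 ℤ.* fibre-2 (4 ℕ.+ k)
    contradictory = ℤ.≤-trans (ℤ.+-monoʳ-≤ (+ 1) (ℤ.*-monoˡ-≤-nonNeg (+ 2) upper)) (ℤ.≤-trans chain (ℤ.*-monoˡ-≤-nonNeg (+ 2) lower))
      where
      Q = + (2 ℕ.^ (2 ℕ.+ k))
      chain : + 1 ℤ.+ + 2 ℤ.* (+ 2 ℤ.* fibre-2 (3 ℕ.+ k) ℤ.- + 3) ℤ.≤ + 2 ℤ.* (count elliptic? ℤ.+ + 2)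
      chain = ≤-from₂ (ℤ.*-monoˡ-≤-nonNeg (+ 4) (fibre-2-bound (2 ℕ.+ k))) (ℤ.≤-trans elliptic-count (ℤ.i≤i+j (+ 2 ℤ.* count elliptic? ℤ.+ + 2) (+ 3)))
        (trans (ℤS.solve 3 (λ f e Q → ℤS.con (+ 2) ℤS.:* (e ℤS.:+ ℤS.con (+ 2)) ℤS.:- (ℤS.con (+ 1) ℤS.:+ ℤS.con (+ 2) ℤS.:* (ℤS.con (+ 2) ℤS.:* f ℤS.:- ℤS.con (+ 3)))
            ℤS.:= (ℤS.con (+ 4) ℤS.:* (Q ℤS.:+ ℤS.con (+ 1)) ℤS.:- ℤS.con (+ 4) ℤS.:* f) ℤS.:+ (ℤS.con (+ 2) ℤS.:* e ℤS.:+ ℤS.con (+ 2) ℤS.:+ ℤS.con (+ 3) ℤS.:- ℤS.con (+ 4) ℤS.:* Q))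
            refl (fibre-2 (3 ℕ.+ k)) (count elliptic?) Q)
          (cong (λ t → (+ 4 ℤ.* (Q ℤ.+ + 1) ℤ.- + 4 ℤ.* fibre-2 (3 ℕ.+ k)) ℤ.+ (+ 2 ℤ.* count elliptic? ℤ.+ + 2 ℤ.+ + 3 ℤ.- t)) (trans (sym (ℤ.pos-* 4 (2 ℕ.^ (2 ℕ.+ k)))) (cong +_ (ℕ.*-assoc 2 2 (2 ℕ.^ (2 ℕ.+ k)))))))

-- Rotations of order p + 1 and of order 5

module FullOrbit {p : ℕ} (K : PrimeField p) (m : ℕ) (p+1 : suc p ≡ 2 ℕ.^ (3 ℕ.+ m)) where
  open Rotation K m p+1
  open Ring using (solve; _:=_; _:+_; _:*_; _:-_; :-_; con)
  open ≡-Reasoning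
  open Orb using (FreeBelow; FreeOn)

  module _ {X v} (X≢0 : X ≢ 0F) (Cv : OnConic X v) (free : FreeBelow X (suc p) v) where
    private
      size : Plane.count (onConic? X) ≡ + p ℤ.- χ (discriminant X)
      size = conic-size X X≢0 (λ a≡0 → parabolic-empty X {v} X≢0 a≡0 Cv)

      orbit : Fin (suc p) → F × F
      orbit i = iterate (ρ X) (toℕ i) v

      orbit-on-conic : ∀ i → OnConic X (orbit i)
      orbit-on-conic i = iterate-preserves (OnConic X) (λ {w} → ρ-conic X {w}) (toℕ i) {v} Cv

    full-orbit : ∀ {w} → OnConic X w → ∃ λ i → iterate (ρ X) i v ≡ w
    full-orbit {w} Cw =
      let i , e = covers plane (onConic? X) orbit (Orb.orbit-injective X free) orbit-on-conic
            (subst (ℤ._≤ + suc p) (sym size) (≤-from (-1≤χ (discriminant X)) (ℤS.solve 2 (λ p c → (ℤS.con (+ 1) ℤS.:+ p) ℤS.:- (p ℤS.:- c) ℤS.:= c ℤS.:- (ℤS.con -[1+ 0 ])) refl (+ p) (χ (discriminant X))))) {w} Cw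
      in toℕ i , e

    -- The orbit alone has p + 1 points and the conic has p - χ(X² - 4), which forces χ = -1.
    full-orbit⇒elliptic : Elliptic X
    full-orbit⇒elliptic = ℤ.≤-antisym (≤-from enough (ℤS.solve 2 (λ p c → (ℤS.con -[1+ 0 ]) ℤS.:- c ℤS.:= (p ℤS.:- c) ℤS.:- (ℤS.con (+ 1) ℤS.:+ p)) refl (+ p) (χ (discriminant X)))) (-1≤χ (discriminant X))
      where
      enough : + suc p ℤ.≤ + p ℤ.- χ (discriminant X)
      enough = subst₂ ℤ._≤_ (count-image plane orbit (Orb.orbit-injective X free)) size
        (Plane.∑-mono (λ u → indicator-mono (Fin.any? (λ i → orbit i Plane.≟ u)) (onConic? X u) (λ (i , h) → subst (OnConic X) h (orbit-on-conic i))))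

  -- A root t of t² + t − 1 is the trace of a rotation of order 5, which acts freely on a conic of p ∓ 1 points.
  5-nonsquare : (p ℕ.% 5 ≡ 2 ⊎ p ℕ.% 5 ≡ 3) → ¬ IsSquare 5F
  5-nonsquare residue (s , s²≡5) = wrong-size (Orb.orbit-size-divides t {4} (onConic? t) freeOn)
    where
    t : F
    t = inv 2F * (s - 1F)
    root : t * t ≡ 1F - t
    root = *-cancelˡ 4≢0 (linear₂ s²≡5 (*-inverseʳ 2F 2≢0) 1F ((s - 1F) * (s - 1F) * (2F * inv 2F + 1F) + 2F * (s - 1F))
      (solve 2 (λ s i → con (+ 4) :* (i :* (s :- con (+ 1)) :* (i :* (s :- con (+ 1)))) :- con (+ 4) :* (con (+ 1) :- i :* (s :- con (+ 1)))
        := con (+ 1) :* (s :* s :- con (+ 5)) :+ ((s :- con (+ 1)) :* (s :- con (+ 1)) :* (con (+ 2) :* i :+ con (+ 1)) :+ con (+ 2) :* (s :- con (+ 1))) :* (con (+ 2) :* i :- con (+ 1))) refl s (inv 2F)))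
    5≢0 : 5F ≢ 0F
    5≢0 = small-nonzero 5 (ℕ.m≤m+n 5 1)
    t≢0 : t ≢ 0F
    t≢0 e = 1≢0 (trans (solve 0 (con (+ 1) := con (+ 1) :- con (+ 0)) refl) (trans (cong (λ u → 1F - u) (sym e)) (trans (sym root) (trans (cong (_* t) e) (zeroˡ t)))))
    a≢0 : discriminant t ≢ 0F
    a≢0 h = 5≢0 (linear₂ h root (t - 2F) (3F - t) (solve 1 (λ t → con (+ 5) :- con (+ 0) := (t :- con (+ 2)) :* (t :* t :- con (+ 4) :- con (+ 0)) :+ (con (+ 3) :- t) :* (t :* t :- (con (+ 1) :- t))) refl t) )
    ρ³ : ∀ y z → iterate (ρ t) 3 (y , z) ≡ (- (t * z) - t * y , - z + t * y)
    ρ³ y z = cong₂ _,_ (linear root z (solve 3 (λ t y z → t :* (t :* z :- y) :- z :- (:- (t :* z) :- t :* y) := z :* (t :* t :- (con (+ 1) :- t))) refl t y z))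
                       (linear root (t * z - y - z) (solve 3 (λ t y z → t :* (t :* (t :* z :- y) :- z) :- (t :* z :- y) :- (:- z :+ t :* y) := (t :* z :- y :- z) :* (t :* t :- (con (+ 1) :- t))) refl t y z))
    -- If t = u + 1/u, then t² + t - 1 = 0 says u⁴ + u³ + u² + u + 1 = 0, so the eigenvalue u is a
    -- fifth root of unity.
    periodic : ∀ v → iterate (ρ t) 5 v ≡ v
    periodic (y , z) = trans (cong (ρ t ∘ ρ t) (ρ³ y z)) (cong₂ _,_
      (linear root y (solve 3 (λ t y z → t :* (:- z :+ t :* y) :- (:- (t :* z) :- t :* y) :- y := y :* (t :* t :- (con (+ 1) :- t))) refl t y z))
      (linear root (t * y) (solve 3 (λ t y z → t :* (t :* (:- z :+ t :* y) :- (:- (t :* z) :- t :* y)) :- (:- z :+ t :* y) :- z := (t :* y) :* (t :* t :- (con (+ 1) :- t))) refl t y z)))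
    A : F × F → F × F
    A = ρ t
    no-fixed-point : ∀ {v} → OnConic t v → A v ≢ v
    no-fixed-point {y , z} Cv h = t≢0 (x²≡0 (trans (linear₂ Cv z≡0 1F (t * z - z - z) (*-combination (cong proj₁ h))) refl))
      where
      t≢2 : t - 2F ≢ 0F
      t≢2 e = a≢0 (linear e (t + 2F) (solve 1 (λ t → t :* t :- con (+ 4) :- con (+ 0) := (t :+ con (+ 2)) :* (t :- con (+ 2) :- con (+ 0))) refl t))
      z≡0 : z ≡ 0F
      z≡0 = x*y≡0 t≢2 (linear₂ (cong proj₂ h) (cong proj₁ h) 1F (- 1F) (solve 3 (λ t y z → (t :- con (+ 2)) :* z :- con (+ 0) := con (+ 1) :* (t :* z :- y :- z) :+ (:- con (+ 1)) :* (z :- y)) refl t y z))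
      *-combination : z ≡ y → t * t - 0F ≡ 1F * (t * t + y * y + z * z - t * y * z) + (t * z - z - z) * (z - 0F)
      *-combination refl = solve 2 (λ t z → t :* t :- con (+ 0) := con (+ 1) :* (t :* t :+ z :* z :+ z :* z :- t :* z :* z) :+ (t :* z :- z :- z) :* (z :- con (+ 0))) refl t z
    freeOn : FreeOn t (OnConic t) 4
    freeOn = record { closed = λ {v} → ρ-conic t {v} ; periodic = λ {v} _ → periodic v ; free = free }
      where
      -- Since 5 is prime, a point fixed by A^k with 0 < k < 5 is fixed by A itself.
      free : ∀ {v} → OnConic t v → FreeBelow t 5 v
      free {v} Cv 1 _ _ h = no-fixed-point {v} Cv h
      free {v} Cv 2 _ _ h = no-fixed-point {v} Cv (trans (sym (trans (cong (λ w → A (A (A w))) h) (cong A h))) (periodic v))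
      free {v} Cv 3 _ _ h = no-fixed-point {v} Cv (trans (sym (cong A (periodic v))) (trans (cong (λ w → A (A (A w))) h) h))
      free {v} Cv 4 _ _ h = no-fixed-point {v} Cv (trans (sym (cong A h)) (periodic v))
      free Cv (suc (suc (suc (suc (suc k))))) _ (ℕ.s≤s (ℕ.s≤s (ℕ.s≤s (ℕ.s≤s (ℕ.s≤s ())))))
    not-2-or-3 : ∀ {r} → r ≢ 2 → r ≢ 3 → p ℕ.% 5 ≢ r
    not-2-or-3 r≢2 r≢3 e = [ (λ f → r≢2 (trans (sym e) f)) , (λ f → r≢3 (trans (sym e) f)) ]′ residue
    wrong-size : ¬ (∃ λ k → Plane.count (onConic? t) ≡ + k ℤ.* + 5)
    wrong-size (k , h) = by-cases (trichotomy (discriminant t))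
      where
      size : + p ℤ.- χ (discriminant t) ≡ + (k ℕ.* 5)
      size = trans (sym (conic-size t t≢0 a≢0)) (trans h (sym (ℤ.pos-* k 5)))
      -- If p - χ(t² - 4) is a multiple of 5, then p is 1 or 4 modulo 5.
      by-cases : ¬ Trichotomy (discriminant t)
      by-cases (is-zero e) = a≢0 e
      by-cases (is-square s≢0 e) = not-2-or-3 (λ ()) (λ ()) (trans (cong (ℕ._% 5) (ℤ.+-injective {p} {1 ℕ.+ k ℕ.* 5}
        (≡-from size (trans (ℤS.solve 2 (λ p k → p ℤS.:- (ℤS.con (+ 1) ℤS.:+ k) ℤS.:= (p ℤS.:- ℤS.con (+ 1)) ℤS.:- k) refl (+ p) (+ (k ℕ.* 5)))
          (cong (λ c → (+ p ℤ.- c) ℤ.- + (k ℕ.* 5)) (sym (χ-square s≢0 (sym e)))))))) (ℕ.[m+kn]%n≡m%n 1 k 5))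
      by-cases (is-negsquare s≢0 e) = at-infinity k (ℤ.+-injective {p ℕ.+ 1} (trans (cong (ℤ._-_ (+ p)) (sym (χ-negsquare s≢0 e))) size))
        where
        at-infinity : ∀ k → p ℕ.+ 1 ≢ k ℕ.* 5
        at-infinity zero e = ℕ.1+n≢0 (trans (ℕ.+-comm 1 p) e)
        at-infinity (suc k) e = not-2-or-3 (λ ()) (λ ()) (trans (cong (ℕ._% 5) (ℕ.+-cancelʳ-≡ 1 p (4 ℕ.+ k ℕ.* 5) (trans e (ℕ.+-comm 1 (4 ℕ.+ k ℕ.* 5))))) (ℕ.[m+kn]%n≡m%n 4 k 5))

-- Transitivity on the conic of a regular trace

module Transitivity {p : ℕ} (K : PrimeField p) (k : ℕ) (p+1 : suc p ≡ 2 ℕ.^ (4 ℕ.+ k)) where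
  open TraceTree K k p+1 public
  open FullOrbit K (suc k) p+1 public
  open Ring using (solve; _:=_; _:+_; _:*_; _:-_; :-_; con)
  open ≡-Reasoning
  open Orb using (FreeBelow; FreeOn)

  -- The rotation ρ X then has order p + 1 or (p + 1)/2.
  Regular : F → Set
  Regular X = Elliptic X × iterate trace (2 ℕ.+ k) X ≢ 2F

  regular? : ∀ X → Dec (Regular X)
  regular? X = elliptic? X ×-dec ¬? (iterate trace (2 ℕ.+ k) X ≟ 2F)

  regular⇒nonzero : ∀ {X} → Regular X → X ≢ 0F
  regular⇒nonzero (_ , t≢2) refl = t≢2 (trace-0 k)

  -- Both 3² - 4 and 3 + 2 equal 5: the first makes 3 elliptic, the second makes it a leaf of the
  -- trace tree.
  3-regular : ¬ IsSquare 5F → Regular 3F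
  3-regular 5-nonsquare =
    trans (cong χ (solve 0 (con (+ 3) :* con (+ 3) :- con (+ 4) := con (+ 5)) refl)) (χ-nonsquare 5-nonsquare) ,
    λ h → leaf-height (subst (¬_ ∘ IsSquare) (solve 0 (con (+ 5) := con (+ 3) :+ con (+ 2)) refl) 5-nonsquare) (trace-stable 1 (2 ℕ.+ k) h)

  -- The swap conjugates ρ to its inverse: ρ ∘ swap ∘ ρ = swap.
  reflection : ∀ X i v → iterate (ρ X) i (swap (iterate (ρ X) i v)) ≡ swap v
  reflection X zero v = refl
  reflection X (suc i) v = begin
    iterate (ρ X) (suc i) (swap (ρ X (iterate (ρ X) i v))) ≡⟨ iterate-suc (ρ X) i _ ⟩
    iterate (ρ X) i (ρ X (swap (ρ X (iterate (ρ X) i v)))) ≡⟨ cong (iterate (ρ X) i) (step (iterate (ρ X) i v)) ⟩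
    iterate (ρ X) i (swap (iterate (ρ X) i v)) ≡⟨ reflection X i v ⟩
    swap v ∎
    where
    step : ∀ w → ρ X (swap (ρ X w)) ≡ swap w
    step (y , z) = cong₂ _,_ refl (solve 3 (λ X y z → X :* z :- (X :* z :- y) := y) refl X y z)

  origin-not-on-conic : ∀ {X v} → X ≢ 0F → OnConic X v → v ≢ origin
  origin-not-on-conic {X} X≢0 Cv refl = X≢0 (x²≡0 (linear Cv 1F (solve 1 (λ X → X :* X :- con (+ 0) := con (+ 1) :* (X :* X :+ con (+ 0) :* con (+ 0) :+ con (+ 0) :* con (+ 0) :- X :* con (+ 0) :* con (+ 0))) refl X)))

  divided-square : ∀ {a x c} → x ≢ 0F → a * (x * x) ≡ c * c → IsSquare a
  divided-square {a} {x} {c} x≢0 h = c * inv x , linear₂ h (*-inverseʳ x x≢0) (- (inv x * inv x)) (a * (x * inv x + 1F))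
    (solve 4 (λ a x c i → c :* i :* (c :* i) :- a := (:- (i :* i)) :* (a :* (x :* x) :- c :* c) :+ (a :* (x :* i :+ con (+ 1))) :* (x :* i :- con (+ 1))) refl a x c (inv x))

  -- If ρ X has order (p + 1)/2, a point and its mirror image lie in different orbits: a rotation between them
  -- is, after halving, a point with y = z (even exponent) or 2y = Xz (odd exponent).
  swap-leaves-orbit : ∀ {X v} → Elliptic X → X ≢ 0F → OnConic X v → iterate trace (3 ℕ.+ k) X ≡ 2F → ∀ i → iterate (ρ X) i v ≢ swap v
  swap-leaves-orbit {X} {v} E X≢0 Cv height i h with half i
  ... | l , inj₁ refl = leaf-height leaf height
    where
    w = iterate (ρ X) l v
    y z : F
    y = proj₁ w
    z = proj₂ w
    Cw : OnConic X w
    Cw = iterate-preserves (OnConic X) (λ {w} → ρ-conic X {w}) l {v} Cv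
    -- By `reflection`, ρ^l can be cancelled from ρ^(2l) v = swap v, so w = ρ^l v is its own mirror
    -- image.
    y≡z : y ≡ z
    y≡z = cong proj₁ (Orb.iterate-injective X l (trans (sym (iterate-+ (ρ X) l l v))
      (trans (cong (λ i → iterate (ρ X) i v) (trans (cong (l ℕ.+_) (sym (ℕ.+-identityʳ l))) (ℕ.*-comm 2 l))) (trans h (sym (reflection X l v))))))
    Cy : OnConic X (y , y)
    Cy = subst (λ z → OnConic X (y , z)) (sym y≡z) Cw
    y≢0 : y ≢ 0F
    y≢0 e = origin-not-on-conic {X} {y , y} X≢0 Cy (cong₂ _,_ e e)
    X-2-square : IsSquare (X - 2F)
    X-2-square = divided-square {c = X} y≢0 (linear Cy (- 1F) (solve 2 (λ X y → (X :- con (+ 2)) :* (y :* y) :- X :* X := (:- con (+ 1)) :* (X :* X :+ y :* y :+ y :* y :- X :* y :* y)) refl X y))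
    -- (X - 2)(X + 2) is a nonsquare and X - 2 is a square, so X + 2 is a nonsquare and
    -- `leaf-height` contradicts `height`.
    leaf : ¬ IsSquare (X + 2F)
    leaf (s , e) = -1⇒nonsquare E (proj₁ X-2-square * s , trans (solve 2 (λ r s → r :* s :* (r :* s) := r :* r :* (s :* s)) refl (proj₁ X-2-square) s)
      (trans (cong₂ _*_ (proj₂ X-2-square) e) (solve 1 (λ X → (X :- con (+ 2)) :* (X :+ con (+ 2)) := X :* X :- con (+ 4)) refl X)))
  ... | l , inj₂ refl = -1⇒nonsquare E (divided-square {c = 2F * X} z≢0 (linear₂ Cw flip (- 4F) (2F * y - X * z)
      (solve 3 (λ X y z → (X :* X :- con (+ 4)) :* (z :* z) :- con (+ 2) :* X :* (con (+ 2) :* X) := (:- con (+ 4)) :* (X :* X :+ y :* y :+ z :* z :- X :* y :* z) :+ (con (+ 2) :* y :- X :* z) :* (con (+ 2) :* y :- X :* z)) refl X y z)))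
    where
    w = iterate (ρ X) l v
    y z : F
    y = proj₁ w
    z = proj₂ w
    Cw : OnConic X w
    Cw = iterate-preserves (OnConic X) (λ {w} → ρ-conic X {w}) l {v} Cv
    flip : 2F * y ≡ X * z
    flip = linear (cong proj₂ (Orb.iterate-injective X l {ρ X w} {swap w} (trans (sym (iterate-+ (ρ X) l (suc l) v))
      (trans (cong (λ i → iterate (ρ X) i v) (trans (ℕ.+-suc l l) (cong suc (trans (cong (l ℕ.+_) (sym (ℕ.+-identityʳ l))) (ℕ.*-comm 2 l))))) (trans h (sym (reflection X l v))))))) (- 1F)
      (solve 3 (λ X y z → con (+ 2) :* y :- X :* z := (:- con (+ 1)) :* (X :* z :- y :- y)) refl X y z)
    z≢0 : z ≢ 0F
    z≢0 e = origin-not-on-conic {X} {w} X≢0 Cw (cong₂ _,_ (x*y≡0 2≢0 (trans flip (trans (cong (X *_) e) (zeroʳ X)))) e)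

  -- With order p + 1 a single orbit fills the conic; with order (p + 1)/2 the orbits of v and of
  -- swap v are disjoint and fill it together.
  transitive : ∀ {X v w} → Regular X → OnConic X v → OnConic X w → ∃ λ i → iterate (ρ X) i v ≡ w ⊎ iterate (ρ X) i (swap v) ≡ w
  transitive {X} {v} {w} (E , t≢2) Cv Cw with iterate trace (3 ℕ.+ k) X ≟ 2F
  ... | no t′≢2 = proj₁ found , inj₁ (proj₂ found)
    where
    X≢0 = regular⇒nonzero (E , t≢2)
    free : FreeBelow X (suc p) v
    free i 0<i i<q h = t′≢2 (period⇒trace X (3 ℕ.+ k) {v} (origin-not-on-conic {X} {v} X≢0 Cv)
      (two-power-period (ρ X) (3 ℕ.+ k) (elliptic-period X≢0 E) i 0<i (subst (i ℕ.<_) p+1 i<q) h))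
    found = full-orbit {X} {v} X≢0 Cv free {w} Cw
  ... | yes t′≡2 = conclude (covers plane (onConic? X) points points-injective points-on-conic size {w} Cw)
    where
    X≢0 = regular⇒nonzero (E , t≢2)
    N = 2 ℕ.^ (3 ℕ.+ k)
    free : ∀ {u} → OnConic X u → FreeBelow X N u
    free {u} Cu i 0<i i<N h = t≢2 (period⇒trace X (2 ℕ.+ k) {u} (origin-not-on-conic {X} {u} X≢0 Cu)
      (two-power-period (ρ X) (2 ℕ.+ k) (trace⇒period X (3 ℕ.+ k) E t′≡2) i 0<i i<N h))
    side : Fin N ⊎ Fin N → F × F
    side (inj₁ i) = iterate (ρ X) (toℕ i) v
    side (inj₂ i) = iterate (ρ X) (toℕ i) (swap v)
    points : Fin (N ℕ.+ N) → F × F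
    points i = side (Fin.splitAt N i)
    disjoint : ∀ i j → iterate (ρ X) i v ≢ iterate (ρ X) j (swap v)
    disjoint i j h with ℕ.≤-total i j
    ... | inj₁ i≤j = swap-leaves-orbit {X} {swap v} E X≢0 (swap-conic X {v} Cv) t′≡2 (j ℕ.∸ i)
          (sym (Orb.iterate-injective X i (trans h (trans (cong (λ c → iterate (ρ X) c (swap v)) (sym (ℕ.m+[n∸m]≡n i≤j))) (iterate-+ (ρ X) i (j ℕ.∸ i) (swap v))))))
    ... | inj₂ j≤i = swap-leaves-orbit {X} {v} E X≢0 Cv t′≡2 (i ℕ.∸ j)
          (Orb.iterate-injective X j (trans (sym (iterate-+ (ρ X) j (i ℕ.∸ j) v)) (trans (cong (λ c → iterate (ρ X) c v) (ℕ.m+[n∸m]≡n j≤i)) h)))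
    side-injective : ∀ a b → side a ≡ side b → a ≡ b
    side-injective (inj₁ i) (inj₁ j) h = cong inj₁ (Orb.orbit-injective X (free {v} Cv) h)
    side-injective (inj₁ i) (inj₂ j) h = ⊥-elim (disjoint (toℕ i) (toℕ j) h)
    side-injective (inj₂ i) (inj₁ j) h = ⊥-elim (disjoint (toℕ j) (toℕ i) (sym h))
    side-injective (inj₂ i) (inj₂ j) h = cong inj₂ (Orb.orbit-injective X (free {swap v} (swap-conic X {v} Cv)) h)
    points-injective : ∀ {i j} → points i ≡ points j → i ≡ j
    points-injective {i} {j} h = trans (sym (Fin.join-splitAt N N i)) (trans (cong (Fin.join N N) (side-injective (Fin.splitAt N i) (Fin.splitAt N j) h)) (Fin.join-splitAt N N j))
    points-on-conic : ∀ i → OnConic X (points i)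
    points-on-conic i with Fin.splitAt N i
    ... | inj₁ i = iterate-preserves (OnConic X) (λ {w} → ρ-conic X {w}) (toℕ i) {v} Cv
    ... | inj₂ i = iterate-preserves (OnConic X) (λ {w} → ρ-conic X {w}) (toℕ i) {swap v} (swap-conic X {v} Cv)
    size : Plane.count (onConic? X) ℤ.≤ + (N ℕ.+ N)
    size = ℤ.≤-reflexive (trans (elliptic-conic-size X≢0 E) (cong (λ t → + (N ℕ.+ t)) (ℕ.+-identityʳ N)))
    conclude : (∃ λ i → points i ≡ w) → ∃ λ i → iterate (ρ X) i v ≡ w ⊎ iterate (ρ X) i (swap v) ≡ w
    conclude (i , h) with Fin.splitAt N i
    ... | inj₁ j = toℕ j , inj₁ h
    ... | inj₂ j = toℕ j , inj₂ h

-- Neighbours of a regular trace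

*-nonneg : ∀ {i j} → + 0 ℤ.≤ i → + 0 ℤ.≤ j → + 0 ℤ.≤ i ℤ.* j
*-nonneg {i} {j} 0≤i 0≤j = subst (ℤ._≤ i ℤ.* j) (ℤ.*-zeroʳ i) (ℤ.*-monoˡ-≤-nonNeg i {{ℤ.nonNegative 0≤i}} 0≤j)

module Mixing {p : ℕ} (K : PrimeField p) (k : ℕ) (p+1 : suc p ≡ 2 ℕ.^ (4 ℕ.+ k)) where
  open Transitivity K k p+1 public
  open Ring using (solve; _:=_; _:+_; _:*_; _:-_; :-_; con)
  open ≡-Reasoning

  distinct-values : ∀ (T : F → ℤ) {c xs} → (∀ v → + 0 ℤ.≤ T v) → AllPairs _≢_ xs → All (λ x → T x ≡ c) xs → + length xs ℤ.* c ℤ.≤ ∑ T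
  distinct-values T {c} {[]} nonneg _ _ = ℤ.≤-trans (ℤ.≤-reflexive (ℤ.*-zeroˡ c)) (∑-nonneg nonneg)
  distinct-values T {c} {x ∷ xs} nonneg (x∉xs ∷ distinct) (Tx ∷ Txs) = ≤-from rest
      (trans (ℤS.solve 3 (λ s l c → s ℤS.:- (ℤS.con (+ 1) ℤS.:+ l) ℤS.:* c ℤS.:= (s ℤS.:- c) ℤS.:- l ℤS.:* c) refl (∑ T) (+ length xs) c)
        (cong (ℤ._- (+ length xs ℤ.* c)) (sym total)))
    where
    T′ : F → ℤ
    T′ v = T v ℤ.- indicator (x ≟ v) ℤ.* T v
    nonneg′ : ∀ v → + 0 ℤ.≤ T′ v
    nonneg′ v with x ≟ v
    ... | yes _ = ℤ.≤-reflexive (sym (trans (cong (ℤ._-_ (T v)) (ℤ.*-identityˡ (T v))) (ℤ.+-inverseʳ (T v))))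
    ... | no _ = ℤ.≤-trans (nonneg v) (ℤ.≤-reflexive (sym (ℤ.+-identityʳ (T v))))
    unchanged : ∀ {y} → x ≢ y → T y ≡ c → T′ y ≡ c
    unchanged {y} x≢y e = trans (cong (λ i → T y ℤ.- i ℤ.* T y) (indicator-no (x ≟ y) x≢y)) (trans (ℤ.+-identityʳ (T y)) e)
    rest : + length xs ℤ.* c ℤ.≤ ∑ T′
    rest = distinct-values T′ nonneg′ distinct (All.zipWith (uncurry unchanged) (x∉xs , Txs))
    total : ∑ T′ ≡ ∑ T ℤ.- c
    total = trans (∑-minus T (λ v → indicator (x ≟ v) ℤ.* T v)) (cong (ℤ._-_ (∑ T)) (trans (∑-pick x T) Tx))

  -- For l other than 0 and 1 this is, up to sign, the trace of Frobenius of the Legendre curve s² =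
  -- w(w - 1)(w - l).
  legendre : F → ℤ
  legendre l = ∑ (λ w → χ (w * (w - 1F)) ℤ.* χ (w - l))

  legendre² : F → ℤ
  legendre² l = legendre l ℤ.* legendre l

  χ²≤1 : ∀ c → χ c ℤ.* χ c ℤ.≤ + 1
  χ²≤1 c with c ≟ 0F
  ... | yes refl = subst (ℤ._≤ + 1) (sym (cong₂ ℤ._*_ χ-zero χ-zero)) (ℤ.+≤+ ℕ.z≤n)
  ... | no c≢0 = ℤ.≤-reflexive (χ² c≢0)

  -- Bessel's inequality with the weights χ(w(w - 1)), whose squares are at most 1.
  ∑legendre² : ∑ legendre² ℤ.≤ + p ℤ.* + p
  ∑legendre² = ℤ.≤-trans (bessel h) (ℤ.*-monoˡ-≤-nonNeg (+ p) (ℤ.≤-trans (∑-mono (λ w → χ²≤1 (w * (w - 1F)))) (ℤ.≤-reflexive (trans (∑-const (+ 1)) (ℤ.*-identityʳ (+ p))))))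
    where
    h : F → ℤ
    h w = χ (w * (w - 1F))

  -- Substituting w ↦ lw brings out the factor χ(l), a sign that squaring removes.
  legendre-inv : ∀ {l} → l ≢ 0F → legendre² (inv l) ≡ legendre² l
  legendre-inv {l} l≢0 = sym (trans (cong₂ ℤ._*_ scaled scaled) (trans
      (ℤS.solve 2 (λ c a → (c ℤS.:* a) ℤS.:* (c ℤS.:* a) ℤS.:= (c ℤS.:* c) ℤS.:* (a ℤS.:* a)) refl (χ l) (legendre (inv l)))
      (trans (cong (ℤ._* legendre² (inv l)) (χ² l≢0)) (ℤ.*-identityˡ (legendre² (inv l))))))
    where
    pointwise : ∀ w → χ (l * w * (l * w - 1F)) ℤ.* χ (l * w - l) ≡ χ l ℤ.* (χ (w * (w - 1F)) ℤ.* χ (w - inv l))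
    pointwise w = begin
      χ (l * w * (l * w - 1F)) ℤ.* χ (l * w - l) ≡⟨ sym (χ-* (l * w * (l * w - 1F)) (l * w - l)) ⟩
      χ (l * w * (l * w - 1F) * (l * w - l)) ≡⟨ cong χ (linear (*-inverseʳ l l≢0) (l * l * w * (w - 1F))
          (solve 3 (λ l w i → l :* w :* (l :* w :- con (+ 1)) :* (l :* w :- l) :- l :* l :* (l :* (w :* (w :- con (+ 1)) :* (w :- i))) := l :* l :* w :* (w :- con (+ 1)) :* (l :* i :- con (+ 1))) refl l w (inv l))) ⟩
      χ (l * l * (l * (w * (w - 1F) * (w - inv l)))) ≡⟨ χ-*-square (l * (w * (w - 1F) * (w - inv l))) l≢0 ⟩
      χ (l * (w * (w - 1F) * (w - inv l))) ≡⟨ χ-* l (w * (w - 1F) * (w - inv l)) ⟩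
      χ l ℤ.* χ (w * (w - 1F) * (w - inv l)) ≡⟨ cong (χ l ℤ.*_) (χ-* (w * (w - 1F)) (w - inv l)) ⟩
      χ l ℤ.* (χ (w * (w - 1F)) ℤ.* χ (w - inv l)) ∎
    scaled : legendre l ≡ χ l ℤ.* legendre (inv l)
    scaled = trans (sym (∑-scale (λ w → χ (w * (w - 1F)) ℤ.* χ (w - l)) l≢0)) (trans (∑-cong pointwise) (∑-* (χ l) (λ w → χ (w * (w - 1F)) ℤ.* χ (w - inv l))))

  -- Substituting w ↦ 1 - w changes the sign of one factor only, and -1 is a nonsquare, so the sum
  -- itself changes sign.
  legendre-1- : ∀ l → legendre² (1F - l) ≡ legendre² l
  legendre-1- l = trans (cong₂ ℤ._*_ reflected reflected) (ℤS.solve 1 (λ a → (ℤS.:- a) ℤS.:* (ℤS.:- a) ℤS.:= a ℤS.:* a) refl (legendre l))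
    where
    involution : ∀ w → 1F - (1F - w) ≡ w
    involution = solve 1 (λ w → con (+ 1) :- (con (+ 1) :- w) := w) refl
    pointwise : ∀ w → χ ((1F - w) * ((1F - w) - 1F)) ℤ.* χ ((1F - w) - (1F - l)) ≡ ℤ.- (χ (w * (w - 1F)) ℤ.* χ (w - l))
    pointwise w = trans (cong₂ ℤ._*_ (cong χ (solve 1 (λ w → (con (+ 1) :- w) :* (con (+ 1) :- w :- con (+ 1)) := w :* (w :- con (+ 1))) refl w))
        (trans (cong χ (solve 2 (λ w l → con (+ 1) :- w :- (con (+ 1) :- l) := :- (w :- l)) refl w l)) (χ-neg′ (w - l))))
      (ℤS.solve 2 (λ a b → a ℤS.:* (ℤS.:- b) ℤS.:= ℤS.:- (a ℤS.:* b)) refl (χ (w * (w - 1F))) (χ (w - l)))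
    reflected : legendre (1F - l) ≡ ℤ.- legendre l
    reflected = trans (sym (∑-reindex (λ w → χ (w * (w - 1F)) ℤ.* χ (w - (1F - l))) (λ w → 1F - w) (λ w → 1F - w) involution involution))
      (trans (∑-cong pointwise) (∑-neg (λ w → χ (w * (w - 1F)) ℤ.* χ (w - l))))

  χ-1 : χ (- 1F) ≡ -[1+ 0 ]
  χ-1 = χ-negsquare 1≢0 (cong -_ (sym (*-identityˡ 1F)))

  -- The anharmonic group acts on l by permuting the branch points 0, 1, l, ∞, and preserves legendre².
  -- At least five of the six images of κ are distinct, so none of them can carry more than a fifth of the second moment.
  legendre-bound : ∀ {κ} → κ ≢ 0F → χ κ ≡ + 1 → χ (1F - κ) ≡ + 1 → 2F * κ ≢ 1F →
    + 5 ℤ.* legendre² (1F - inv (1F - κ)) ℤ.≤ + p ℤ.* + p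
  legendre-bound {κ} κ≢0 χκ χν 2κ≢1 = ℤ.≤-trans
    (distinct-values legendre² {xs = l ∷ κ ∷ inv κ ∷ ν ∷ inv ν ∷ []} (λ v → square-nonneg (legendre v)) distinct
      (refl ∷ sym (trans Tl (trans (legendre-inv ν≢0) (legendre-1- κ))) ∷ trans (legendre-inv κ≢0) (sym (trans Tl (trans (legendre-inv ν≢0) (legendre-1- κ))))
        ∷ sym (trans Tl (legendre-inv ν≢0)) ∷ sym Tl ∷ []))
    ∑legendre²
    where
    ν l : F
    ν = 1F - κ
    l = 1F - inv ν
    contra : + 1 ≢ + 0
    contra ()
    ν≢0 : ν ≢ 0F
    ν≢0 e = contra (trans (sym χν) (trans (cong χ e) χ-zero))
    Tl : legendre² l ≡ legendre² (inv ν)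
    Tl = legendre-1- (inv ν)
    -- l = -κ/(1 - κ) is a nonsquare, whereas κ, 1 - κ and their inverses are squares; this
    -- separates l from the other four.
    χl : χ l ≡ -[1+ 0 ]
    χl = begin
      χ l ≡⟨ cong χ (linear (*-inverseʳ ν ν≢0) (- 1F) (solve 2 (λ κ i → con (+ 1) :- i :- (:- (κ :* i)) := (:- con (+ 1)) :* ((con (+ 1) :- κ) :* i :- con (+ 1))) refl κ (inv ν))) ⟩
      χ (- (κ * inv ν)) ≡⟨ χ-neg′ (κ * inv ν) ⟩
      ℤ.- χ (κ * inv ν) ≡⟨ cong ℤ.-_ (trans (χ-* κ (inv ν)) (cong₂ ℤ._*_ χκ (trans (χ-inv ν) χν))) ⟩
      -[1+ 0 ] ∎
    l≢ : ∀ {x} → χ x ≡ + 1 → l ≢ x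
    l≢ {x} h refl = sign (trans (sym χl) h)
      where
      sign : -[1+ 0 ] ≢ + 1
      sign ()
    -- x = 1/x means x = 1 or x = -1, and -1 is not a square.
    self-inverse : ∀ {x} → x ≢ 0F → χ x ≡ + 1 → x ≢ 1F → x ≢ inv x
    self-inverse {x} x≢0 h x≢1 e with x²≡y² {x} {1F} (trans (cong (x *_) e) (trans (*-inverseʳ x x≢0) (sym (*-identityˡ 1F))))
    ... | inj₁ x≡1 = x≢1 x≡1
    ... | inj₂ x≡-1 = sign (trans (sym h) (trans (cong χ x≡-1) χ-1))
      where
      sign : + 1 ≢ -[1+ 0 ]
      sign ()
    κ≢ν : κ ≢ ν
    κ≢ν e = 2κ≢1 (linear e 1F (solve 1 (λ κ → con (+ 2) :* κ :- con (+ 1) := con (+ 1) :* (κ :- (con (+ 1) :- κ))) refl κ))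
    -- κ(1 - κ) = 1 would give κ³ = -1, but κ³ has the same character as κ.
    κν≢1 : κ * ν ≢ 1F
    κν≢1 e = sign (trans (sym (trans (χ-*-square {κ} κ κ≢0) χκ)) (trans (cong χ (linear e (- (κ + 1F))
        (solve 1 (λ κ → κ :* κ :* κ :- (:- con (+ 1)) := (:- (κ :+ con (+ 1))) :* (κ :* (con (+ 1) :- κ) :- con (+ 1))) refl κ))) χ-1))
      where
      sign : + 1 ≢ -[1+ 0 ]
      sign ()
    inv-injective : inv κ ≢ inv ν
    inv-injective e = κ≢ν (trans (sym (inv-involutive κ)) (trans (cong inv e) (inv-involutive ν)))
    κ≢1 : κ ≢ 1F
    κ≢1 e = ν≢0 (x-x≡0 (sym e))
    ν≢1 : ν ≢ 1F
    ν≢1 e = κ≢0 (linear e (- 1F) (solve 1 (λ κ → κ :- con (+ 0) := (:- con (+ 1)) :* (con (+ 1) :- κ :- con (+ 1))) refl κ))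
    distinct : AllPairs _≢_ (l ∷ κ ∷ inv κ ∷ ν ∷ inv ν ∷ [])
    distinct = (l≢ χκ ∷ l≢ (trans (χ-inv κ) χκ) ∷ l≢ χν ∷ l≢ (trans (χ-inv ν) χν) ∷ [])
      ∷ (self-inverse κ≢0 χκ κ≢1 ∷ κ≢ν ∷ (λ e → κν≢1 (trans (cong (_* ν) e) (trans (*-comm (inv ν) ν) (*-inverseʳ ν ν≢0)))) ∷ [])
      ∷ ((λ e → κν≢1 (trans (cong (κ *_) (sym e)) (*-inverseʳ κ κ≢0))) ∷ inv-injective ∷ [])
      ∷ (self-inverse ν≢0 χν ν≢1 ∷ [])
      ∷ [] ∷ []

  16F : F
  16F = ⟦ + 16 ⟧

  16≢0 : 16F ≢ 0F
  16≢0 e = *-nonzero 4≢0 4≢0 (trans (solve 0 (con (+ 4) :* con (+ 4) := con (+ 16)) refl) e)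

  -- The discriminant (Xy)² - 4(X² + y²) of the conic equation as a quadratic in z, written so that
  -- its symmetry in X and y is visible.
  gram : F → F → F
  gram X y = discriminant X * discriminant y - 16F

  Adjacent : F → F → Set
  Adjacent X y = χ (gram X y) ≢ -[1+ 0 ]

  adjacent? : ∀ X y → Dec (Adjacent X y)
  adjacent? X y = ¬? (χ (gram X y) ℤ.≟ -[1+ 0 ])

  adjacent⇒conic : ∀ {X y} → Adjacent X y → ∃ λ z → OnConic X (y , z)
  adjacent⇒conic {X} {y} adj = point (trichotomy (gram X y))
    where
    from-root : ∀ s → gram X y ≡ s * s → ∃ λ z → OnConic X (y , z)
    from-root s h = inv 2F * (X * y + s) , *-cancelˡ 4≢0 (linear₂ h (*-inverseʳ 2F 2≢0) (- 1F) ((X * y + s) * (X * y + s) * (2F * inv 2F + 1F) - (X * y + X * y) * (X * y + s))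
      (solve 4 (λ X y s i → con (+ 4) :* (X :* X :+ y :* y :+ i :* (X :* y :+ s) :* (i :* (X :* y :+ s))) :- con (+ 4) :* (X :* y :* (i :* (X :* y :+ s)))
        := (:- con (+ 1)) :* ((X :* X :- con (+ 4)) :* (y :* y :- con (+ 4)) :- con (+ 16) :- s :* s) :+ ((X :* y :+ s) :* (X :* y :+ s) :* (con (+ 2) :* i :+ con (+ 1)) :- (X :* y :+ X :* y) :* (X :* y :+ s)) :* (con (+ 2) :* i :- con (+ 1))) refl X y s (inv 2F)))
    point : Trichotomy (gram X y) → ∃ λ z → OnConic X (y , z)
    point (is-zero e) = from-root 0F (trans e (sym (zeroˡ 0F)))
    point (is-square {s} _ e) = from-root s e
    point (is-negsquare s≢0 e) = ⊥-elim (adj (χ-negsquare s≢0 e))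

  Neighbour : F → F → Set
  Neighbour X y = Regular y × Adjacent X y

  neighbour? : ∀ X y → Dec (Neighbour X y)
  neighbour? X y = regular? y ×-dec adjacent? X y

  module Degree {X} (E : Elliptic X) (X≢0 : X ≢ 0F) (X²≢2 : X * X ≢ 2F) where
    private
      a κ l : F
      a = discriminant X
      κ = inv 4F * (X * X)
      -- This is X²/(X² - 4), so that `gram X y` = (X² - 4)(y² - 4l). It is expressed through κ =
      -- X²/4 to suit `legendre-bound`.
      l = 1F - inv (1F - κ)

      4κ≡X² : 4F * κ ≡ X * X
      4κ≡X² = linear (*-inverseʳ 4F 4≢0) (X * X) (solve 2 (λ X i → con (+ 4) :* (i :* (X :* X)) :- X :* X := X :* X :* (con (+ 4) :* i :- con (+ 1))) refl X (inv 4F))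

      1-κ : 4F * (1F - κ) ≡ - a
      1-κ = linear 4κ≡X² (- 1F) (solve 2 (λ X κ → con (+ 4) :* (con (+ 1) :- κ) :- (:- (X :* X :- con (+ 4))) := (:- con (+ 1)) :* (con (+ 4) :* κ :- X :* X)) refl X κ)

      χ4* : ∀ c → χ (4F * c) ≡ χ c
      χ4* c = trans (cong χ (solve 1 (λ c → con (+ 4) :* c := con (+ 2) :* con (+ 2) :* c) refl c)) (χ-*-square c 2≢0)

      χν : χ (1F - κ) ≡ + 1
      χν = trans (sym (χ4* (1F - κ))) (trans (cong χ 1-κ) (trans (χ-neg′ a) (cong ℤ.-_ E)))

      1-κ≢0 : 1F - κ ≢ 0F
      1-κ≢0 e = contra (trans (sym χν) (trans (cong χ e) χ-zero))
        where
        contra : + 1 ≢ + 0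
        contra ()

      al≡X² : a * l ≡ X * X
      al≡X² = linear₂ (*-inverseʳ (1F - κ) 1-κ≢0) 1-κ 4F (- inv (1F - κ))
        (solve 3 (λ X κ j → (X :* X :- con (+ 4)) :* (con (+ 1) :- j) :- X :* X := con (+ 4) :* ((con (+ 1) :- κ) :* j :- con (+ 1)) :+ (:- j) :* (con (+ 4) :* (con (+ 1) :- κ) :- (:- (X :* X :- con (+ 4))))) refl X κ (inv (1F - κ)))

    -- κ = (X/2)² is a square, and 1 - κ = -(X² - 4)/4 is one because X² - 4 is not; 2κ = 1 is the
    -- excluded case X² = 2.
    legendre-small : + 5 ℤ.* legendre² l ℤ.≤ + p ℤ.* + p
    legendre-small = legendre-bound
      (*-nonzero (inv-nonzero 4≢0) (*-nonzero X≢0 X≢0))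
      (trans (sym (χ4* κ)) (χ-square X≢0 (sym 4κ≡X²)))
      χν
      (λ e → X²≢2 (linear₂ 4κ≡X² e (- 1F) 2F (solve 2 (λ X κ → X :* X :- con (+ 2) := (:- con (+ 1)) :* (con (+ 4) :* κ :- X :* X) :+ con (+ 2) :* (con (+ 2) :* κ :- con (+ 1))) refl X κ)))

    private
      u : F → ℤ
      u y = χ (discriminant y)
      g : F → ℤ
      g y = χ (gram X y)

      ∑u : ∑ u ≡ -[1+ 0 ]
      ∑u = trans (∑-cong (λ y → cong (λ t → χ (t - 4F)) (sym (*-identityˡ (y * y))))) (trans (∑χ[αy²-β] 1≢0 4≢0) (cong ℤ.-_ (χ-square {1F} 1≢0 (*-identityˡ 1F))))

      gram-as-quadratic : ∀ y → gram X y ≡ a * (y * y) - 4F * (X * X)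
      gram-as-quadratic y = solve 2 (λ X y → (X :* X :- con (+ 4)) :* (y :* y :- con (+ 4)) :- con (+ 16) := (X :* X :- con (+ 4)) :* (y :* y) :- con (+ 4) :* (X :* X)) refl X y

      a≢0 : a ≢ 0F
      a≢0 = elliptic⇒discriminant≢0 E

      ∑g : ∑ g ≡ + 1
      ∑g = trans (∑-cong (λ y → cong χ (gram-as-quadratic y))) (trans (∑χ[αy²-β] a≢0 (*-nonzero 4≢0 (*-nonzero X≢0 X≢0))) (cong ℤ.-_ E))

      factor : ∀ v → χ (a * v - 4F * (X * X)) ≡ ℤ.- χ (v - 4F * l)
      factor v = trans (cong χ (linear al≡X² 4F (solve 4 (λ a l X v → a :* v :- con (+ 4) :* (X :* X) :- a :* (v :- con (+ 4) :* l) := con (+ 4) :* (a :* l :- X :* X)) refl a l X v)))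
        (trans (χ-* a (v - 4F * l)) (trans (cong (ℤ._* χ (v - 4F * l)) E) (ℤ.-1*i≡-i (χ (v - 4F * l)))))

      l≢1 : 4F ≢ 4F * l
      l≢1 e = inv-nonzero 1-κ≢0 (*-cancelˡ 4≢0 (linear e 1F (solve 1 (λ j → con (+ 4) :* j :- con (+ 4) :* con (+ 0) := con (+ 1) :* (con (+ 4) :- con (+ 4) :* (con (+ 1) :- j))) refl (inv (1F - κ)))))

      -- In terms of v = y², the weight 1 + χ(v) yields a quadratic and a cubic sum; v = 4w turns
      -- the cubic one into `legendre l`.
      ∑ug : ∑ (λ y → u y ℤ.* g y) ≡ + 1 ℤ.- legendre l
      ∑ug = begin
        ∑ (λ y → u y ℤ.* g y) ≡⟨ ∑-cong (λ y → cong (ℤ._*_ (u y)) (trans (cong χ (gram-as-quadratic y)) (factor (y * y)))) ⟩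
        ∑ (λ y → r (y * y)) ≡⟨ ∑-of-squares r ⟩
        ∑ (λ v → (+ 1 ℤ.+ χ v) ℤ.* r v) ≡⟨ ∑-cong pointwise ⟩
        ∑ (λ v → ℤ.- χ ((v - 4F) * (v - 4F * l)) ℤ.- s v) ≡⟨ ∑-minus (λ v → ℤ.- χ ((v - 4F) * (v - 4F * l))) s ⟩
        ∑ (λ v → ℤ.- χ ((v - 4F) * (v - 4F * l))) ℤ.- ∑ s ≡⟨ cong₂ ℤ._-_ (trans (∑-neg (λ v → χ ((v - 4F) * (v - 4F * l)))) (cong ℤ.-_ quadratic)) (trans (sym (∑-scale s 4≢0)) (∑-cong rescale)) ⟩
        + 1 ℤ.- legendre l ∎
        where
        r s : F → ℤ
        r v = χ (v - 4F) ℤ.* ℤ.- χ (v - 4F * l)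
        s v = χ v ℤ.* (χ (v - 4F) ℤ.* χ (v - 4F * l))
        pointwise : ∀ v → (+ 1 ℤ.+ χ v) ℤ.* r v ≡ ℤ.- χ ((v - 4F) * (v - 4F * l)) ℤ.- s v
        pointwise v = trans (ℤS.solve 3 (λ c d e → (ℤS.con (+ 1) ℤS.:+ c) ℤS.:* (d ℤS.:* (ℤS.:- e)) ℤS.:= (ℤS.:- (d ℤS.:* e)) ℤS.:- c ℤS.:* (d ℤS.:* e)) refl (χ v) (χ (v - 4F)) (χ (v - 4F * l)))
          (cong (λ t → ℤ.- t ℤ.- s v) (sym (χ-* (v - 4F) (v - 4F * l))))
        quadratic : ∑ (λ v → χ ((v - 4F) * (v - 4F * l))) ≡ -[1+ 0 ]
        quadratic = trans (∑χ-quadratic 4F (4F * l)) (trans (cong (λ t → + p ℤ.* t ℤ.- + 1) (indicator-no (4F ≟ 4F * l) l≢1)) (cong (ℤ._- + 1) (ℤ.*-zeroʳ (+ p))))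
        rescale : ∀ w → s (4F * w) ≡ χ (w * (w - 1F)) ℤ.* χ (w - l)
        rescale w = trans (cong₂ (λ b c → χ (4F * w) ℤ.* (χ b ℤ.* χ c))
            (solve 1 (λ w → con (+ 4) :* w :- con (+ 4) := con (+ 4) :* (w :- con (+ 1))) refl w) (solve 2 (λ w l → con (+ 4) :* w :- con (+ 4) :* l := con (+ 4) :* (w :- l)) refl w l))
          (trans (cong₂ ℤ._*_ (χ4* w) (cong₂ ℤ._*_ (χ4* (w - 1F)) (χ4* (w - l))))
            (trans (sym (ℤ.*-assoc (χ w) (χ (w - 1F)) (χ (w - l)))) (cong (ℤ._* χ (w - l)) (sym (χ-* w (w - 1F))))))

    -- The weight (1 - u)(1 + g) is at most 4, and it vanishes unless y is elliptic and adjacent to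
    -- X: at y = 2 and y = -2 because there gram = -16 is a nonsquare. Elliptic y that are not
    -- regular are charged to `fibre-2`.
    degree-bound : + (2 ℕ.^ (4 ℕ.+ k)) ℤ.+ legendre l ℤ.≤ + 4 ℤ.* (count (neighbour? X) ℤ.+ fibre-2 (2 ℕ.+ k))
    degree-bound = subst₂ ℤ._≤_ left right (∑-mono pointwise)
      where
      left : ∑ (λ y → (+ 1 ℤ.- u y) ℤ.* (+ 1 ℤ.+ g y)) ≡ + (2 ℕ.^ (4 ℕ.+ k)) ℤ.+ legendre l
      left = begin
        ∑ (λ y → (+ 1 ℤ.- u y) ℤ.* (+ 1 ℤ.+ g y)) ≡⟨ ∑-cong (λ y → ℤS.solve 2 (λ u g → (ℤS.con (+ 1) ℤS.:- u) ℤS.:* (ℤS.con (+ 1) ℤS.:+ g) ℤS.:= (ℤS.con (+ 1) ℤS.:+ g) ℤS.:- (u ℤS.:+ u ℤS.:* g)) refl (u y) (g y)) ⟩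
        ∑ (λ y → (+ 1 ℤ.+ g y) ℤ.- (u y ℤ.+ u y ℤ.* g y)) ≡⟨ ∑-minus (λ y → + 1 ℤ.+ g y) (λ y → u y ℤ.+ u y ℤ.* g y) ⟩
        ∑ (λ y → + 1 ℤ.+ g y) ℤ.- ∑ (λ y → u y ℤ.+ u y ℤ.* g y) ≡⟨ cong₂ ℤ._-_ (∑-+ (λ _ → + 1) g) (∑-+ u (λ y → u y ℤ.* g y)) ⟩
        (∑ (λ _ → + 1) ℤ.+ ∑ g) ℤ.- (∑ u ℤ.+ ∑ (λ y → u y ℤ.* g y)) ≡⟨ cong₂ ℤ._-_ (cong₂ ℤ._+_ (trans (∑-const (+ 1)) (ℤ.*-identityʳ (+ p))) ∑g) (cong₂ ℤ._+_ ∑u ∑ug) ⟩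
        (+ p ℤ.+ + 1) ℤ.- (-[1+ 0 ] ℤ.+ (+ 1 ℤ.- legendre l)) ≡⟨ ℤS.solve 2 (λ p L → (p ℤS.:+ ℤS.con (+ 1)) ℤS.:- (ℤS.con -[1+ 0 ] ℤS.:+ (ℤS.con (+ 1) ℤS.:- L)) ℤS.:= (ℤS.con (+ 1) ℤS.:+ p) ℤS.:+ L) refl (+ p) (legendre l) ⟩
        + suc p ℤ.+ legendre l ≡⟨ cong (λ t → + t ℤ.+ legendre l) p+1 ⟩
        + (2 ℕ.^ (4 ℕ.+ k)) ℤ.+ legendre l ∎
      low : F → ℤ
      low y = indicator (iterate trace (2 ℕ.+ k) y ≟ 2F)
      right : ∑ (λ y → + 4 ℤ.* (indicator (neighbour? X y) ℤ.+ low y)) ≡ + 4 ℤ.* (count (neighbour? X) ℤ.+ fibre-2 (2 ℕ.+ k))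
      right = trans (∑-* (+ 4) (λ y → indicator (neighbour? X y) ℤ.+ low y)) (cong (ℤ._*_ (+ 4)) (∑-+ (λ y → indicator (neighbour? X y)) low))
      1+g≤2 : ∀ y → + 1 ℤ.+ g y ℤ.≤ + 2
      1+g≤2 y = ℤ.+-monoʳ-≤ (+ 1) (χ≤1 (gram X y))
      pointwise : ∀ y → (+ 1 ℤ.- u y) ℤ.* (+ 1 ℤ.+ g y) ℤ.≤ + 4 ℤ.* (indicator (neighbour? X y) ℤ.+ low y)
      pointwise y = by-cases (trichotomy (discriminant y)) (iterate trace (2 ℕ.+ k) y ≟ 2F) (adjacent? X y)
        where
        rhs : ℤ
        rhs = + 4 ℤ.* (indicator (neighbour? X y) ℤ.+ low y)
        0≤rhs : + 0 ℤ.≤ rhs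
        0≤rhs = *-nonneg {+ 4} (ℤ.+≤+ ℕ.z≤n) (ℤ.+-mono-≤ (indicator-nonneg (neighbour? X y)) (indicator-nonneg (iterate trace (2 ℕ.+ k) y ≟ 2F)))
        small : ∀ {i} → indicator (neighbour? X y) ℤ.+ low y ≡ + 1 ℤ.+ i → + 0 ℤ.≤ i → u y ≡ -[1+ 0 ] → (+ 1 ℤ.- u y) ℤ.* (+ 1 ℤ.+ g y) ℤ.≤ rhs
        small {i} e 0≤i E′ = ℤ.≤-trans (ℤ.≤-reflexive (cong (λ t → (+ 1 ℤ.- t) ℤ.* (+ 1 ℤ.+ g y)) E′))
          (ℤ.≤-trans (ℤ.*-monoˡ-≤-nonNeg (+ 2) (1+g≤2 y)) (subst (λ t → + 4 ℤ.≤ + 4 ℤ.* t) (sym e) (ℤ.*-monoˡ-≤-nonNeg (+ 4) (ℤ.+-monoʳ-≤ (+ 1) 0≤i))))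
        by-cases : Trichotomy (discriminant y) → Dec (iterate trace (2 ℕ.+ k) y ≡ 2F) → Dec (Adjacent X y) → (+ 1 ℤ.- u y) ℤ.* (+ 1 ℤ.+ g y) ℤ.≤ rhs
        by-cases (is-zero e) _ _ = ℤ.≤-trans (ℤ.≤-reflexive (trans (cong (ℤ._*_ (+ 1 ℤ.- u y)) (cong (ℤ._+_ (+ 1)) g≡-1)) (ℤ.*-zeroʳ (+ 1 ℤ.- u y)))) 0≤rhs
          where
          g≡-1 : g y ≡ -[1+ 0 ]
          g≡-1 = χ-negsquare {4F} 4≢0 (linear e a (solve 2 (λ a d → a :* d :- con (+ 16) :- (:- (con (+ 4) :* con (+ 4))) := a :* (d :- con (+ 0))) refl a (discriminant y)))
        by-cases (is-square s≢0 e) _ _ = ℤ.≤-trans (ℤ.≤-reflexive (trans (cong (λ t → (+ 1 ℤ.- t) ℤ.* (+ 1 ℤ.+ g y)) (χ-square s≢0 (sym e))) (ℤ.*-zeroˡ (+ 1 ℤ.+ g y)))) 0≤rhs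
        by-cases (is-negsquare s≢0 e) _ (no ¬adj) = ℤ.≤-trans (ℤ.≤-reflexive (trans (cong (ℤ._*_ (+ 1 ℤ.- u y)) (cong (ℤ._+_ (+ 1)) (decidable-stable (χ (gram X y) ℤ.≟ -[1+ 0 ]) ¬adj))) (ℤ.*-zeroʳ (+ 1 ℤ.- u y)))) 0≤rhs
        by-cases (is-negsquare s≢0 e) (yes t≡2) (yes _) = small (trans (ℤ.+-comm (indicator (neighbour? X y)) (low y)) (cong (ℤ._+ indicator (neighbour? X y)) (indicator-yes (iterate trace (2 ℕ.+ k) y ≟ 2F) t≡2)))
          (indicator-nonneg (neighbour? X y)) (χ-negsquare s≢0 e)
        by-cases (is-negsquare s≢0 e) (no t≢2) (yes adj) = small (cong (ℤ._+ low y) (indicator-yes (neighbour? X y) ((χ-negsquare s≢0 e , t≢2) , adj)))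
          (indicator-nonneg (iterate trace (2 ℕ.+ k) y ≟ 2F)) (χ-negsquare s≢0 e)

-- Mixing

-- 15/32 lies slightly above 1/√5, since 5 · 15² = 1125 exceeds 32² = 1024.
ratio-bound : ∀ x q → 0 ℕ.< q → 5 ℕ.* (x ℕ.* x) ℕ.≤ q ℕ.* q → 32 ℕ.* x ℕ.≤ 15 ℕ.* q
ratio-bound x q 0<q h with ℕ.≤-total (32 ℕ.* x) (15 ℕ.* q)
... | inj₁ le = le
... | inj₂ ge = ⊥-elim (ℕ.<⇒≱ (ℕ.*-monoˡ-< (q ℕ.* q) {{ℕ.>-nonZero (ℕ.*-mono-< 0<q 0<q)}} {1024} {1125} (ℕ.m≤m+n 1025 100)) (begin
  1125 ℕ.* (q ℕ.* q) ≡⟨ ℕS.solve 1 (λ q → ℕS.con 1125 ℕS.:* (q ℕS.:* q) ℕS.:= ℕS.con 5 ℕS.:* ((ℕS.con 15 ℕS.:* q) ℕS.:* (ℕS.con 15 ℕS.:* q))) refl q ⟩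
  5 ℕ.* ((15 ℕ.* q) ℕ.* (15 ℕ.* q)) ≤⟨ ℕ.*-monoʳ-≤ 5 (ℕ.*-mono-≤ ge ge) ⟩
  5 ℕ.* ((32 ℕ.* x) ℕ.* (32 ℕ.* x)) ≡⟨ ℕS.solve 1 (λ x → ℕS.con 5 ℕS.:* ((ℕS.con 32 ℕS.:* x) ℕS.:* (ℕS.con 32 ℕS.:* x)) ℕS.:= ℕS.con 1024 ℕS.:* (ℕS.con 5 ℕS.:* (x ℕS.:* x))) refl x ⟩
  1024 ℕ.* (5 ℕ.* (x ℕ.* x)) ≤⟨ ℕ.*-monoʳ-≤ 1024 h ⟩
  1024 ℕ.* (q ℕ.* q) ∎))
  where open ℕ.≤-Reasoning

ratio-boundℤ : ∀ L q → 0 ℕ.< q → + 5 ℤ.* (L ℤ.* L) ℤ.≤ + q ℤ.* + q → ℤ.- (+ 32 ℤ.* L) ℤ.≤ + 15 ℤ.* + q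
ratio-boundℤ (+ n) q 0<q h = ℤ.≤-trans (ℤ.neg-mono-≤ (*-nonneg {+ 32} {+ n} (ℤ.+≤+ ℕ.z≤n) (ℤ.+≤+ ℕ.z≤n))) (*-nonneg {+ 15} {+ q} (ℤ.+≤+ ℕ.z≤n) (ℤ.+≤+ ℕ.z≤n))
ratio-boundℤ -[1+ n ] q 0<q h = subst₂ ℤ._≤_ (ℤ.pos-* 32 (suc n)) (ℤ.pos-* 15 q)
  (ℤ.+≤+ (ratio-bound (suc n) q 0<q (ℤ.drop‿+≤+ (subst₂ ℤ._≤_ (sym (ℤ.pos-* 5 (suc n ℕ.* suc n))) (sym (ℤ.pos-* q q)) h))))

-- With B, G ≥ q/256 the mixing bound would force q ≤ 4 · 256² = 2¹⁸.
numerical-contradiction : ∀ B G q → 2 ℕ.^ 19 ℕ.≤ q → q ℕ.≤ 256 ℕ.* B → q ℕ.≤ 256 ℕ.* G → ¬ (B ℕ.* (G ℕ.* G) ℕ.≤ 4 ℕ.* (q ℕ.* G))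
numerical-contradiction B zero q big hB hG h = ℕ.<⇒≱ (ℕ.<-≤-trans (ℕ.m^n>0 2 19) big) hG
numerical-contradiction B G@(suc _) q big hB hG h = ℕ.<⇒≱ (ℕ.*-monoˡ-< q {{ℕ.>-nonZero (ℕ.<-≤-trans (ℕ.m^n>0 2 19) big)}} {2 ℕ.^ 18} {q} (ℕ.<-≤-trans (ℕ.^-monoʳ-< 2 (ℕ.s≤s (ℕ.s≤s ℕ.z≤n)) (ℕ.n<1+n 18)) big)) (begin
  q ℕ.* q ≤⟨ ℕ.*-mono-≤ hB hG ⟩
  (256 ℕ.* B) ℕ.* (256 ℕ.* G) ≡⟨ ℕS.solve 2 (λ b g → (ℕS.con 256 ℕS.:* b) ℕS.:* (ℕS.con 256 ℕS.:* g) ℕS.:= ℕS.con 65536 ℕS.:* (b ℕS.:* g)) refl B G ⟩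
  65536 ℕ.* (B ℕ.* G) ≤⟨ ℕ.*-monoʳ-≤ 65536 BG≤4q ⟩
  65536 ℕ.* (4 ℕ.* q) ≡⟨ sym (ℕ.*-assoc 65536 4 q) ⟩
  2 ℕ.^ 18 ℕ.* q ∎)
  where
  open ℕ.≤-Reasoning
  BG≤4q : B ℕ.* G ℕ.≤ 4 ℕ.* q
  BG≤4q = ℕ.*-cancelʳ-≤ (B ℕ.* G) (4 ℕ.* q) G (subst₂ ℕ._≤_ (sym (ℕ.*-assoc B G G)) (sym (ℕ.*-assoc 4 q G)) h)

module Connectivity {p : ℕ} (K : PrimeField p) (k : ℕ) (p+1 : suc p ≡ 2 ℕ.^ (4 ℕ.+ k)) (k≥15 : 15 ℕ.≤ k) where
  open Mixing K k p+1 public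
  open Ring using (solve; _:=_; _:+_; _:*_; _:-_; :-_; con)
  open ≡-Reasoning

  q : ℕ
  q = 2 ℕ.^ (4 ℕ.+ k)

  2^19≤q : 2 ℕ.^ 19 ℕ.≤ q
  2^19≤q = ℕ.^-monoʳ-≤ 2 (ℕ.+-monoʳ-≤ 4 k≥15)

  p≤q : p ℕ.≤ q
  p≤q = subst (p ℕ.≤_) p+1 (ℕ.n≤1+n p)

  -- If X² = 2, then t ↦ t² - 2 leads from X through 0 and -2 to 2, so the trace is already 2 after
  -- three steps.
  regular⇒X²≢2 : ∀ {X} → Regular X → X * X ≢ 2F
  regular⇒X²≢2 {X} (_ , t≢2) e = t≢2 (subst (λ i → iterate trace i X ≡ 2F) (trans (ℕ.+-suc (k ℕ.∸ 1) 2) (trans (cong suc (ℕ.+-comm (k ℕ.∸ 1) 2)) (cong (2 ℕ.+_) (ℕ.m+[n∸m]≡n (ℕ.≤-trans (ℕ.s≤s ℕ.z≤n) k≥15)))))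
    (trace-stable (k ℕ.∸ 1) 3 (trans (cong (λ t → trace (trace t)) (x-x≡0 e)) (trace-0 0))))

  -- Inserting L ≥ -15q/32 and at most q/8 + 1 low traces, `degree-bound` gives 4N ≥ q/32 - 4.
  -- Multiplied by 64 this is 256N ≥ 2q - 256, and q ≥ 256.
  neighbour-count : ∀ {X} → Regular X → + q ℤ.≤ + 256 ℤ.* count (neighbour? X)
  neighbour-count {X} R@(E , _) = ℤ.0≤i-j⇒j≤i (subst (+ 0 ℤ.≤_) (trans
      (ℤS.solve 5 (λ N b L q Q → (ℤS.con (+ 64) ℤS.:* (ℤS.con (+ 4) ℤS.:* (N ℤS.:+ b) ℤS.:- (q ℤS.:+ L)) ℤS.:+ ℤS.con (+ 256) ℤS.:* (Q ℤS.:+ ℤS.con (+ 1) ℤS.:- b))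
          ℤS.:+ (ℤS.con (+ 2) ℤS.:* (ℤS.con (+ 15) ℤS.:* q ℤS.:- (ℤS.:- (ℤS.con (+ 32) ℤS.:* L))) ℤS.:+ (q ℤS.:- ℤS.con (+ 256)))
          ℤS.:= (ℤS.con (+ 256) ℤS.:* N ℤS.:- q) ℤS.:+ ℤS.con (+ 32) ℤS.:* (ℤS.con (+ 8) ℤS.:* Q ℤS.:- q)) refl N b L (+ q) Q)
      (trans (cong (λ t → (+ 256 ℤ.* N ℤ.- + q) ℤ.+ + 32 ℤ.* (t ℤ.- + q)) 8Q≡q) (ℤS.solve 2 (λ N q → (ℤS.con (+ 256) ℤS.:* N ℤS.:- q) ℤS.:+ ℤS.con (+ 32) ℤS.:* (q ℤS.:- q) ℤS.:= ℤS.con (+ 256) ℤS.:* N ℤS.:- q) refl N (+ q))))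
    (ℤ.+-mono-≤
      (ℤ.+-mono-≤ (*-nonneg {+ 64} (ℤ.+≤+ ℕ.z≤n) (ℤ.i≤j⇒0≤j-i degree-bound)) (*-nonneg {+ 256} (ℤ.+≤+ ℕ.z≤n) (ℤ.i≤j⇒0≤j-i (fibre-2-bound (1 ℕ.+ k)))))
      (ℤ.+-mono-≤ (*-nonneg {+ 2} (ℤ.+≤+ ℕ.z≤n) (ℤ.i≤j⇒0≤j-i (ratio-boundℤ L q (ℕ.m^n>0 2 (4 ℕ.+ k)) small))) (ℤ.i≤j⇒0≤j-i (ℤ.+≤+ (ℕ.≤-trans (ℕ.^-monoʳ-≤ 2 {8} {19} (ℕ.m≤m+n 8 11)) 2^19≤q))))))
    where
    open Degree E (regular⇒nonzero R) (regular⇒X²≢2 R)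
    N b L Q : ℤ
    N = count (neighbour? X)
    b = fibre-2 (2 ℕ.+ k)
    L = legendre (1F - inv (1F - inv 4F * (X * X)))
    Q = + (2 ℕ.^ (1 ℕ.+ k))
    8Q≡q : + 8 ℤ.* Q ≡ + q
    8Q≡q = trans (sym (ℤ.pos-* 8 (2 ℕ.^ (1 ℕ.+ k)))) (cong +_ (sym (ℕ.^-distribˡ-+-* 2 3 (1 ℕ.+ k))))
    small : + 5 ℤ.* (L ℤ.* L) ℤ.≤ + q ℤ.* + q
    small = ℤ.≤-trans legendre-small (subst₂ ℤ._≤_ (ℤ.pos-* p p) (ℤ.pos-* q q) (ℤ.+≤+ (ℕ.*-mono-≤ p≤q p≤q)))

  module _ {B G : F → Set} (B? : ∀ x → Dec (B x)) (G? : ∀ y → Dec (G y))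
           (G-elliptic : ∀ {y} → G y → Elliptic y) (separated : ∀ {x y} → B x → G y → χ (gram x y) ≡ -[1+ 0 ]) where
    private
      g b : F → ℤ
      g y = indicator (G? y)
      b x = indicator (B? x)

      -- The value of x² - 4 at which `gram x y` vanishes. The sign of `gram x y` thereby becomes,
      -- up to χ(y² - 4), the character of a difference, as `bessel` requires.
      centre : F → F
      centre y = 16F * inv (discriminant y)

      h : F → ℤ
      h w = ∑ (λ y → g y ℤ.* indicator (centre y ≟ w))

      T : F → ℤ
      T l = ∑ (λ w → h w ℤ.* χ (w - l))

      resum : ∀ (f : F → ℤ) → ∑ (λ w → h w ℤ.* f w) ≡ ∑ (λ y → g y ℤ.* f (centre y))
      resum f = begin
        ∑ (λ w → h w ℤ.* f w) ≡⟨ ∑-cong (λ w → sym (∑-*ʳ (f w) (λ y → g y ℤ.* indicator (centre y ≟ w)))) ⟩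
        ∑ (λ w → ∑ (λ y → (g y ℤ.* indicator (centre y ≟ w)) ℤ.* f w)) ≡⟨ ∑-swap (finite p) (λ w y → (g y ℤ.* indicator (centre y ≟ w)) ℤ.* f w) ⟩
        ∑ (λ y → ∑ (λ w → (g y ℤ.* indicator (centre y ≟ w)) ℤ.* f w)) ≡⟨ ∑-cong (λ y → trans (∑-cong (λ w → ℤ.*-assoc (g y) (indicator (centre y ≟ w)) (f w)))
              (trans (∑-* (g y) (λ w → indicator (centre y ≟ w) ℤ.* f w)) (cong (ℤ._*_ (g y)) (∑-pick (centre y) f)))) ⟩
        ∑ (λ y → g y ℤ.* f (centre y)) ∎

      -- Every y in `G` contributes χ(y² - 4) · χ(-gram) = -1, so nothing cancels.
      T-on-B : ∀ {x} → B x → T (discriminant x) ≡ ℤ.- count G?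
      T-on-B {x} Bx = trans (resum (λ w → χ (w - discriminant x))) (trans (∑-cong pointwise) (∑-neg g))
        where
        pointwise : ∀ y → g y ℤ.* χ (centre y - discriminant x) ≡ ℤ.- g y
        pointwise y with G? y
        ... | no _ = refl
        ... | yes Gy = trans (ℤ.*-identityˡ (χ (centre y - discriminant x))) (begin
          χ (centre y - discriminant x) ≡⟨ cong χ (linear (*-inverseʳ d d≢0) (discriminant x) (solve 3 (λ e d i → con (+ 16) :* i :- e :- i :* (:- (e :* d :- con (+ 16))) := e :* (d :* i :- con (+ 1))) refl (discriminant x) d (inv d))) ⟩
          χ (inv d * (- gram x y)) ≡⟨ χ-* (inv d) (- gram x y) ⟩
          χ (inv d) ℤ.* χ (- gram x y) ≡⟨ cong₂ ℤ._*_ (trans (χ-inv d) (G-elliptic Gy)) (trans (χ-neg′ (gram x y)) (cong ℤ.-_ (separated Bx Gy))) ⟩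
          -[1+ 0 ] ∎)
          where
          d = discriminant y
          d≢0 = elliptic⇒discriminant≢0 (G-elliptic Gy)

      0≤h : ∀ w → + 0 ℤ.≤ h w
      0≤h w = ∑-nonneg (λ y → *-nonneg (indicator-nonneg (G? y)) (indicator-nonneg (centre y ≟ w)))

      -- A centre determines y², so at most two y share it.
      h≤2 : ∀ w → h w ℤ.≤ + 2
      h≤2 w = ℤ.≤-trans (∑-mono pointwise) (ℤ.≤-trans (ℤ.≤-reflexive (roots c)) (ℤ.+-monoʳ-≤ (+ 1) (χ≤1 c)))
        where
        c = 4F + 16F * inv w
        pointwise : ∀ y → g y ℤ.* indicator (centre y ≟ w) ℤ.≤ indicator (y * y ≟ c)
        pointwise y with G? y
        ... | no _ = indicator-nonneg (y * y ≟ c)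
        ... | yes Gy = subst (ℤ._≤ indicator (y * y ≟ c)) (sym (ℤ.*-identityˡ (indicator (centre y ≟ w)))) (indicator-mono (centre y ≟ w) (y * y ≟ c) solve-y)
          where
          d = discriminant y
          d≢0 = elliptic⇒discriminant≢0 (G-elliptic Gy)
          solve-y : centre y ≡ w → y * y ≡ c
          solve-y refl = linear₂ (*-inverseʳ (centre y) (*-nonzero 16≢0 (inv-nonzero d≢0))) (*-inverseʳ d d≢0) (- d) (16F * inv (centre y))
            (solve 3 (λ y i j → y :* y :- (con (+ 4) :+ con (+ 16) :* j) := (:- (y :* y :- con (+ 4))) :* (con (+ 16) :* i :* j :- con (+ 1)) :+ con (+ 16) :* j :* ((y :* y :- con (+ 4)) :* i :- con (+ 1))) refl y (inv d) (inv (centre y)))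

      ∑h : ∑ h ≡ count G?
      ∑h = trans (∑-cong (λ w → sym (ℤ.*-identityʳ (h w)))) (trans (resum (λ _ → + 1)) (∑-cong (λ y → ℤ.*-identityʳ (g y))))

      ∑h² : ∑ (λ w → h w ℤ.* h w) ℤ.≤ + 2 ℤ.* count G?
      ∑h² = ℤ.≤-trans (∑-mono (λ w → ℤ.*-monoʳ-≤-nonNeg (h w) {{ℤ.nonNegative (0≤h w)}} (h≤2 w))) (ℤ.≤-reflexive (trans (∑-* (+ 2) h) (cong (ℤ._*_ (+ 2)) ∑h)))

    -- If no member of B is adjacent to a member of G, then T is as large as possible on all of B, which Bessel's inequality limits.
    mixing : count B? ℤ.* (count G? ℤ.* count G?) ℤ.≤ + 4 ℤ.* (+ p ℤ.* count G?)
    mixing = chain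
      where
      Γ = count G?
      on-B : ∑ (λ x → b x ℤ.* (Γ ℤ.* Γ)) ℤ.≤ ∑ (λ x → T (discriminant x) ℤ.* T (discriminant x))
      on-B = ∑-mono pointwise
        where
        pointwise : ∀ x → b x ℤ.* (Γ ℤ.* Γ) ℤ.≤ T (discriminant x) ℤ.* T (discriminant x)
        pointwise x with B? x
        ... | no _ = square-nonneg (T (discriminant x))
        ... | yes Bx = ℤ.≤-reflexive (trans (ℤS.solve 1 (λ c → ℤS.con (+ 1) ℤS.:* (c ℤS.:* c) ℤS.:= (ℤS.:- c) ℤS.:* (ℤS.:- c)) refl Γ) (sym (cong₂ ℤ._*_ (T-on-B Bx) (T-on-B Bx))))
      T² : F → ℤ
      T² l = T l ℤ.* T l
      -- At most two x have the same x² - 4; this factor 2 and the one from `h≤2` make the 4 of the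
      -- conclusion.
      unfold-squares : ∑ (λ x → T² (discriminant x)) ℤ.≤ + 2 ℤ.* ∑ T²
      unfold-squares = ℤ.≤-trans (ℤ.≤-reflexive (∑-of-squares (λ v → T² (v - 4F)))) (ℤ.≤-trans
        (∑-mono (λ v → ℤ.*-monoʳ-≤-nonNeg (T² (v - 4F)) {{ℤ.nonNegative (square-nonneg (T (v - 4F)))}} (ℤ.+-monoʳ-≤ (+ 1) (χ≤1 v))))
        (ℤ.≤-reflexive (trans (∑-* (+ 2) (λ v → T² (v - 4F))) (cong (ℤ._*_ (+ 2)) (∑-shift T² 4F)))))
      chain : count B? ℤ.* (Γ ℤ.* Γ) ℤ.≤ + 4 ℤ.* (+ p ℤ.* Γ)
      chain = ℤ.≤-trans (ℤ.≤-reflexive (sym (∑-*ʳ (Γ ℤ.* Γ) b))) (ℤ.≤-trans on-B (ℤ.≤-trans unfold-squares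
        (ℤ.≤-trans (ℤ.*-monoˡ-≤-nonNeg (+ 2) (ℤ.≤-trans (bessel h) (ℤ.*-monoˡ-≤-nonNeg (+ p) ∑h²)))
          (ℤ.≤-reflexive (ℤS.solve 2 (λ p c → ℤS.con (+ 2) ℤS.:* (p ℤS.:* (ℤS.con (+ 2) ℤS.:* c)) ℤS.:= ℤS.con (+ 4) ℤS.:* (p ℤS.:* c)) refl (+ p) Γ)))))

  connected : ∀ {X Y} → Regular X → Regular Y → ∃ λ y → ∃ λ y′ → Neighbour X y × Neighbour Y y′ × Adjacent y y′
  connected {X} {Y} RX RY = by-search (search (λ y → search (λ y′ → neighbour? X y ×-dec (neighbour? Y y′ ×-dec adjacent? y y′))))
    where
    by-search : Dec (∃ λ y → ∃ λ y′ → Neighbour X y × Neighbour Y y′ × Adjacent y y′) → ∃ λ y → ∃ λ y′ → Neighbour X y × Neighbour Y y′ × Adjacent y y′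
    by-search (yes path) = path
    by-search (no none) = ⊥-elim (numerical-contradiction ℤ.∣ β ∣ ℤ.∣ γ ∣ q 2^19≤q (bound RX) (bound RY) product)
      where
      β γ : ℤ
      β = count (neighbour? X)
      γ = count (neighbour? Y)
      ∣count∣ : ∀ Z → + ℤ.∣ count (neighbour? Z) ∣ ≡ count (neighbour? Z)
      ∣count∣ Z = ℤ.0≤i⇒+∣i∣≡i (∑-nonneg (λ y → indicator-nonneg (neighbour? Z y)))
      bound : ∀ {Z} → Regular Z → q ℕ.≤ 256 ℕ.* ℤ.∣ count (neighbour? Z) ∣
      bound {Z} R = ℤ.drop‿+≤+ (subst (+ q ℤ.≤_) (trans (cong (ℤ._*_ (+ 256)) (sym (∣count∣ Z))) (sym (ℤ.pos-* 256 ℤ.∣ count (neighbour? Z) ∣))) (neighbour-count R))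
      separated : ∀ {y y′} → Neighbour X y → Neighbour Y y′ → χ (gram y y′) ≡ -[1+ 0 ]
      separated {y} {y′} n n′ = decidable-stable (χ (gram y y′) ℤ.≟ -[1+ 0 ]) (λ adj → none (y , y′ , n , n′ , adj))
      mixed : β ℤ.* (γ ℤ.* γ) ℤ.≤ + 4 ℤ.* (+ p ℤ.* γ)
      mixed = mixing (neighbour? X) (neighbour? Y) (λ n → proj₁ (proj₁ n)) separated
      product : ℤ.∣ β ∣ ℕ.* (ℤ.∣ γ ∣ ℕ.* ℤ.∣ γ ∣) ℕ.≤ 4 ℕ.* (q ℕ.* ℤ.∣ γ ∣)
      product = ℕ.≤-trans (ℤ.drop‿+≤+ (subst₂ ℤ._≤_ left right mixed)) (ℕ.*-monoʳ-≤ 4 (ℕ.*-monoˡ-≤ ℤ.∣ γ ∣ p≤q))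
        where
        left : β ℤ.* (γ ℤ.* γ) ≡ + (ℤ.∣ β ∣ ℕ.* (ℤ.∣ γ ∣ ℕ.* ℤ.∣ γ ∣))
        left = trans (cong₂ (λ s t → s ℤ.* (t ℤ.* t)) (sym (∣count∣ X)) (sym (∣count∣ Y))) (trans (cong (ℤ._*_ (+ ℤ.∣ β ∣)) (sym (ℤ.pos-* ℤ.∣ γ ∣ ℤ.∣ γ ∣))) (sym (ℤ.pos-* ℤ.∣ β ∣ (ℤ.∣ γ ∣ ℕ.* ℤ.∣ γ ∣))))
        right : + 4 ℤ.* (+ p ℤ.* γ) ≡ + (4 ℕ.* (p ℕ.* ℤ.∣ γ ∣))
        right = trans (cong (λ t → + 4 ℤ.* (+ p ℤ.* t)) (sym (∣count∣ Y))) (trans (cong (ℤ._*_ (+ 4)) (sym (ℤ.pos-* p ℤ.∣ γ ∣))) (sym (ℤ.pos-* 4 (p ℕ.* ℤ.∣ γ ∣))))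

-- Integer lifts

module Lifting {p : ℕ} (K : PrimeField p) (m : ℕ) (p+1 : suc p ≡ 2 ℕ.^ (3 ℕ.+ m)) where
  open Rotation K m p+1
  open FullOrbit K m p+1
  open Ring using (solve; _:=_; _:+_; _:*_; _:-_; :-_; con)
  open ≡-Reasoning
  open Orb using (FreeBelow)

  -- The substitution X = 3x turns x² + y² + z² = 3xyz into X² + Y² + Z² = XYZ.
  scaled : ℤ → F
  scaled x = ⟦ + 3 ℤ.* x ⟧

  Lifts : F → F × F → Set
  Lifts X (Y , Z) = ∃ λ a → ∃ λ b → ∃ λ c → markov a b c ≡ + 0 × scaled a ≡ X × scaled b ≡ Y × scaled c ≡ Z

  lifts-ρ : ∀ {X v} → Lifts X v → Lifts X (ρ X v)
  lifts-ρ {X} {Y , Z} (a , b , c , e , refl , refl , refl) = a , c , + 3 ℤ.* a ℤ.* c ℤ.- b ,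
    trans (ℤS.solve 3 (λ a b c → a ℤS.:* a ℤS.:+ c ℤS.:* c ℤS.:+ (ℤS.con (+ 3) ℤS.:* a ℤS.:* c ℤS.:- b) ℤS.:* (ℤS.con (+ 3) ℤS.:* a ℤS.:* c ℤS.:- b) ℤS.:- ℤS.con (+ 3) ℤS.:* a ℤS.:* c ℤS.:* (ℤS.con (+ 3) ℤS.:* a ℤS.:* c ℤS.:- b)
      ℤS.:= a ℤS.:* a ℤS.:+ b ℤS.:* b ℤS.:+ c ℤS.:* c ℤS.:- ℤS.con (+ 3) ℤS.:* a ℤS.:* b ℤS.:* c) refl a b c) e ,
    refl , refl , (begin
      ⟦ + 3 ℤ.* (+ 3 ℤ.* a ℤ.* c ℤ.- b) ⟧ ≡⟨ cong ⟦_⟧ (ℤS.solve 3 (λ a b c → ℤS.con (+ 3) ℤS.:* (ℤS.con (+ 3) ℤS.:* a ℤS.:* c ℤS.:- b) ℤS.:= (ℤS.con (+ 3) ℤS.:* a) ℤS.:* (ℤS.con (+ 3) ℤS.:* c) ℤS.:+ (ℤS.:- (ℤS.con (+ 3) ℤS.:* b))) refl a b c) ⟩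
      ⟦ (+ 3 ℤ.* a) ℤ.* (+ 3 ℤ.* c) ℤ.+ ℤ.- (+ 3 ℤ.* b) ⟧ ≡⟨ +-homo ((+ 3 ℤ.* a) ℤ.* (+ 3 ℤ.* c)) (ℤ.- (+ 3 ℤ.* b)) ⟩
      ⟦ (+ 3 ℤ.* a) ℤ.* (+ 3 ℤ.* c) ⟧ + ⟦ ℤ.- (+ 3 ℤ.* b) ⟧ ≡⟨ cong₂ _+_ (*-homo (+ 3 ℤ.* a) (+ 3 ℤ.* c)) (-‿homo (+ 3 ℤ.* b)) ⟩
      scaled a * scaled c - scaled b ∎)

  lifts-swap : ∀ {X Y Z} → Lifts X (Y , Z) → Lifts X (Z , Y)
  lifts-swap (a , b , c , e , ea , eb , ec) = a , c , b , trans (ℤS.solve 3 (λ a b c → a ℤS.:* a ℤS.:+ c ℤS.:* c ℤS.:+ b ℤS.:* b ℤS.:- ℤS.con (+ 3) ℤS.:* a ℤS.:* c ℤS.:* b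
    ℤS.:= a ℤS.:* a ℤS.:+ b ℤS.:* b ℤS.:+ c ℤS.:* c ℤS.:- ℤS.con (+ 3) ℤS.:* a ℤS.:* b ℤS.:* c) refl a b c) e , ea , ec , eb

  lifts-exchange : ∀ {X Y Z} → Lifts X (Y , Z) → Lifts Y (X , Z)
  lifts-exchange (a , b , c , e , ea , eb , ec) = b , a , c , trans (ℤS.solve 3 (λ a b c → b ℤS.:* b ℤS.:+ a ℤS.:* a ℤS.:+ c ℤS.:* c ℤS.:- ℤS.con (+ 3) ℤS.:* b ℤS.:* a ℤS.:* c
    ℤS.:= a ℤS.:* a ℤS.:+ b ℤS.:* b ℤS.:+ c ℤS.:* c ℤS.:- ℤS.con (+ 3) ℤS.:* a ℤS.:* b ℤS.:* c) refl a b c) e , eb , ea , ec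

  lifts-iterate : ∀ {X v} i → Lifts X v → Lifts X (iterate (ρ X) i v)
  lifts-iterate {X} {v} i = iterate-preserves (Lifts X) (λ {w} → lifts-ρ {X} {w}) i {v}

  conic-exchange : ∀ {X Y Z} → OnConic X (Y , Z) → OnConic Y (X , Z)
  conic-exchange {X} {Y} {Z} h = linear h 1F (solve 3 (λ X Y Z → Y :* Y :+ X :* X :+ Z :* Z :- Y :* X :* Z := con (+ 1) :* (X :* X :+ Y :* Y :+ Z :* Z :- X :* Y :* Z)) refl X Y Z)

  markov-homo : ∀ a b c → ⟦ markov a b c ⟧ ≡ ⟦ a ⟧ * ⟦ a ⟧ + ⟦ b ⟧ * ⟦ b ⟧ + ⟦ c ⟧ * ⟦ c ⟧ - 3F * ⟦ a ⟧ * ⟦ b ⟧ * ⟦ c ⟧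
  markov-homo a b c = trans (+-homo (a ℤ.* a ℤ.+ b ℤ.* b ℤ.+ c ℤ.* c) (ℤ.- (+ 3 ℤ.* a ℤ.* b ℤ.* c))) (cong₂ _+_
    (trans (+-homo (a ℤ.* a ℤ.+ b ℤ.* b) (c ℤ.* c)) (cong₂ _+_ (trans (+-homo (a ℤ.* a) (b ℤ.* b)) (cong₂ _+_ (*-homo a a) (*-homo b b))) (*-homo c c)))
    (trans (-‿homo (+ 3 ℤ.* a ℤ.* b ℤ.* c)) (cong -_ (trans (*-homo (+ 3 ℤ.* a ℤ.* b) c) (cong (_* ⟦ c ⟧) (trans (*-homo (+ 3 ℤ.* a) b) (cong (_* ⟦ b ⟧) (*-homo (+ 3) a))))))))

  markov⇒conic : ∀ a b c → markov a b c ≡ + 0 [mod p ] → OnConic (scaled a) (scaled b , scaled c)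
  markov⇒conic a b c h = subst₂ (λ X v → OnConic X v) (sym (*-homo (+ 3) a)) (cong₂ _,_ (sym (*-homo (+ 3) b)) (sym (*-homo (+ 3) c)))
    (linear (trans (sym (markov-homo a b c)) (⟦⟧-cong (markov a b c) (+ 0) h)) ⟦ + 9 ⟧
      (solve 3 (λ a b c → (con (+ 3) :* a) :* (con (+ 3) :* a) :+ (con (+ 3) :* b) :* (con (+ 3) :* b) :+ (con (+ 3) :* c) :* (con (+ 3) :* c) :- (con (+ 3) :* a) :* (con (+ 3) :* b) :* (con (+ 3) :* c)
        := con (+ 9) :* (a :* a :+ b :* b :+ c :* c :- con (+ 3) :* a :* b :* c :- con (+ 0))) refl ⟦ a ⟧ ⟦ b ⟧ ⟦ c ⟧))

  lift⇒conic : ∀ {X v} → Lifts X v → OnConic X v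
  lift⇒conic (a , b , c , e , refl , refl , refl) = markov⇒conic a b c (subst (λ i → i ≡ + 0 [mod p ]) (sym e) (p ℕ.∣0))

  scaled-injective : ∀ a b → scaled a ≡ scaled b → a ≡ b [mod p ]
  scaled-injective a b h = ⟦⟧-injective a b (*-cancelˡ (small-nonzero 3 (ℕ.m≤m+n 3 3)) (trans (sym (*-homo (+ 3) a)) (trans h (*-homo (+ 3) b))))

  -- The matrix is that of ρ with X = 3x, so the columns of its powers are the orbits of the two
  -- basis vectors.
  entries : ∀ x k → (⟦ m11 (Mx x ^ᴹ k) ⟧ , ⟦ m21 (Mx x ^ᴹ k) ⟧) ≡ iterate (ρ (scaled x)) k (1F , 0F)
                  × (⟦ m12 (Mx x ^ᴹ k) ⟧ , ⟦ m22 (Mx x ^ᴹ k) ⟧) ≡ iterate (ρ (scaled x)) k (0F , 1F)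
  entries x zero = refl , refl
  entries x (suc k) = trans (column (m11 (Mx x ^ᴹ k)) (m21 (Mx x ^ᴹ k))) (cong (ρ (scaled x)) (proj₁ (entries x k)))
                    , trans (column (m12 (Mx x ^ᴹ k)) (m22 (Mx x ^ᴹ k))) (cong (ρ (scaled x)) (proj₂ (entries x k)))
    where
    column : ∀ s t → (⟦ + 0 ℤ.* s ℤ.+ + 1 ℤ.* t ⟧ , ⟦ ℤ.- (+ 1) ℤ.* s ℤ.+ (+ 3 ℤ.* x) ℤ.* t ⟧) ≡ ρ (scaled x) (⟦ s ⟧ , ⟦ t ⟧)
    column s t = cong₂ _,_
      (cong ⟦_⟧ (ℤS.solve 2 (λ s t → ℤS.con (+ 0) ℤS.:* s ℤS.:+ ℤS.con (+ 1) ℤS.:* t ℤS.:= t) refl s t))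
      (trans (cong ⟦_⟧ (ℤS.solve 3 (λ s t x → ℤS.con -[1+ 0 ] ℤS.:* s ℤS.:+ x ℤS.:* t ℤS.:= x ℤS.:* t ℤS.:+ (ℤS.:- s)) refl s t (+ 3 ℤ.* x)))
        (trans (+-homo ((+ 3 ℤ.* x) ℤ.* t) (ℤ.- s)) (cong₂ _+_ (*-homo (+ 3 ℤ.* x) t) (-‿homo s))))

  period⇒identity : ∀ x k → (∀ w → iterate (ρ (scaled x)) k w ≡ w) → (Mx x ^ᴹ k) ≡ᴹ I₂ [mod p ]
  period⇒identity x k h =
      ⟦⟧-injective (m11 (Mx x ^ᴹ k)) (+ 1) (cong proj₁ first) , ⟦⟧-injective (m12 (Mx x ^ᴹ k)) (+ 0) (cong proj₁ second)
    , ⟦⟧-injective (m21 (Mx x ^ᴹ k)) (+ 0) (cong proj₂ first) , ⟦⟧-injective (m22 (Mx x ^ᴹ k)) (+ 1) (cong proj₂ second)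
    where
    first = trans (proj₁ (entries x k)) (h (1F , 0F))
    second = trans (proj₂ (entries x k)) (h (0F , 1F))

  FullOrder : F → Set
  FullOrder X = ∀ k → 0 ℕ.< k → k ℕ.< suc p → ¬ (∀ w → iterate (ρ X) k w ≡ w)

  order⇒fullOrder : ∀ x → OrderAtLeast p (Mx x) (p ℕ.+ 1) → FullOrder (scaled x)
  order⇒fullOrder x order k 0<k k<p+1 h = order k 0<k (subst (k ℕ.<_) (ℕ.+-comm 1 p) k<p+1) (period⇒identity x k h)

  -- For X = 0 the rotation is (y , z) ↦ (z , -y), of order 4 < p + 1.
  fullOrder⇒nonzero : ∀ {X} → FullOrder X → X ≢ 0F
  fullOrder⇒nonzero order refl = order 4 (ℕ.s≤s ℕ.z≤n) (ℕ.s≤s (ℕ.≤-trans (ℕ.m≤m+n 4 3) 7≤p)) λ (y , z) → cong₂ _,_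
    (solve 2 (λ y z → con (+ 0) :* (con (+ 0) :* (con (+ 0) :* z :- y) :- z) :- (con (+ 0) :* z :- y) := y) refl y z)
    (solve 2 (λ y z → con (+ 0) :* (con (+ 0) :* (con (+ 0) :* (con (+ 0) :* z :- y) :- z) :- (con (+ 0) :* z :- y)) :- (con (+ 0) :* (con (+ 0) :* z :- y) :- z) := z) refl y z)

  module _ {X} (order : FullOrder X) where
    X≢0 : X ≢ 0F
    X≢0 = fullOrder⇒nonzero order

    free : ∀ {v} → OnConic X v → FreeBelow X (suc p) v
    free {v} Cv k 0<k k<q h = order k 0<k k<q (fixes-one⇒fixes-all X k (conic-form {X} {v} X≢0 Cv) h)

    fullOrder⇒elliptic : ∀ {v} → OnConic X v → Elliptic X
    fullOrder⇒elliptic {v} Cv = full-orbit⇒elliptic {X} {v} X≢0 Cv (free {v} Cv)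

    -- Trace 2 after j doublings would make the 2^j-th power of ρ the identity, although 2^j < p +
    -- 1.
    fullOrder-trace : ∀ j {v} → j ℕ.< 3 ℕ.+ m → OnConic X v → iterate trace j X ≢ 2F
    fullOrder-trace j {v} j<n Cv h = order (2 ℕ.^ j) (ℕ.m^n>0 2 j) (subst (2 ℕ.^ j ℕ.<_) (sym p+1) (ℕ.^-monoʳ-< 2 (ℕ.s≤s (ℕ.s≤s ℕ.z≤n)) j<n))
      (trace⇒period X j (fullOrder⇒elliptic {v} Cv) h)

    lift-conic : ∀ {v w} → Lifts X v → OnConic X w → Lifts X w
    lift-conic {v} {w} lift Cw = let i , e = full-orbit {X} {v} X≢0 (lift⇒conic {X} {v} lift) (free {v} (lift⇒conic {X} {v} lift)) {w} Cw
                                 in subst (Lifts X) e (lifts-iterate {X} {v} i lift)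

  lift-solution : (∀ {X w} → FullOrder X → OnConic X w → Lifts X w) → ∀ (x : Fin 3 → ℤ) →
    markov (x zero) (x (suc zero)) (x (suc (suc zero))) ≡ + 0 [mod p ] →
    (∃ λ i → OrderAtLeast p (Mx (x i)) (p ℕ.+ 1)) →
    ∃ λ a → ∃ λ b → ∃ λ c → (markov a b c ≡ + 0) × (a ≡ x zero [mod p ]) × (b ≡ x (suc zero) [mod p ]) × (c ≡ x (suc (suc zero)) [mod p ])
  lift-solution lift x on-surface (i , order) = conclude (lifted i (order⇒fullOrder (x i) order))
    where
    X Y Z : F
    X = scaled (x zero)
    Y = scaled (x (suc zero))
    Z = scaled (x (suc (suc zero)))
    C : OnConic X (Y , Z)
    C = markov⇒conic (x zero) (x (suc zero)) (x (suc (suc zero))) on-surface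
    -- The equation is symmetric, so the coordinate of full order is moved to the first place and
    -- back.
    lifted : ∀ i → FullOrder (scaled (x i)) → Lifts X (Y , Z)
    lifted zero order = lift order C
    lifted (suc zero) order = lifts-exchange (lift order (conic-exchange {X} {Y} {Z} C))
    lifted (suc (suc zero)) order = lifts-swap (lifts-exchange (lift order (conic-exchange {X} {Z} {Y} (swap-conic X {Y , Z} C))))
    conclude : Lifts X (Y , Z) → _
    conclude (a , b , c , e , ea , eb , ec) = a , b , c , e , scaled-injective a (x zero) ea , scaled-injective b (x (suc zero)) eb , scaled-injective c (x (suc (suc zero))) ec

module LiftLarge {p : ℕ} (K : PrimeField p) (k : ℕ) (p+1 : suc p ≡ 2 ℕ.^ (4 ℕ.+ k)) (k≥15 : 15 ℕ.≤ k) (residue : p ℕ.% 5 ≡ 2 ⊎ p ℕ.% 5 ≡ 3) where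
  open Connectivity K k p+1 k≥15
  open Lifting K (suc k) p+1
  open Ring using (solve; _:=_; _:+_; _:*_; _:-_; :-_; con)

  lift-regular : ∀ {X v w} → Regular X → Lifts X v → OnConic X w → Lifts X w
  lift-regular {X} {v} {w} R lift Cw with transitive {X} {v} {w} R (lift⇒conic {X} {v} lift) Cw
  ... | i , inj₁ e = subst (Lifts X) e (lifts-iterate {X} {v} i lift)
  ... | i , inj₂ e = subst (Lifts X) e (lifts-iterate {X} {swap v} i (lifts-swap lift))

  lift-adjacent : ∀ {X Y v} → Regular X → Lifts X v → Adjacent X Y → ∃ λ w → Lifts Y w
  lift-adjacent {X} {Y} {v} R lift adj = let z , Cz = adjacent⇒conic adj in (X , z) , lifts-exchange (lift-regular {X} {v} {Y , z} R lift Cz)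

  adjacent-sym : ∀ {X Y} → Adjacent X Y → Adjacent Y X
  adjacent-sym {X} {Y} adj = adj ∘ trans (cong χ (solve 2 (λ X Y → (X :* X :- con (+ 4)) :* (Y :* Y :- con (+ 4)) :- con (+ 16) := (Y :* Y :- con (+ 4)) :* (X :* X :- con (+ 4)) :- con (+ 16)) refl X Y))

  lift-large : ∀ {X w} → FullOrder X → OnConic X w → Lifts X w
  lift-large {X} {w} order Cw =
    let y , y′ , (Ry , 3~y) , (Ry′ , X~y′) , y~y′ = connected R3 RX
        u , lift-y = lift-adjacent {v = 3F , 3F} R3 (+ 1 , + 1 , + 1 , refl , refl , refl , refl) 3~y
        u′ , lift-y′ = lift-adjacent {v = u} Ry lift-y y~y′
        -- y′ was found as a neighbour of X, so the last link of the chain is traversed backwards.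
        u″ , lift-X = lift-adjacent {v = u′} Ry′ lift-y′ (adjacent-sym X~y′)
    in lift-regular {X} {u″} {w} RX lift-X Cw
    where
    R3 : Regular 3F
    R3 = 3-regular (5-nonsquare residue)
    RX : Regular X
    RX = fullOrder⇒elliptic order {w} Cw , fullOrder-trace order (2 ℕ.+ k) {w} (ℕ.m≤n+m (3 ℕ.+ k) 1) Cw

-- Finite verification for small primes

module LiftSmall {p : ℕ} (K : PrimeField p) (m : ℕ) (p+1 : suc p ≡ 2 ℕ.^ (3 ℕ.+ m)) .{{_ : ℕ.NonZero p}} where
  open Rotation K m p+1
  open Lifting K m p+1
  open Ring using (solve; _:=_; _:+_; _:*_; _:-_; :-_; con)

  -- The map t ↦ t² - 2 on natural representatives, where the finite check can be evaluated; p - 2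
  -- stands for -2.
  traceℕ : ℕ → ℕ
  traceℕ t = (t ℕ.* t ℕ.+ (p ℕ.∸ 2)) ℕ.% p

  -- Either X² − 4 is a square, or X has order at most (p + 1)/2, or X occurs in a tabulated Markov triple.
  Settled : List (ℤ × ℤ × ℤ) → Fin p → Set
  Settled table r = (∃ λ (s : Fin p) → (toℕ s ℕ.* toℕ s ℕ.+ 4) ℕ.% p ≡ (toℕ r ℕ.* toℕ r) ℕ.% p)
    ⊎ iterate traceℕ (2 ℕ.+ m) (toℕ r) ≡ 2
    ⊎ Any (λ (a , b , c) → markov a b c ≡ + 0 × (+ 3 ℤ.* a) %ℕ p ≡ toℕ r) table

  settled? : ∀ table r → Dec (Settled table r)
  settled? table r = Fin.any? (λ s → (toℕ s ℕ.* toℕ s ℕ.+ 4) ℕ.% p ℕ.≟ (toℕ r ℕ.* toℕ r) ℕ.% p)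
    ⊎-dec (iterate traceℕ (2 ℕ.+ m) (toℕ r) ℕ.≟ 2
    ⊎-dec Any.any? (λ (a , b , c) → (markov a b c ℤ.≟ + 0) ×-dec ((+ 3 ℤ.* a) %ℕ p ℕ.≟ toℕ r)) table)

  private
    ⟦%⟧ : ∀ a → ⟦ + (a %ℕ p) ⟧ ≡ ⟦ a ⟧
    ⟦%⟧ a = sym (⟦⟧-cong a (+ (a %ℕ p)) (∣⇒∣ᵤ (divides (a /ℕ p) (trans (cong (ℤ._- + (a %ℕ p)) (a≡a%ℕn+[a/ℕn]*n a p))
      (ℤS.solve 2 (λ u v → (u ℤS.:+ v) ℤS.:- u ℤS.:= v) refl (+ (a %ℕ p)) ((a /ℕ p) ℤ.* + p))))))

    ⟦+⟧ : ∀ a b → ⟦ + (a ℕ.+ b) ⟧ ≡ ⟦ + a ⟧ + ⟦ + b ⟧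
    ⟦+⟧ a b = +-homo (+ a) (+ b)

    ⟦*⟧ : ∀ a b → ⟦ + (a ℕ.* b) ⟧ ≡ ⟦ + a ⟧ * ⟦ + b ⟧
    ⟦*⟧ a b = trans (cong ⟦_⟧ (ℤ.pos-* a b)) (*-homo (+ a) (+ b))

    ⟦p-2⟧ : ⟦ + (p ℕ.∸ 2) ⟧ ≡ - 2F
    ⟦p-2⟧ = linear (trans (sym (⟦+⟧ (p ℕ.∸ 2) 2)) (trans (cong (λ i → ⟦ + i ⟧) (ℕ.m∸n+n≡m (ℕ.≤-trans (ℕ.m≤m+n 2 5) 7≤p))) p≡0)) 1F
      (solve 1 (λ r → r :- (:- con (+ 2)) := con (+ 1) :* (r :+ con (+ 2) :- con (+ 0))) refl ⟦ + (p ℕ.∸ 2) ⟧)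
      where
      p≡0 : ⟦ + p ⟧ ≡ 0F
      p≡0 = ⟦⟧-cong (+ p) (+ 0) (subst (p ℕ.∣_) (cong ℤ.∣_∣ (sym (ℤ.+-identityʳ (+ p)))) ℕ.∣-refl)

    ⟦traceℕ⟧ : ∀ j t → ⟦ + iterate traceℕ j t ⟧ ≡ iterate trace j ⟦ + t ⟧
    ⟦traceℕ⟧ zero t = refl
    ⟦traceℕ⟧ (suc j) t = trans (⟦%⟧ (+ (u ℕ.* u ℕ.+ (p ℕ.∸ 2)))) (trans (⟦+⟧ (u ℕ.* u) (p ℕ.∸ 2)) (cong₂ _+_ (trans (⟦*⟧ u u) (cong₂ _*_ (⟦traceℕ⟧ j t) (⟦traceℕ⟧ j t))) ⟦p-2⟧))
      where u = iterate traceℕ j t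

  lift-small : ∀ table → (∀ r → Settled table r) → ∀ {X w} → FullOrder X → OnConic X w → Lifts X w
  lift-small table settled {X} {w} order Cw = by-cases (settled X)
    where
    by-cases : Settled table X → Lifts X w
    by-cases (inj₁ (s , e)) = ⊥-elim (-1⇒nonsquare (fullOrder⇒elliptic order {w} Cw) (⟦ + toℕ s ⟧ , linear squares 1F
      (solve 2 (λ s X → s :* s :- (X :* X :- con (+ 4)) := con (+ 1) :* (s :* s :+ con (+ 4) :- X :* X)) refl ⟦ + toℕ s ⟧ X)))
      where
      squares : ⟦ + toℕ s ⟧ * ⟦ + toℕ s ⟧ + 4F ≡ X * X
      squares = trans (cong (_+ 4F) (sym (⟦*⟧ (toℕ s) (toℕ s)))) (trans (sym (⟦+⟧ (toℕ s ℕ.* toℕ s) 4)) (trans (sym (⟦%⟧ (+ (toℕ s ℕ.* toℕ s ℕ.+ 4))))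
        (trans (cong (λ i → ⟦ + i ⟧) e) (trans (⟦%⟧ (+ (toℕ X ℕ.* toℕ X))) (trans (⟦*⟧ (toℕ X) (toℕ X)) (cong₂ _*_ (⟦toℕ⟧ X) (⟦toℕ⟧ X)))))))
    by-cases (inj₂ (inj₁ e)) = ⊥-elim (fullOrder-trace order (2 ℕ.+ m) {w} (ℕ.n<1+n (2 ℕ.+ m)) Cw
      (trans (cong (iterate trace (2 ℕ.+ m)) (sym (⟦toℕ⟧ X))) (trans (sym (⟦traceℕ⟧ (2 ℕ.+ m) (toℕ X))) (cong (λ i → ⟦ + i ⟧) e))))
    by-cases (inj₂ (inj₂ found)) = let (a , b , c) , e , r = Any.satisfied found in
      lift-conic order {scaled b , scaled c} {w} (a , b , c , e , trans (sym (⟦%⟧ (+ 3 ℤ.* a))) (trans (cong (λ i → ⟦ + i ⟧) r) (⟦toℕ⟧ X)) , refl , refl) Cw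

-- Small exponents and the conclusion

open import Data.Nat using (_+_; _^_; _∸_; _>_; _%_)

-- Found by a search of the Markov tree: for p = 7 and p = 127, every X of full order is congruent to 3a for one of these.
markov-triples : List (ℤ × ℤ × ℤ)
-- Changing two signs preserves the equation, so -X is covered along with X.
markov-triples = positive ++ map (λ (a , b , c) → ℤ.- a , ℤ.- b , c) positive
  where
  positive : List (ℤ × ℤ × ℤ)
  positive = (+ 1 , + 1 , + 1) ∷ (+ 1325 , + 13 , + 34) ∷ (+ 233 , + 1 , + 89) ∷ (+ 135137 , + 34 , + 1325)
    ∷ (+ 5741 , + 2 , + 985) ∷ (+ 8399329 , + 433 , + 6466) ∷ (+ 610 , + 1 , + 233) ∷ (+ 16964653 , + 985 , + 5741)
    ∷ (+ 162930183509 , + 6466 , + 8399329) ∷ (+ 94418953 , + 34 , + 925765) ∷ (+ 1405695061 , + 34 , + 13782649)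
    ∷ (+ 82561235448866 , + 433 , + 63557570729) ∷ (+ 624740857339396181 , + 37666 , + 5528778008357)
    ∷ (+ 8487613404424009 , + 1325 , + 2135248790338) ∷ (+ 10881286283486669 , + 43261 , + 83842154089)
    ∷ (+ 93139301545921 , + 1441889 , + 21531778) ∷ []

module _ (p : ℕ) (pr : Prime p) (m : ℕ) (p+1 : suc p ≡ 2 ^ (3 + m)) where
  open Lifting (primeField p pr) m p+1 using (lift-solution) public

abstract
  settled-7 : (pr : Prime 7) → ∀ r → LiftSmall.Settled (primeField 7 pr) 0 refl markov-triples r
  settled-7 pr = from-yes (Fin.all? (LiftSmall.settled? (primeField 7 pr) 0 refl markov-triples))

  settled-127 : (pr : Prime 127) → ∀ r → LiftSmall.Settled (primeField 127 pr) 4 refl markov-triples r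
  settled-127 pr = from-yes (Fin.all? (LiftSmall.settled? (primeField 127 pr) 4 refl markov-triples))

-- The divisors up to 23 are needed for 2¹¹ − 1 = 23 · 89.
Excluded : ℕ → Set
Excluded N = N ℕ.≤ 5 ⊎ ¬ (N % 5 ≡ 2 ⊎ N % 5 ≡ 3) ⊎ ∃ λ (d : Fin 24) → 1 ℕ.< toℕ d × toℕ d ℕ.< N × toℕ d ℕ.∣ N

excluded? : ∀ N → Dec (Excluded N)
excluded? N = (N ℕ.≤? 5) ⊎-dec (¬? ((N % 5 ℕ.≟ 2) ⊎-dec (N % 5 ℕ.≟ 3))
  ⊎-dec Fin.any? (λ d → (1 ℕ.<? toℕ d) ×-dec ((toℕ d ℕ.<? N) ×-dec (toℕ d ℕ.∣? N))))

abstract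
  -- 2^n - 1 is 2 or 3 modulo 5 only for n ≡ 3 or 2 modulo 4. Even n give multiples of 3, and 2^15 -
  -- 1 is a multiple of 7.
  small-exponents : ∀ (n : Fin 19) → toℕ n ≡ 3 ⊎ toℕ n ≡ 7 ⊎ Excluded (2 ^ toℕ n ∸ 1)
  small-exponents = from-yes (Fin.all? (λ (n : Fin 19) → (toℕ n ℕ.≟ 3) ⊎-dec ((toℕ n ℕ.≟ 7) ⊎-dec excluded? (2 ^ toℕ n ∸ 1))))

not-excluded : ∀ {p} → Prime p → p > 5 → (p % 5 ≡ 2 ⊎ p % 5 ≡ 3) → ¬ Excluded p
not-excluded pr p>5 residue (inj₁ p≤5) = ℕ.<⇒≱ p>5 p≤5
not-excluded pr p>5 residue (inj₂ (inj₁ ¬residue)) = ¬residue residue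
not-excluded pr p>5 residue (inj₂ (inj₂ (d , 1<d , d<p , d∣p))) with prime⇒irreducible pr d∣p
... | inj₁ d≡1 = ℕ.<⇒≢ 1<d (sym d≡1)
... | inj₂ d≡p = ℕ.<⇒≢ d<p d≡p

theorem1p1 : (p : ℕ) → Prime p → p > 5 → (∃ λ n → p ≡ 2 ^ n ∸ 1)
    → (p % 5 ≡ 2 ⊎ p % 5 ≡ 3)
    → (x : Fin 3 → ℤ)
    → markov (x zero) (x (suc zero)) (x (suc (suc zero))) ≡ + 0 [mod p ]
    → (∃ λ (i : Fin 3) → OrderAtLeast p (Mx (x i)) (p + 1))
    → ∃ λ (a : ℤ) → ∃ λ (b : ℤ) → ∃ λ (c : ℤ) →
    (markov a b c ≡ + 0)
    × (a ≡ x zero [mod p ]) × (b ≡ x (suc zero) [mod p ]) × (c ≡ x (suc (suc zero)) [mod p ])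
theorem1p1 p pr p>5 (n , p≡2^n-1) residue with n ℕ.<? 19
-- The threshold n ≥ 19 is the bound p + 1 ≥ 2^19 of `numerical-contradiction`; in terms of k = n -
-- 4 it reads k ≥ 15.
... | no n≮19 = lift-solution p pr (suc k) p+1 (LiftLarge.lift-large (primeField p pr) k p+1 (ℕ.∸-monoˡ-≤ 4 (ℕ.≮⇒≥ n≮19)) residue)
  where
  k = n ∸ 4
  p+1 : suc p ≡ 2 ^ (4 + k)
  p+1 = trans (trans (ℕ.+-comm 1 p) (trans (cong (_+ 1) p≡2^n-1) (ℕ.m∸n+n≡m (ℕ.m^n>0 2 n)))) (cong (2 ^_) (sym (ℕ.m+[n∸m]≡n (ℕ.≤-trans (ℕ.m≤m+n 4 15) (ℕ.≮⇒≥ n≮19)))))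
... | yes n<19 with small-exponents (fromℕ< n<19)
...   | inj₂ (inj₂ excluded) = ⊥-elim (not-excluded pr p>5 residue (subst Excluded (trans (cong (λ i → 2 ^ i ∸ 1) (Fin.toℕ-fromℕ< n<19)) (sym p≡2^n-1)) excluded))
...   | inj₁ n≡3 with trans (sym (Fin.toℕ-fromℕ< n<19)) n≡3
theorem1p1 p pr p>5 (n , refl) residue | yes n<19 | inj₁ n≡3 | refl = lift-solution 7 pr 0 refl (LiftSmall.lift-small (primeField 7 pr) 0 refl markov-triples (settled-7 pr))
theorem1p1 p pr p>5 (n , p≡2^n-1) residue | yes n<19 | inj₂ (inj₁ n≡7) with trans (sym (Fin.toℕ-fromℕ< n<19)) n≡7
theorem1p1 p pr p>5 (n , refl) residue | yes n<19 | inj₂ (inj₁ n≡7) | refl = lift-solution 127 pr 4 refl (LiftSmall.lift-small (primeField 127 pr) 4 refl markov-triples (settled-127 pr))
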